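{- Let $p\ge5$ be a prime and let $E\in\mathbb{F}_p$, $E\neq0$. The Vieta graph of the quartic $(x+y+z+t)^2=Exyzt$ over $\mathbb{F}_p$ has $p^3-1-\sigma(E)p$ vertices in total; it has $4\big((p-3)^2-2\sigma(-E)(p-3)\big)$ vertices of degree $3$, $6\big(1+\sigma(-E)\big)(p-3)$ vertices of degree $2$, $4\big(p^2-3p+3+\sigma(-E)\big)$ vertices of degree $1$, and $6p-5$ vertices of degree $0$.
   Context: $\sigma:\mathbb{F}_p\to\{ -1,0,1\}\subset\mathbb{Z}$ denotes the quadratic character: $\sigma(a)=1$ if $a$ is a nonzero square, $\sigma(a)=-1$ if $a$ is a non-square, $\sigma(0)=0$. Let $f(x_1,x_2,x_3,x_4)=(x_1+x_2+x_3+x_4)^2-Ex_1x_2x_3x_4$, which is monic quadratic in each variable. The $i$-th Vieta flip of a solution $x=(x_1,\dots,x_4)\in\mathbb{F}_p^4$ of $f=0$ is the solution obtained by replacing $x_i$ by the other root $x_i'=x_i-(\partial_i f)(x)$ of $f=0$ viewed as a quadratic equation in $x_i$. The Vieta graph is the finite simple graph whose vertices are the solutions of $f=0$ in $\mathbb{F}_p^4$, where two distinct vertices are joined by an edge whenever one is a Vieta flip of the other. -}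

module Defs where

open import Data.Fin using (Fin; zero; suc; toℕ)
import Data.Fin.Properties as Fin
open import Data.Integer using (ℤ; 0ℤ; 1ℤ; -1ℤ)
open import Data.List
  using (List; []; _∷_; length; filter; cartesianProductWith; allFin)
open import Data.List.Membership.Propositional using (_∈_)
open import Data.List.Membership.Propositional.Properties
  using (∈-cartesianProductWith⁺; ∈-allFin; ∈-filter⁺; ∈-filter⁻)
open import Data.List.Relation.Unary.All using ([])
open import Data.List.Relation.Unary.AllPairs using ([]; _∷_)
open import Data.List.Relation.Unary.Any using (here)
open import Data.List.Relation.Unary.Unique.Propositional using (Unique)
import Data.List.Relation.Unary.Unique.Propositional.Properties as Unique
open import Data.Nat as ℕ using (ℕ; zero; suc; NonZero; _∸_)
open import Data.Nat.DivMod using (_mod_)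
open import Data.Product using (_×_; _,_; ∃; proj₂)
open import Data.Sum using (_⊎_; swap)
open import Data.Vec using (Vec; []; _∷_; lookup; _[_]≔_)
open import Data.Vec.Properties using (≡-dec; ∷-injective)
open import Function.Bundles using (_⇔_; mk⇔)
open import Relation.Binary using (Rel; Decidable; Symmetric; Irreflexive)
open import Relation.Binary.PropositionalEquality
  using (_≡_; _≢_; refl; sym)
open import Relation.Nullary using (Dec; yes; no; ¬?; _×-dec_; _⊎-dec_)
open import Level using (0ℓ)

-- The vertex set is the finite subset of A enumerated by `vertices`;
-- only the restriction of `_~_` to it matters.
record SimpleGraph (A : Set) : Set₁ where
  field
    vertices : List A
    unique   : Unique vertices
    _~_      : Rel A 0ℓ
    _~?_     : Decidable _~_
    ~-sym    : Symmetric _~_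
    ~-irrefl : Irreflexive _≡_ _~_

  order : ℕ
  order = length vertices

  degree : A → ℕ
  degree x = length (filter (x ~?_) vertices)

  #ofDegree : ℕ → ℕ
  #ofDegree d = length (filter (λ x → degree x ℕ.≟ d) vertices)

-- Residues modulo p.
𝔽 : ℕ → Set
𝔽 = Fin

module _ {p : ℕ} .{{_ : NonZero p}} where

  infixl 6 _+ₚ_ _-ₚ_
  infixl 7 _*ₚ_
  infix  8 -ₚ_

  0ₚ 1ₚ : 𝔽 p
  0ₚ = 0 mod p
  1ₚ = 1 mod p

  _+ₚ_ _-ₚ_ _*ₚ_ : 𝔽 p → 𝔽 p → 𝔽 p
  a +ₚ b = (toℕ a ℕ.+ toℕ b) mod p
  a -ₚ b = (toℕ a ℕ.+ (p ∸ toℕ b)) mod p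
  a *ₚ b = (toℕ a ℕ.* toℕ b) mod p

  -ₚ_ : 𝔽 p → 𝔽 p
  -ₚ a = 0ₚ -ₚ a

  IsSquare : 𝔽 p → Set
  IsSquare a = ∃ λ (b : 𝔽 p) → b *ₚ b ≡ a

  isSquare? : (a : 𝔽 p) → Dec (IsSquare a)
  isSquare? a = Fin.any? (λ b → b *ₚ b Fin.≟ a)

  σ : 𝔽 p → ℤ
  σ a with a Fin.≟ 0ₚ | isSquare? a
  ... | yes _ | _     = 0ℤ
  ... | no  _ | yes _ = 1ℤ
  ... | no  _ | no  _ = -1ℤ

-- Syntactic polynomials in n variables, so that ∂ is formal differentiation.
infixl 6 _⊕_ _⊖_
infixl 7 _⊗_

data Poly (p n : ℕ) : Set where
  con         : 𝔽 p → Poly p n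
  var         : Fin n → Poly p n
  _⊕_ _⊖_ _⊗_ : Poly p n → Poly p n → Poly p n

module _ {p n : ℕ} .{{_ : NonZero p}} where

  eval : Poly p n → Vec (𝔽 p) n → 𝔽 p
  eval (con c) x = c
  eval (var i) x = lookup x i
  eval (g ⊕ h) x = eval g x +ₚ eval h x
  eval (g ⊖ h) x = eval g x -ₚ eval h x
  eval (g ⊗ h) x = eval g x *ₚ eval h x

  ∂ : Fin n → Poly p n → Poly p n
  ∂ i (con c) = con 0ₚ
  ∂ i (var j) with i Fin.≟ j
  ... | yes _ = con 1ₚ
  ... | no  _ = con 0ₚ
  ∂ i (g ⊕ h) = ∂ i g ⊕ ∂ i h
  ∂ i (g ⊖ h) = ∂ i g ⊖ ∂ i h
  ∂ i (g ⊗ h) = ∂ i g ⊗ h ⊕ g ⊗ ∂ i h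

vectors : (p n : ℕ) → List (Vec (𝔽 p) n)
vectors p zero    = [] ∷ []
vectors p (suc n) = cartesianProductWith _∷_ (allFin p) (vectors p n)

∈-vectors : ∀ {p n} (x : Vec (𝔽 p) n) → x ∈ vectors p n
∈-vectors []      = here refl
∈-vectors (a ∷ x) = ∈-cartesianProductWith⁺ _∷_ (∈-allFin a) (∈-vectors x)

vectors-unique : ∀ p n → Unique (vectors p n)
vectors-unique p zero    = [] ∷ []
vectors-unique p (suc n) =
  Unique.cartesianProductWith⁺ _∷_ ∷-injective
    (Unique.allFin⁺ p) (vectors-unique p n)

module _ {p : ℕ} .{{_ : NonZero p}} (E : 𝔽 p) where

  quartic : Poly p 4
  quartic = s ⊗ s ⊖ con E ⊗ x₁ ⊗ x₂ ⊗ x₃ ⊗ x₄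
    where
    x₁ x₂ x₃ x₄ s : Poly p 4
    x₁ = var zero
    x₂ = var (suc zero)
    x₃ = var (suc (suc zero))
    x₄ = var (suc (suc (suc zero)))
    s  = x₁ ⊕ x₂ ⊕ x₃ ⊕ x₄

  IsSolution : Vec (𝔽 p) 4 → Set
  IsSolution x = eval quartic x ≡ 0ₚ

  isSolution? : ∀ x → Dec (IsSolution x)
  isSolution? x = eval quartic x Fin.≟ 0ₚ

  solutions : List (Vec (𝔽 p) 4)
  solutions = filter isSolution? (vectors p 4)

  ∈-solutions : ∀ {x} → x ∈ solutions ⇔ IsSolution x
  ∈-solutions {x} = mk⇔
    (λ x∈ → proj₂ (∈-filter⁻ isSolution? {xs = vectors p 4} x∈))
    (∈-filter⁺ isSolution? (∈-vectors x))

  flip : Fin 4 → Vec (𝔽 p) 4 → Vec (𝔽 p) 4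
  flip i x = x [ i ]≔ (lookup x i -ₚ eval (∂ i quartic) x)

  Adjacent : Rel (Vec (𝔽 p) 4) 0ℓ
  Adjacent x y = x ≢ y × ∃ λ i → y ≡ flip i x ⊎ x ≡ flip i y

  adjacent? : Decidable Adjacent
  adjacent? x y =
    ¬? (x ≟ y) ×-dec Fin.any? (λ i → (y ≟ flip i x) ⊎-dec (x ≟ flip i y))
    where
    _≟_ : Decidable {A = Vec (𝔽 p) 4} _≡_
    _≟_ = ≡-dec Fin._≟_

  vietaGraph : SimpleGraph (Vec (𝔽 p) 4)
  vietaGraph = record
    { vertices = solutions
    ; unique   = Unique.filter⁺ isSolution? (vectors-unique p 4)
    ; _~_      = Adjacent
    ; _~?_     = adjacent?
    ; ~-sym    = λ (x≢y , i , e) → (λ y≡x → x≢y (sym y≡x)) , i , swap e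
    ; ~-irrefl = λ x≡y (x≢y , _) → x≢y x≡y
    }

{-# OPTIONS --safe #-}
module Submission where

-- Counts are computed as integer sums of indicators over F_p. For a character χ extended by
-- χ(0) = 0, the fourfold convolution V = (χ ⋆ χ) ⋆ (χ ⋆ χ) is constant off 0, so V(1) follows from
-- V(0) and the total mass (Σ χ)⁴. A solution with coordinate sum s ≠ 0 is s times a vector w of
-- sum 1 with 1 = s² E Π w, so the number of solutions reduces to V(1) for the trivial and for the
-- quadratic character.
--
-- On solutions the i-th flip is an involution, it fixes x exactly when ∂ᵢf(x) = 0, and distinct
-- flips that move x give distinct neighbours; hence deg x = #{i : ∂ᵢf(x) ≠ 0}. Since
-- xᵢ ∂ᵢf = s (2 xᵢ - s) on solutions, a solution with nonzero coordinates has degree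
-- 4 - #{i : 2 xᵢ = s}, and these are counted by inclusion–exclusion over the conditions 2 xᵢ = s.
-- A solution with a zero coordinate has s = 0 and ∂ᵢf = -E Π_{j ≠ i} xⱼ, so its degree is 1 if it
-- has exactly one zero coordinate and 0 otherwise.

open import Algebra.Bundles using (CommutativeRing)
import Algebra.Properties.AbelianGroup
import Algebra.Properties.Ring
import Algebra.Properties.Semiring.Mult.TCOptimised
import Algebra.Properties.Semiring.Sum
import Algebra.Solver.Ring
open import Algebra.Solver.Ring.AlmostCommutativeRing
  using (fromCommutativeRing; _-Raw-AlmostCommutative⟶_)
open import Algebra.Structures using (IsCommutativeRing)
open import Data.Bool using (Bool; true; false; not; _∧_; if_then_else_)
open import Data.Fin as Fin using (Fin; zero; suc; toℕ; _≟_)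
open import Data.Fin.Permutation using (permutation)
import Data.Fin.Properties as Fin
open import Data.Integer as ℤ using (ℤ; +_; -[1+_]; 0ℤ; 1ℤ; -1ℤ)
import Data.Integer.Properties as ℤ
open import Data.Integer.Tactic.RingSolver using (solve-∀)
open import Data.List using (List; []; _∷_; length; filter; map; _++_; cartesianProductWith; tabulate; allFin)
open import Data.List.Membership.Propositional using (_∈_)
open import Data.List.Membership.Propositional.Properties
  using (∈-map⁺; ∈-map⁻; ∈-filter⁺; ∈-filter⁻; ∈-allFin)
open import Data.List.Membership.Propositional.Properties.WithK using (unique∧set⇒bag)
open import Data.List.Properties using (filter-++; length-++; length-map)
open import Data.List.Relation.Binary.BagAndSetEquality using (∼bag⇒↭)
open import Data.List.Relation.Binary.Permutation.Propositional.Properties using (↭-length)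
open import Data.List.Relation.Unary.All as All using (All; []; _∷_)
import Data.List.Relation.Unary.All.Properties as All
open import Data.List.Relation.Unary.AllPairs using ([]; _∷_)
open import Data.List.Relation.Unary.Unique.Propositional using (Unique)
import Data.List.Relation.Unary.Unique.Propositional.Properties as Unique
import Data.Maybe as Maybe
open import Data.Nat as ℕ using (ℕ; zero; suc; NonZero; _≥_; _∸_)
open import Data.Nat.Coprimality using (prime⇒coprime; coprime-Bézout)
open import Data.Nat.DivMod as ℕ using (_%_; _mod_)
open import Data.Nat.GCD using (module Bézout)
open import Data.Nat.Primality using (Prime)
import Data.Nat.Properties as ℕ
open import Data.Product using (∃; _,_; proj₁; proj₂)
open import Data.Sum using (_⊎_; inj₁; inj₂; [_,_]′)
open import Data.Vec using (Vec; []; _∷_; lookup; _[_]≔_)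
open import Data.Vec.Properties using (lookup∘update; lookup∘update′; []≔-lookup)
open import Function using (_∘_; id)
open import Function.Bundles using (mk⇔; module Equivalence)
open import Relation.Binary.PropositionalEquality
  using (_≡_; _≢_; refl; sym; trans; cong; cong₂; subst; isEquivalence; module ≡-Reasoning)
open import Relation.Nullary using (Dec; yes; no; does; ¬_; ¬?; contradiction; _×-dec_)
open import Relation.Nullary.Decidable using (does-⇔; dec-true; dec-false; dec⇒maybe)
open import Relation.Unary using (Decidable)

-- The two sides of the equation have degrees 2 and 4, so scaling to total 1 leaves a factor s²; for
-- a fixed w the number of admissible s is 1 + η(E Π w) when Π w ≠ 0. This is where the quadratic
-- character enters the number of vertices. Constancy off 0 comes from χ(t)² = 1 for t ≠ 0. It
-- already holds for the twofold convolution J = χ ⋆ χ, and V(0) is computed from the two values of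
-- J.
--
-- In the degree counts the character has another origin. One condition 2 xᵢ = s makes the equation
-- linear in a remaining coordinate, and the degenerate case of that linear equation is 4 = -E a². A
-- second and a third condition lead to the same equation. It has 1 + η(-E) roots a, so every degree
-- count is a polynomial in p and η(-E).

-- Polynomial identities with integer coefficients over a commutative ring.

module IntegerCoefficients {c ℓ} (R : CommutativeRing c ℓ) where

  open CommutativeRing R hiding (zero) renaming (refl to ≈-refl; sym to ≈-sym; trans to ≈-trans)
  open Algebra.Properties.Ring ring
  open Algebra.Properties.AbelianGroup +-abelianGroup using (⁻¹-∙-comm)
  open Algebra.Properties.Semiring.Mult.TCOptimised semiring
  open import Relation.Binary.Reasoning.Setoid setoid

  -- With this form of multiple `1 × 1#` reduces to `1#`, so `con 1ℤ` denotes the unit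
  -- definitionally and solved identities fit goals written with the unit.
  ⟦_⟧ : ℤ → Carrier
  ⟦ + n ⟧      = n × 1#
  ⟦ -[1+ n ] ⟧ = - (suc n × 1#)

  suc-× : ∀ n → suc n × 1# ≈ 1# + n × 1#
  suc-× n = ×-homo-+ 1# 1 n

  ⟦⊖⟧ : ∀ m n → ⟦ m ℤ.⊖ n ⟧ ≈ m × 1# - n × 1#
  ⟦⊖⟧ zero    zero    = ≈-sym (-‿inverseʳ 0#)
  ⟦⊖⟧ zero    (suc n) = ≈-sym (+-identityˡ _)
  ⟦⊖⟧ (suc m) zero    = ≈-sym (≈-trans (+-congˡ -0#≈0#) (+-identityʳ _))
  ⟦⊖⟧ (suc m) (suc n) = begin
    ⟦ suc m ℤ.⊖ suc n ⟧              ≡⟨ cong ⟦_⟧ (ℤ.[1+m]⊖[1+n]≡m⊖n m n) ⟩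
    ⟦ m ℤ.⊖ n ⟧                      ≈⟨ ⟦⊖⟧ m n ⟩
    -- The inserted `1# - 1#` supplies one unit to each of the two multiples.
    m × 1# - n × 1#                ≈⟨ +-congʳ (≈-trans (+-congˡ (-‿inverseʳ 1#)) (+-identityʳ _)) ⟨
    m × 1# + (1# - 1#) - n × 1#    ≈⟨ +-congʳ (+-assoc _ _ _) ⟨
    m × 1# + 1# - 1# - n × 1#      ≈⟨ +-assoc _ _ _ ⟩
    m × 1# + 1# + (- 1# - n × 1#)  ≈⟨ +-cong (+-comm _ _) (⁻¹-∙-comm _ _) ⟩
    1# + m × 1# - (1# + n × 1#)    ≈⟨ +-cong (suc-× m) (-‿cong (suc-× n)) ⟨
    suc m × 1# - suc n × 1#        ∎

  ⟦-⟧ : ∀ i → ⟦ ℤ.- i ⟧ ≈ - ⟦ i ⟧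
  ⟦-⟧ (+ zero)  = ≈-sym -0#≈0#
  ⟦-⟧ (+ suc n) = ≈-refl
  ⟦-⟧ -[1+ n ]  = ≈-sym (-‿involutive _)

  ⟦+⟧ : ∀ i j → ⟦ i ℤ.+ j ⟧ ≈ ⟦ i ⟧ + ⟦ j ⟧
  ⟦+⟧ (+ m)    (+ n)    = ×-homo-+ 1# m n
  ⟦+⟧ (+ m)    -[1+ n ] = ⟦⊖⟧ m (suc n)
  ⟦+⟧ -[1+ m ] (+ n)    = ≈-trans (⟦⊖⟧ n (suc m)) (+-comm _ _)
  ⟦+⟧ -[1+ m ] -[1+ n ] = begin
    - (suc (suc (m ℕ.+ n)) × 1#)     ≡⟨ cong (λ k → - (suc k × 1#)) (ℕ.+-suc m n) ⟨
    - ((suc m ℕ.+ suc n) × 1#)       ≈⟨ -‿cong (×-homo-+ 1# (suc m) (suc n)) ⟩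
    - (suc m × 1# + suc n × 1#)      ≈⟨ ⁻¹-∙-comm _ _ ⟨
    - (suc m × 1#) - (suc n × 1#)    ∎

  ⟦+*⟧ : ∀ m j → ⟦ + m ℤ.* j ⟧ ≈ ⟦ + m ⟧ * ⟦ j ⟧
  ⟦+*⟧ m (+ n) = begin
    ⟦ + m ℤ.* + n ⟧    ≡⟨ cong ⟦_⟧ (ℤ.pos-* m n) ⟨
    (m ℕ.* n) × 1#     ≈⟨ ×1-homo-* m n ⟩
    ⟦ + m ⟧ * ⟦ + n ⟧  ∎
  ⟦+*⟧ m -[1+ n ] = begin
    ⟦ + m ℤ.* -[1+ n ] ⟧         ≡⟨ cong ⟦_⟧ (ℤ.neg-distribʳ-* (+ m) (+ suc n)) ⟨
    ⟦ ℤ.- (+ m ℤ.* + suc n) ⟧    ≈⟨ ⟦-⟧ (+ m ℤ.* + suc n) ⟩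
    - ⟦ + m ℤ.* + suc n ⟧        ≈⟨ -‿cong (⟦+*⟧ m (+ suc n)) ⟩
    - (⟦ + m ⟧ * ⟦ + suc n ⟧)    ≈⟨ -‿distribʳ-* _ _ ⟩
    ⟦ + m ⟧ * ⟦ -[1+ n ] ⟧       ∎
  ⟦*⟧ : ∀ i j → ⟦ i ℤ.* j ⟧ ≈ ⟦ i ⟧ * ⟦ j ⟧
  ⟦*⟧ (+ m)    j = ⟦+*⟧ m j
  ⟦*⟧ -[1+ m ] j = begin
    ⟦ -[1+ m ] ℤ.* j ⟧           ≡⟨ cong ⟦_⟧ (ℤ.neg-distribˡ-* (+ suc m) j) ⟨
    ⟦ ℤ.- (+ suc m ℤ.* j) ⟧      ≈⟨ ⟦-⟧ (+ suc m ℤ.* j) ⟩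
    - ⟦ + suc m ℤ.* j ⟧          ≈⟨ -‿cong (⟦+*⟧ (suc m) j) ⟩
    - (⟦ + suc m ⟧ * ⟦ j ⟧)      ≈⟨ -‿distribˡ-* _ _ ⟩
    ⟦ -[1+ m ] ⟧ * ⟦ j ⟧         ∎

  homomorphism : ℤ.+-*-rawRing -Raw-AlmostCommutative⟶ fromCommutativeRing R
  homomorphism = record
    { ⟦_⟧ = ⟦_⟧ ; +-homo = ⟦+⟧ ; *-homo = ⟦*⟧ ; -‿homo = ⟦-⟧ ; 0-homo = ≈-refl ; 1-homo = ≈-refl }

  module Solver = Algebra.Solver.Ring ℤ.+-*-rawRing (fromCommutativeRing R) homomorphism
    (λ i j → Maybe.map (λ i≡j → reflexive (cong ⟦_⟧ i≡j)) (dec⇒maybe (i ℤ.≟ j)))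

open import Data.Integer using (_+_; _-_; _*_; _^_; -_; _≤_; +≤+; -≤+)
open import Data.Product using (_×_)

-- Indicators of decidable propositions and finite integer sums.

module Sum = Algebra.Properties.Semiring.Sum ℤ.+-*-semiring

⟨_⟩ : Bool → ℤ
⟨ b ⟩ = if b then 1ℤ else 0ℤ

[_] : ∀ {P : Set} → Dec P → ℤ
[ P? ] = ⟨ does P? ⟩

module _ {P : Set} where

  []-yes : (P? : Dec P) → P → [ P? ] ≡ 1ℤ
  []-yes P? h = cong ⟨_⟩ (dec-true P? h)

  []-no : (P? : Dec P) → ¬ P → [ P? ] ≡ 0ℤ
  []-no P? h = cong ⟨_⟩ (dec-false P? h)

  []-cong : ∀ {Q : Set} (P? : Dec P) (Q? : Dec Q) → (P → Q) → (Q → P) → [ P? ] ≡ [ Q? ]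
  []-cong P? Q? f g = cong ⟨_⟩ (does-⇔ (mk⇔ f g) P? Q?)

  []-× : ∀ {Q : Set} (P? : Dec P) (Q? : Dec Q) → [ P? ×-dec Q? ] ≡ [ P? ] * [ Q? ]
  []-× (yes _) Q? = sym (ℤ.*-identityˡ _)
  []-× (no _)  Q? = refl

  []-¬ : (P? : Dec P) → [ ¬? P? ] ≡ 1ℤ - [ P? ]
  []-¬ (yes _) = refl
  []-¬ (no _)  = refl

  -- Where `P` fails both sides are 0, so an equation may be proved under the hypothesis whose
  -- indicator multiplies it. Facts that hold only at solutions enter the sums in this way.
  []-*-cong : ∀ (P? : Dec P) {x y} → (P → x ≡ y) → [ P? ] * x ≡ [ P? ] * y
  []-*-cong (yes h) eq = cong (1ℤ *_) (eq h)
  []-*-cong (no _)  eq = refl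

sum-[≟] : ∀ {n} (i : Fin n) (f : Fin n → ℤ) → Sum.sum (λ j → [ i ≟ j ] * f j) ≡ f i
sum-[≟] {suc n} zero f = trans
  (cong (_+_ (1ℤ * f zero)) (Sum.sum-replicate-zero n))
  (trans (ℤ.+-identityʳ _) (ℤ.*-identityˡ _))
sum-[≟] {suc n} (suc i) f = trans (ℤ.+-identityˡ _) (sum-[≟] i (f ∘ suc))

sum-nonpositive : ∀ {n} (f : Fin n → ℤ) → (∀ i → f i ≤ 0ℤ) → Sum.sum f ≤ 0ℤ
sum-nonpositive {zero}  f f≤0 = ℤ.≤-refl
sum-nonpositive {suc n} f f≤0 = ℤ.+-mono-≤ (f≤0 zero) (sum-nonpositive (f ∘ suc) (f≤0 ∘ suc))

nonpositive-+≡0 : ∀ {x y} → x ≤ 0ℤ → y ≤ 0ℤ → x + y ≡ 0ℤ → x ≡ 0ℤ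
nonpositive-+≡0 {x} {y} x≤0 y≤0 eq = ℤ.≤-antisym x≤0
  (subst (_≤ x) eq (subst (x + y ≤_) (ℤ.+-identityʳ x) (ℤ.+-monoʳ-≤ x y≤0)))

-- Turns one equation between totals into an equation at every index; the multiplicativity of the
-- quadratic character at non-squares rests on it.
sum-nonpositive≡0 : ∀ {n} (f : Fin n → ℤ) → (∀ i → f i ≤ 0ℤ) → Sum.sum f ≡ 0ℤ → ∀ i → f i ≡ 0ℤ
sum-nonpositive≡0 {suc n} f f≤0 eq = λ
  { zero    → nonpositive-+≡0 (f≤0 zero) rest≤0 eq
  ; (suc i) → sum-nonpositive≡0 (f ∘ suc) (f≤0 ∘ suc)
                (nonpositive-+≡0 rest≤0 (f≤0 zero) (trans (ℤ.+-comm _ (f zero)) eq)) i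
  }
  where
  rest≤0 = sum-nonpositive (f ∘ suc) (f≤0 ∘ suc)

-- Sums over a field of odd order and its quadratic character.

-- The carrier is `Fin p` itself, so a sum over the field is a finite sum over `Fin p`; the
-- operations are abstract, so the counting sees the field laws and not reduction modulo p.
record OddField (p : ℕ) : Set where
  infixl 6 _⊞_ _⊟_
  infixl 7 _·_
  infix  8 ⊟_
  field
    _⊞_ _·_           : Fin p → Fin p → Fin p
    ⊟_                : Fin p → Fin p
    𝟘 𝟙               : Fin p
    isCommutativeRing : IsCommutativeRing _≡_ _⊞_ _·_ ⊟_ 𝟘 𝟙
    inverse           : ∀ a → a ≢ 𝟘 → ∃ λ b → a · b ≡ 𝟙
    2≢0               : 𝟙 ⊞ 𝟙 ≢ 𝟘
    1<p               : 1 ℕ.< p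

  _⊟_ : Fin p → Fin p → Fin p
  a ⊟ b = a ⊞ (⊟ b)

  commutativeRing : CommutativeRing _ _
  commutativeRing = record { isCommutativeRing = isCommutativeRing }

module FieldSums {p : ℕ} (K : OddField p) where

  open OddField K public
  open IsCommutativeRing isCommutativeRing public
    using (zeroˡ; zeroʳ; *-identityˡ; *-identityʳ; +-identityˡ; *-comm; *-assoc; -‿inverseʳ)
  module RS = IntegerCoefficients.Solver commutativeRing
  open RS using (solve; _:=_; _:+_; _:*_; _:-_; :-_; con)
  open ≡-Reasoning

  F : Set
  F = Fin p

  q : ℤ
  q = + p

  ⊟≡0⇒≡ : ∀ {x y} → x ⊟ y ≡ 𝟘 → x ≡ y
  ⊟≡0⇒≡ {x} {y} h = trans (solve 2 (λ x y → x := x :- y :+ y) refl x y)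
    (trans (cong (_⊞ y) h) (+-identityˡ y))

  ≡⇒⊟≡0 : ∀ {x y} → x ≡ y → x ⊟ y ≡ 𝟘
  ≡⇒⊟≡0 refl = -‿inverseʳ _

  -- Each ring-theoretic consequence u ≡ v ⇒ x ≡ y is certified by a multiplier k.
  consequence : ∀ {u v x y} k → u ≡ v → x ⊟ y ≡ k · (u ⊟ v) → x ≡ y
  consequence k u≡v eq = ⊟≡0⇒≡ (trans eq (trans (cong (k ·_) (≡⇒⊟≡0 u≡v)) (zeroʳ k)))

  ·-cancelˡ-0 : ∀ {a b} → a ≢ 𝟘 → a · b ≡ 𝟘 → b ≡ 𝟘
  ·-cancelˡ-0 {a} {b} a≢0 ab≡0 with c , ac≡1 ← inverse a a≢0 = begin
    b            ≡⟨ *-identityˡ b ⟨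
    𝟙 · b        ≡⟨ cong (_· b) ac≡1 ⟨
    a · c · b    ≡⟨ solve 3 (λ a b c → a :* c :* b := c :* (a :* b)) refl a b c ⟩
    c · (a · b)  ≡⟨ cong (c ·_) ab≡0 ⟩
    c · 𝟘        ≡⟨ zeroʳ c ⟩
    𝟘            ∎

  ·-cancelˡ : ∀ {a x y} → a ≢ 𝟘 → a · x ≡ a · y → x ≡ y
  ·-cancelˡ {a} {x} {y} a≢0 eq = ⊟≡0⇒≡ (·-cancelˡ-0 a≢0
    (trans (solve 3 (λ a x y → a :* (x :- y) := a :* x :- a :* y) refl a x y) (≡⇒⊟≡0 eq)))

  ·≢0 : ∀ {a b} → a ≢ 𝟘 → b ≢ 𝟘 → a · b ≢ 𝟘
  ·≢0 a≢0 b≢0 ab≡0 = b≢0 (·-cancelˡ-0 a≢0 ab≡0)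

  ·≡0 : ∀ {a b} → a · b ≡ 𝟘 → a ≡ 𝟘 ⊎ b ≡ 𝟘
  ·≡0 {a} ab≡0 with a ≟ 𝟘
  ... | yes a≡0 = inj₁ a≡0
  ... | no  a≢0 = inj₂ (·-cancelˡ-0 a≢0 ab≡0)

  ·≢0⁻ˡ : ∀ {a b} → a · b ≢ 𝟘 → a ≢ 𝟘
  ·≢0⁻ˡ {b = b} ab≢0 refl = ab≢0 (zeroˡ b)

  ·≢0⁻ʳ : ∀ {a b} → a · b ≢ 𝟘 → b ≢ 𝟘
  ·≢0⁻ʳ {a} ab≢0 refl = ab≢0 (zeroʳ a)

  1≢0 : 𝟙 ≢ 𝟘
  1≢0 1≡0 = 2≢0 (trans (cong₂ _⊞_ 1≡0 1≡0) (+-identityˡ 𝟘))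

  ⊞-self≡0 : ∀ {a} → a ⊞ a ≡ 𝟘 → a ≡ 𝟘
  ⊞-self≡0 {a} h = ·-cancelˡ-0 2≢0 (trans (solve 1 (λ a → con (+ 2) :* a := a :+ a) refl a) h)

  ⊟1≢0 : ⊟ 𝟙 ≢ 𝟘
  ⊟1≢0 h = 1≢0 (trans (solve 0 (con 1ℤ := :- (:- con 1ℤ)) refl) (trans (cong ⊟_ h) (solve 0 (:- con 0ℤ := con 0ℤ) refl)))

  ∑ : (F → ℤ) → ℤ
  ∑ = Sum.sum

  infixr 8 ∑
  syntax ∑ (λ x → e) = ∑[ x ] e

  ∑-cong : ∀ {f g} → (∀ x → f x ≡ g x) → ∑ f ≡ ∑ g
  ∑-cong = Sum.sum-cong-≗

  ∑-+ : ∀ f g → ∑[ x ] (f x + g x) ≡ ∑ f + ∑ g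
  ∑-+ = Sum.∑-distrib-+

  ∑-*ˡ : ∀ c f → ∑[ x ] (c * f x) ≡ c * ∑ f
  ∑-*ˡ c f = sym (Sum.*-distribˡ-sum c f)

  ∑-*ʳ : ∀ c f → ∑[ x ] (f x * c) ≡ ∑ f * c
  ∑-*ʳ c f = sym (Sum.*-distribʳ-sum c f)

  ∑-comm : ∀ f → ∑[ x ] (∑[ y ] f x y) ≡ ∑[ y ] (∑[ x ] f x y)
  ∑-comm = Sum.∑-comm

  ∑-const : ∀ c → ∑[ x ] c ≡ q * c
  ∑-const c = const p
    where
    const : ∀ n → Sum.sum {n} (λ _ → c) ≡ + n * c
    const zero    = refl
    const (suc n) = trans (cong (_+_ c) (const n)) (trans (cong (_+ + n * c) (sym (ℤ.*-identityˡ c))) (sym (ℤ.*-distribʳ-+ c 1ℤ (+ n))))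

  ∑-zero : ∀ {f} → (∀ x → f x ≡ 0ℤ) → ∑ f ≡ 0ℤ
  ∑-zero h = trans (∑-cong h) (Sum.sum-replicate-zero p)

  -- Eliminates a summation variable that a condition determines: the indicator of a predicate with
  -- `a` as its only witness is that of equality with `a`.
  ∑-pick : ∀ {P : F → Set} (P? : ∀ x → Dec (P x)) a f →
           P a → (∀ x → P x → x ≡ a) → ∑[ x ] ([ P? x ] * f x) ≡ f a
  ∑-pick P? a f Pa unique = trans
    (∑-cong λ x → cong (_* f x) ([]-cong (P? x) (a ≟ x) (λ Px → sym (unique x Px)) λ { refl → Pa }))
    (sum-[≟] a f)

  ∑-pick₁ : ∀ {P : F → Set} (P? : ∀ x → Dec (P x)) a →
            P a → (∀ x → P x → x ≡ a) → ∑[ x ] [ P? x ] ≡ 1ℤ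
  ∑-pick₁ P? a Pa unique = trans (∑-cong λ x → sym (ℤ.*-identityʳ _)) (∑-pick P? a (λ _ → 1ℤ) Pa unique)

  ∑-reindex : ∀ (φ ψ : F → F) → (∀ x → φ (ψ x) ≡ x) → (∀ x → ψ (φ x) ≡ x) →
              ∀ f → ∑[ x ] f (φ x) ≡ ∑ f
  ∑-reindex φ ψ φψ ψφ f = sym (Sum.sum-permute f (permutation φ ψ φψ ψφ))

  ∑-scale : ∀ {t} → t ≢ 𝟘 → ∀ f → ∑[ x ] f (t · x) ≡ ∑ f
  ∑-scale {t} t≢0 with u , tu≡1 ← inverse t t≢0 = ∑-reindex (t ·_) (u ·_)
    (λ x → trans (sym (*-assoc t u x)) (trans (cong (_· x) tu≡1) (*-identityˡ x)))
    (λ x → trans (solve 3 (λ t u x → u :* (t :* x) := t :* u :* x) refl t u x)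
                 (trans (cong (_· x) tu≡1) (*-identityˡ x)))

  ∑-shift : ∀ c f → ∑[ x ] f (x ⊟ c) ≡ ∑ f
  ∑-shift c = ∑-reindex (_⊟ c) (_⊞ c)
    (λ x → solve 2 (λ c x → x :+ c :- c := x) refl c x)
    (λ x → solve 2 (λ c x → x :- c :+ c := x) refl c x)

  -- The trivial character, extended by 0 at 0.
  ν : F → ℤ
  ν a = [ ¬? (a ≟ 𝟘) ]

  ν-0 : ν 𝟘 ≡ 0ℤ
  ν-0 = []-no (¬? (𝟘 ≟ 𝟘)) (λ h → h refl)

  ν-≢0 : ∀ {a} → a ≢ 𝟘 → ν a ≡ 1ℤ
  ν-≢0 {a} = []-yes (¬? (a ≟ 𝟘))

  ν-* : ∀ a b → ν (a · b) ≡ ν a * ν b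
  ν-* a b = trans
    ([]-cong (¬? (a · b ≟ 𝟘)) (¬? (a ≟ 𝟘) ×-dec ¬? (b ≟ 𝟘))
      (λ h → ·≢0⁻ˡ h , ·≢0⁻ʳ h) (λ (h , k) → ·≢0 h k))
    ([]-× (¬? (a ≟ 𝟘)) (¬? (b ≟ 𝟘)))

  ∑-ν : ∑ ν ≡ q - 1ℤ
  ∑-ν = begin
    ∑ ν                             ≡⟨ ∑-cong (λ x → []-¬ (x ≟ 𝟘)) ⟩
    ∑[ x ] (1ℤ - [ x ≟ 𝟘 ])         ≡⟨ ∑-cong (λ x → cong (_+_ 1ℤ) (sym (ℤ.-1*i≡-i [ x ≟ 𝟘 ]))) ⟩
    ∑[ x ] (1ℤ + -1ℤ * [ x ≟ 𝟘 ])   ≡⟨ ∑-+ (λ _ → 1ℤ) (λ x → -1ℤ * [ x ≟ 𝟘 ]) ⟩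
    ∑[ x ] 1ℤ + ∑[ x ] (-1ℤ * [ x ≟ 𝟘 ])
      ≡⟨ cong₂ _+_ (trans (∑-const 1ℤ) (ℤ.*-identityʳ q))
           (trans (∑-*ˡ -1ℤ (λ x → [ x ≟ 𝟘 ])) (cong (-1ℤ *_) (∑-pick₁ (_≟ 𝟘) 𝟘 refl (λ _ → id)))) ⟩
    q - 1ℤ                          ∎

  -- The quadratic character; 1 + η a counts the square roots of a.
  η : F → ℤ
  η a = ∑[ t ] [ t · t ≟ a ] - 1ℤ

  η-0 : η 𝟘 ≡ 0ℤ
  η-0 = cong (_- 1ℤ) (∑-pick₁ (λ t → t · t ≟ 𝟘) 𝟘 (zeroʳ 𝟘) λ t h → [ id , id ]′ (·≡0 h))

  square-roots : ∀ {t b} → t · t ≡ b · b → t ≡ b ⊎ t ≡ ⊟ b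
  square-roots {t} {b} h with ·≡0 {t ⊟ b} {t ⊞ b}
    (trans (solve 2 (λ t b → (t :- b) :* (t :+ b) := t :* t :- b :* b) refl t b) (≡⇒⊟≡0 h))
  ... | inj₁ eq = inj₁ (⊟≡0⇒≡ eq)
  ... | inj₂ eq = inj₂ (consequence 𝟙 eq
    (solve 2 (λ t b → t :- :- b := con 1ℤ :* (t :+ b :- con 0ℤ)) refl t b))

  η-square : ∀ {b} → b ≢ 𝟘 → η (b · b) ≡ 1ℤ
  η-square {b} b≢0 = cong (_- 1ℤ) (begin
    ∑[ t ] [ t · t ≟ b · b ]              ≡⟨ ∑-cong split ⟩
    ∑[ t ] ([ t ≟ b ] + [ t ≟ ⊟ b ])      ≡⟨ ∑-+ (λ t → [ t ≟ b ]) (λ t → [ t ≟ ⊟ b ]) ⟩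
    ∑[ t ] [ t ≟ b ] + ∑[ t ] [ t ≟ ⊟ b ]
      ≡⟨ cong₂ _+_ (∑-pick₁ (_≟ b) b refl (λ _ → id)) (∑-pick₁ (_≟ ⊟ b) (⊟ b) refl (λ _ → id)) ⟩
    + 2 ∎)
    where
    split : ∀ t → [ t · t ≟ b · b ] ≡ [ t ≟ b ] + [ t ≟ ⊟ b ]
    split t with t ≟ b | t ≟ ⊟ b
    -- Coinciding roots b = -b would give 2 b = 0, which is impossible for b ≠ 0 in odd
    -- characteristic.
    ... | yes refl | yes t≡-t = contradiction
          (⊞-self≡0 (consequence 𝟙 t≡-t (solve 1 (λ t → t :+ t :- con 0ℤ := con 1ℤ :* (t :- :- t)) refl t))) b≢0
    ... | yes refl | no  _    = []-yes (t · t ≟ t · t) refl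
    ... | no  _    | yes refl = []-yes (⊟ b · ⊟ b ≟ b · b) (solve 1 (λ b → :- b :* :- b := b :* b) refl b)
    ... | no  t≢b  | no t≢-b  = []-no (t · t ≟ b · b) λ h → [ t≢b , t≢-b ]′ (square-roots h)

  η-nonsquare : ∀ {a} → (∀ t → t · t ≢ a) → η a ≡ -1ℤ
  η-nonsquare {a} h = cong (_- 1ℤ) (∑-zero λ t → []-no (t · t ≟ a) (h t))

  data QuadraticClass (a : F) : Set where
    is-zero      : a ≡ 𝟘 → QuadraticClass a
    is-square    : ∀ b → b ≢ 𝟘 → b · b ≡ a → QuadraticClass a
    is-nonsquare : (∀ t → t · t ≢ a) → QuadraticClass a

  classify : ∀ a → QuadraticClass a
  classify a with a ≟ 𝟘 | Fin.any? (λ t → t · t ≟ a)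
  ... | yes a≡0 | _            = is-zero a≡0
  ... | no a≢0  | yes (b , eq) = is-square b (λ { refl → a≢0 (trans (sym eq) (zeroˡ 𝟘)) }) eq
  ... | no _    | no none      = is-nonsquare λ t eq → none (t , eq)

  η≤1 : ∀ a → η a ≤ 1ℤ
  η≤1 a with classify a
  ... | is-zero refl           = ℤ.≤-trans (ℤ.≤-reflexive η-0) (+≤+ ℕ.z≤n)
  ... | is-square b b≢0 refl   = ℤ.≤-reflexive (η-square b≢0)
  ... | is-nonsquare h         = ℤ.≤-trans (ℤ.≤-reflexive (η-nonsquare h)) -≤+

  -- Every t is a square root of exactly one a, so the root counts total q, and the subtracted ones
  -- cancel this.
  ∑-η : ∑ η ≡ 0ℤ
  ∑-η = begin
    ∑ η                                        ≡⟨ ∑-+ (λ a → ∑[ t ] [ t · t ≟ a ]) (λ _ → -1ℤ) ⟩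
    ∑[ a ] (∑[ t ] [ t · t ≟ a ]) + ∑[ a ] -1ℤ
      ≡⟨ cong₂ _+_ (∑-comm (λ a t → [ t · t ≟ a ])) (∑-const -1ℤ) ⟩
    ∑[ t ] (∑[ a ] [ t · t ≟ a ]) + q * -1ℤ
      ≡⟨ cong (_+ q * -1ℤ) (∑-cong λ t → ∑-pick₁ (t · t ≟_) (t · t) refl (λ _ → sym)) ⟩
    ∑[ t ] 1ℤ + q * -1ℤ                        ≡⟨ cong (_+ q * -1ℤ) (∑-const 1ℤ) ⟩
    q * 1ℤ + q * -1ℤ                           ≡⟨ ℤ.*-distribˡ-+ q 1ℤ -1ℤ ⟨
    q * 0ℤ                                     ≡⟨ ℤ.*-zeroʳ q ⟩
    0ℤ                                         ∎

  -- Substituting b t for t matches the square roots of b² c with those of c.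
  η-square-* : ∀ {b} → b ≢ 𝟘 → ∀ c → η (b · b · c) ≡ η c
  η-square-* {b} b≢0 c = cong (_- 1ℤ) (begin
    ∑[ t ] [ t · t ≟ b · b · c ]
      ≡⟨ ∑-scale b≢0 (λ t → [ t · t ≟ b · b · c ]) ⟨
    ∑[ t ] [ b · t · (b · t) ≟ b · b · c ]
      ≡⟨ ∑-cong (λ t → []-cong (b · t · (b · t) ≟ b · b · c) (t · t ≟ c)
           (λ h → ·-cancelˡ (·≢0 b≢0 b≢0) (trans (rearrange t) h))
           (λ h → trans (sym (rearrange t)) (cong (b · b ·_) h))) ⟩
    ∑[ t ] [ t · t ≟ c ]  ∎)
    where
    rearrange : ∀ t → b · b · (t · t) ≡ b · t · (b · t)
    rearrange t = solve 2 (λ b t → b :* b :* (t :* t) := b :* t :* (b :* t)) refl b t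

  -- The sum over c of η (a c) + η c vanishes, and no term is positive.
  η-nonsquare-* : ∀ {a} → (∀ t → t · t ≢ a) → ∀ c → η (a · c) ≡ -1ℤ * η c
  η-nonsquare-* {a} nonsq c = begin
    η (a · c)                      ≡⟨ add-sub (η (a · c)) (η c) ⟩
    η (a · c) + η c + -1ℤ * η c    ≡⟨ cong (_+ -1ℤ * η c) (sum-nonpositive≡0 _ nonpositive total c) ⟩
    0ℤ + -1ℤ * η c                 ≡⟨ ℤ.+-identityˡ _ ⟩
    -1ℤ * η c                      ∎
    where
    add-sub : ∀ x y → x ≡ x + y + -1ℤ * y
    add-sub = solve-∀
    a≢0 : a ≢ 𝟘
    a≢0 refl = nonsq 𝟘 (zeroˡ 𝟘)
    -- For a square c ≠ 0 the two values are -1 and 1; for a non-square c the second is -1 and the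
    -- first is at most 1.
    nonpositive : ∀ c → η (a · c) + η c ≤ 0ℤ
    nonpositive c with classify c
    ... | is-zero refl = ℤ.≤-reflexive (cong₂ _+_ (trans (cong η (zeroʳ a)) η-0) η-0)
    ... | is-square b b≢0 refl = ℤ.≤-reflexive (cong₂ _+_
            (trans (cong η (*-comm a (b · b))) (trans (η-square-* b≢0 a) (η-nonsquare nonsq)))
            (η-square b≢0))
    ... | is-nonsquare h = ℤ.+-mono-≤ (η≤1 (a · c)) (ℤ.≤-reflexive (η-nonsquare h))
    total : ∑[ c ] (η (a · c) + η c) ≡ 0ℤ
    total = trans (∑-+ (λ c → η (a · c)) η) (cong₂ _+_ (trans (∑-scale a≢0 η) ∑-η) ∑-η)

  η-* : ∀ a c → η (a · c) ≡ η a * η c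
  η-* a c with classify a
  ... | is-zero refl = trans (trans (cong η (zeroˡ c)) η-0) (sym (cong (_* η c) η-0))
  ... | is-square b b≢0 refl = trans (η-square-* b≢0 c)
          (trans (sym (ℤ.*-identityˡ _)) (cong (_* η c) (sym (η-square b≢0))))
  ... | is-nonsquare h = trans (η-nonsquare-* h c) (cong (_* η c) (sym (η-nonsquare h)))

  η²≡1 : ∀ {a} → a ≢ 𝟘 → η a * η a ≡ 1ℤ
  η²≡1 {a} a≢0 with classify a
  ... | is-zero a≡0          = contradiction a≡0 a≢0
  ... | is-square b b≢0 refl = cong₂ _*_ (η-square b≢0) (η-square b≢0)
  ... | is-nonsquare h       = cong₂ _*_ (η-nonsquare h) (η-nonsquare h)

-- Additive convolutions of the trivial and the quadratic character.

module Convolutions {p : ℕ} (K : OddField p) where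

  open FieldSums K
  open RS using (solve; _:=_; _:+_; _:*_; _:-_; :-_; con)
  open ≡-Reasoning

  infixl 7 _⋆_
  _⋆_ : (F → ℤ) → (F → ℤ) → F → ℤ
  (g ⋆ h) a = ∑[ x ] (g x * h (a ⊟ x))

  ∑-⋆ : ∀ g h → ∑ (g ⋆ h) ≡ ∑ g * ∑ h
  ∑-⋆ g h = begin
    ∑[ a ] ∑[ x ] (g x * h (a ⊟ x))  ≡⟨ ∑-comm (λ a x → g x * h (a ⊟ x)) ⟩
    ∑[ x ] ∑[ a ] (g x * h (a ⊟ x))  ≡⟨ ∑-cong (λ x → ∑-*ˡ (g x) (λ a → h (a ⊟ x))) ⟩
    ∑[ x ] (g x * ∑[ a ] h (a ⊟ x))  ≡⟨ ∑-cong (λ x → cong (g x *_) (∑-shift x h)) ⟩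
    ∑[ x ] (g x * ∑ h)               ≡⟨ ∑-*ʳ (∑ h) g ⟩
    ∑ g * ∑ h                        ∎

  ScaleInvariant : (F → ℤ) → Set
  ScaleInvariant g = ∀ {t} → t ≢ 𝟘 → ∀ a → g (t · a) ≡ g a

  -- The hypothesis concerns the product g(t x) h(t y) because a character alone need not be
  -- invariant under scaling: the factor χ(t) disappears only when it occurs twice.
  ⋆-scale : ∀ {t} → t ≢ 𝟘 → ∀ g h → (∀ x y → g (t · x) * h (t · y) ≡ g x * h y) →
            ∀ a → (g ⋆ h) (t · a) ≡ (g ⋆ h) a
  ⋆-scale {t} t≢0 g h inv a = begin
    ∑[ x ] (g x * h (t · a ⊟ x))            ≡⟨ ∑-scale t≢0 (λ x → g x * h (t · a ⊟ x)) ⟨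
    ∑[ x ] (g (t · x) * h (t · a ⊟ t · x))
      ≡⟨ ∑-cong (λ x → cong (λ z → g (t · x) * h z) (distrib x)) ⟩
    ∑[ x ] (g (t · x) * h (t · (a ⊟ x)))    ≡⟨ ∑-cong (λ x → inv x (a ⊟ x)) ⟩
    ∑[ x ] (g x * h (a ⊟ x))                ∎
    where
    distrib : ∀ x → t · a ⊟ t · x ≡ t · (a ⊟ x)
    distrib x = solve 3 (λ t a x → t :* a :- t :* x := t :* (a :- x)) refl t a x

  ∑-constant-off-0 : ∀ g c → (∀ {a} → a ≢ 𝟘 → g a ≡ c) → ∑ g ≡ g 𝟘 + (q - 1ℤ) * c
  ∑-constant-off-0 g c h = begin
    ∑ g                                    ≡⟨ ∑-cong split ⟩
    ∑[ a ] ([ a ≟ 𝟘 ] * (g 𝟘 - c) + c)     ≡⟨ ∑-+ (λ a → [ a ≟ 𝟘 ] * (g 𝟘 - c)) (λ _ → c) ⟩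
    ∑[ a ] ([ a ≟ 𝟘 ] * (g 𝟘 - c)) + ∑[ a ] c
      ≡⟨ cong₂ _+_ (∑-pick (_≟ 𝟘) 𝟘 (λ _ → g 𝟘 - c) refl (λ _ → id)) (∑-const c) ⟩
    g 𝟘 - c + q * c                        ≡⟨ collect (g 𝟘) c q ⟩
    g 𝟘 + (q - 1ℤ) * c                     ∎
    where
    collect : ∀ x c q → x - c + q * c ≡ x + (q - 1ℤ) * c
    collect = solve-∀
    split-0 : ∀ x c → x ≡ 1ℤ * (x - c) + c
    split-0 = solve-∀
    split : ∀ a → g a ≡ [ a ≟ 𝟘 ] * (g 𝟘 - c) + c
    split a with a ≟ 𝟘
    ... | yes refl = split-0 (g 𝟘) c
    ... | no a≢0   = trans (h a≢0) (sym (ℤ.+-identityˡ c))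

  ∑-scale-invariant : ∀ {g} → ScaleInvariant g → ∑ g ≡ g 𝟘 + (q - 1ℤ) * g 𝟙
  ∑-scale-invariant {g} inv = ∑-constant-off-0 g (g 𝟙)
    λ {a} a≢0 → trans (cong g (sym (*-identityʳ a))) (inv a≢0 𝟙)

  ∑³ : (F → F → F → ℤ) → ℤ
  ∑³ f = ∑[ a ] ∑[ b ] ∑[ c ] f a b c

  ∑³-cong : ∀ {f g} → (∀ a b c → f a b c ≡ g a b c) → ∑³ f ≡ ∑³ g
  ∑³-cong h = ∑-cong λ a → ∑-cong λ b → ∑-cong (h a b)

  ∑³-+ : ∀ f g → ∑³ (λ a b c → f a b c + g a b c) ≡ ∑³ f + ∑³ g
  ∑³-+ f g = trans
    (∑-cong λ a → trans (∑-cong λ b → ∑-+ (f a b) (g a b)) (∑-+ (λ b → ∑ (f a b)) (λ b → ∑ (g a b))))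
    (∑-+ (λ a → ∑[ b ] ∑ (f a b)) (λ a → ∑[ b ] ∑ (g a b)))

  ∑³-*ˡ : ∀ k f → ∑³ (λ a b c → k * f a b c) ≡ k * ∑³ f
  ∑³-*ˡ k f = trans
    (∑-cong λ a → trans (∑-cong λ b → ∑-*ˡ k (f a b)) (∑-*ˡ k (λ b → ∑ (f a b))))
    (∑-*ˡ k (λ a → ∑[ b ] ∑ (f a b)))

  ∑-∑³ : ∀ (f : F → F → F → F → ℤ) → ∑³ (λ a b c → ∑[ s ] f s a b c) ≡ ∑[ s ] ∑³ (f s)
  ∑-∑³ f = begin
    ∑[ a ] ∑[ b ] ∑[ c ] ∑[ s ] f s a b c
      ≡⟨ ∑-cong (λ a → ∑-cong (λ b → ∑-comm (λ c s → f s a b c))) ⟩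
    ∑[ a ] ∑[ b ] ∑[ s ] ∑[ c ] f s a b c
      ≡⟨ ∑-cong (λ a → ∑-comm (λ b s → ∑[ c ] f s a b c)) ⟩
    ∑[ a ] ∑[ s ] ∑[ b ] ∑[ c ] f s a b c
      ≡⟨ ∑-comm (λ a s → ∑[ b ] ∑[ c ] f s a b c) ⟩
    ∑[ s ] ∑³ (f s) ∎

  module Character (χ : F → ℤ) (χ-* : ∀ a b → χ (a · b) ≡ χ a * χ b)
                   (χ-0 : χ 𝟘 ≡ 0ℤ) (χ² : ∀ {a} → a ≢ 𝟘 → χ a * χ a ≡ 1ℤ) where

    -- `J 𝟙` is the Jacobi sum of χ with itself; `V a` weighs each representation of a as a sum of
    -- four elements by χ of their product.
    J V : F → ℤ
    J = χ ⋆ χ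
    V = J ⋆ J

    χ-scale : ∀ {t} → t ≢ 𝟘 → ∀ x y → χ (t · x) * χ (t · y) ≡ χ x * χ y
    χ-scale {t} t≢0 x y = begin
      χ (t · x) * χ (t · y)      ≡⟨ cong₂ _*_ (χ-* t x) (χ-* t y) ⟩
      χ t * χ x * (χ t * χ y)    ≡⟨ swap (χ t) (χ x) (χ y) ⟩
      χ t * χ t * (χ x * χ y)    ≡⟨ cong (_* (χ x * χ y)) (χ² t≢0) ⟩
      1ℤ * (χ x * χ y)           ≡⟨ ℤ.*-identityˡ _ ⟩
      χ x * χ y                  ∎
      where
      swap : ∀ t x y → t * x * (t * y) ≡ t * t * (x * y)
      swap = solve-∀

    J-scale : ScaleInvariant J
    J-scale t≢0 = ⋆-scale t≢0 χ χ (χ-scale t≢0)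

    V-scale : ScaleInvariant V
    V-scale t≢0 = ⋆-scale t≢0 J J λ x y → cong₂ _*_ (J-scale t≢0 x) (J-scale t≢0 y)

    J-off-0 : ∀ {a} → a ≢ 𝟘 → J a ≡ J 𝟙
    J-off-0 {a} a≢0 = trans (cong J (sym (*-identityʳ a))) (J-scale a≢0 𝟙)

    -- At 0 the two arguments are x and -x, and χ(x) χ(-x) = χ(-1) χ(x)².
    J-0 : J 𝟘 ≡ (q - 1ℤ) * χ (⊟ 𝟙)
    J-0 = begin
      ∑[ x ] (χ x * χ (𝟘 ⊟ x))                 ≡⟨ ∑-cong pointwise ⟩
      ∑[ x ] (ν x * χ (⊟ 𝟙))                   ≡⟨ ∑-*ʳ (χ (⊟ 𝟙)) ν ⟩
      ∑ ν * χ (⊟ 𝟙)                            ≡⟨ cong (_* χ (⊟ 𝟙)) ∑-ν ⟩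
      (q - 1ℤ) * χ (⊟ 𝟙)                       ∎
      where
      swap : ∀ x y → x * (y * x) ≡ x * x * y
      swap = solve-∀
      square : ∀ x → χ x * χ x ≡ ν x
      square x with x ≟ 𝟘
      ... | yes refl = cong₂ _*_ χ-0 χ-0
      ... | no x≢0   = χ² x≢0
      pointwise : ∀ x → χ x * χ (𝟘 ⊟ x) ≡ ν x * χ (⊟ 𝟙)
      pointwise x = begin
        χ x * χ (𝟘 ⊟ x)          ≡⟨ cong (λ z → χ x * χ z) (solve 1 (λ x → con 0ℤ :- x := :- con 1ℤ :* x) refl x) ⟩
        χ x * χ (⊟ 𝟙 · x)        ≡⟨ cong (χ x *_) (χ-* (⊟ 𝟙) x) ⟩
        χ x * (χ (⊟ 𝟙) * χ x)    ≡⟨ swap (χ x) (χ (⊟ 𝟙)) ⟩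
        χ x * χ x * χ (⊟ 𝟙)      ≡⟨ cong (_* χ (⊟ 𝟙)) (square x) ⟩
        ν x * χ (⊟ 𝟙)            ∎

    J-total : J 𝟘 + (q - 1ℤ) * J 𝟙 ≡ ∑ χ * ∑ χ
    J-total = trans (sym (∑-scale-invariant J-scale)) (∑-⋆ χ χ)

    -- For x ≠ 0 both x and -x are nonzero, so J equals `J 𝟙` at both; only x = 0 contributes the
    -- square of `J 𝟘`.
    V-0 : V 𝟘 ≡ J 𝟘 * J 𝟘 + (q - 1ℤ) * (J 𝟙 * J 𝟙)
    V-0 = begin
      ∑[ x ] (J x * J (𝟘 ⊟ x))
        ≡⟨ ∑-constant-off-0 (λ x → J x * J (𝟘 ⊟ x)) (J 𝟙 * J 𝟙)
             (λ x≢0 → cong₂ _*_ (J-off-0 x≢0) (J-off-0 (λ h → x≢0 (negate h)))) ⟩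
      J 𝟘 * J (𝟘 ⊟ 𝟘) + (q - 1ℤ) * (J 𝟙 * J 𝟙)
        ≡⟨ cong (λ z → J 𝟘 * J z + (q - 1ℤ) * (J 𝟙 * J 𝟙)) (-‿inverseʳ 𝟘) ⟩
      J 𝟘 * J 𝟘 + (q - 1ℤ) * (J 𝟙 * J 𝟙) ∎
      where
      negate : ∀ {x} → 𝟘 ⊟ x ≡ 𝟘 → x ≡ 𝟘
      negate {x} h = sym (⊟≡0⇒≡ h)

    V-total : V 𝟘 + (q - 1ℤ) * V 𝟙 ≡ ∑ χ * ∑ χ * (∑ χ * ∑ χ)
    V-total = trans (sym (∑-scale-invariant V-scale)) (trans (∑-⋆ J J) (cong₂ _*_ (∑-⋆ χ χ) (∑-⋆ χ χ)))

    -- The sum over c is J(s - a - b); with u = a + b in place of b the sum over a becomes J(u), so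
    -- the four factors pair up into J ⋆ J.
    ∑³-χ : ∀ s → ∑³ (λ a b c → χ a * χ b * χ c * χ (s ⊟ a ⊟ b ⊟ c)) ≡ V s
    ∑³-χ s = begin
      ∑[ a ] ∑[ b ] ∑[ c ] (χ a * χ b * χ c * χ (s ⊟ a ⊟ b ⊟ c))
        ≡⟨ ∑-cong (λ a → ∑-cong (λ b → trans
             (∑-cong (λ c → ℤ.*-assoc (χ a * χ b) (χ c) (χ (s ⊟ a ⊟ b ⊟ c))))
             (∑-*ˡ (χ a * χ b) (λ c → χ c * χ (s ⊟ a ⊟ b ⊟ c))))) ⟩
      ∑[ a ] ∑[ b ] (χ a * χ b * J (s ⊟ a ⊟ b))
        ≡⟨ ∑-cong (λ a → sym (∑-shift a (λ b → χ a * χ b * J (s ⊟ a ⊟ b)))) ⟩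
      ∑[ a ] ∑[ u ] (χ a * χ (u ⊟ a) * J (s ⊟ a ⊟ (u ⊟ a)))
        ≡⟨ ∑-cong (λ a → ∑-cong (λ u → cong (λ z → χ a * χ (u ⊟ a) * J z)
             (solve 3 (λ s a u → s :- a :- (u :- a) := s :- u) refl s a u))) ⟩
      ∑[ a ] ∑[ u ] (χ a * χ (u ⊟ a) * J (s ⊟ u))
        ≡⟨ ∑-comm (λ a u → χ a * χ (u ⊟ a) * J (s ⊟ u)) ⟩
      ∑[ u ] ∑[ a ] (χ a * χ (u ⊟ a) * J (s ⊟ u))
        ≡⟨ ∑-cong (λ u → ∑-*ʳ (J (s ⊟ u)) (λ a → χ a * χ (u ⊟ a))) ⟩
      ∑[ u ] (J u * J (s ⊟ u)) ∎

  instance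
    q-1-nonZero : ℤ.NonZero (q - 1ℤ)
    q-1-nonZero = go 1<p
      where
      go : ∀ {n} → 1 ℕ.< n → ℤ.NonZero (+ n - 1ℤ)
      go (ℕ.s≤s (ℕ.s≤s _)) = _

  module Triv = Character ν ν-* ν-0 (λ a≢0 → cong₂ _*_ (ν-≢0 a≢0) (ν-≢0 a≢0))
  module Quad = Character η η-* η-0 η²≡1

  -- A total mass has the form g(0) + (q - 1) g(1), so the value at 1 is isolated by cancelling q -
  -- 1, which is nonzero since p > 1.
  cancel-q-1 : ∀ {x y z} → z + (q - 1ℤ) * x ≡ z + (q - 1ℤ) * y → x ≡ y
  cancel-q-1 {x} {y} {z} eq = ℤ.*-cancelˡ-≡ (q - 1ℤ) x y (∙-cancelˡ z _ _ eq)
    where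
    open import Algebra.Properties.AbelianGroup ℤ.+-0-abelianGroup using (∙-cancelˡ)

  triv-J-0 : Triv.J 𝟘 ≡ q - 1ℤ
  triv-J-0 = trans Triv.J-0 (trans (cong ((q - 1ℤ) *_) (ν-≢0 ⊟1≢0)) (ℤ.*-identityʳ _))

  triv-J-1 : Triv.J 𝟙 ≡ q - + 2
  triv-J-1 = cancel-q-1 {z = q - 1ℤ} (begin
    q - 1ℤ + (q - 1ℤ) * Triv.J 𝟙      ≡⟨ cong (_+ (q - 1ℤ) * Triv.J 𝟙) triv-J-0 ⟨
    Triv.J 𝟘 + (q - 1ℤ) * Triv.J 𝟙       ≡⟨ Triv.J-total ⟩
    ∑ ν * ∑ ν                      ≡⟨ cong₂ _*_ ∑-ν ∑-ν ⟩
    (q - 1ℤ) * (q - 1ℤ)            ≡⟨ expand q ⟩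
    q - 1ℤ + (q - 1ℤ) * (q - + 2)  ∎)
    where
    expand : ∀ q → (q - 1ℤ) * (q - 1ℤ) ≡ q - 1ℤ + (q - 1ℤ) * (q - + 2)
    expand = solve-∀

  triv-V-0 : Triv.V 𝟘 ≡ (q - 1ℤ) * (q - 1ℤ) + (q - 1ℤ) * ((q - + 2) * (q - + 2))
  triv-V-0 = trans Triv.V-0 (cong₂ (λ x y → x * x + (q - 1ℤ) * (y * y)) triv-J-0 triv-J-1)

  triv-V-1 : Triv.V 𝟙 ≡ (q - 1ℤ) * (q - 1ℤ) * (q - 1ℤ) - (q - 1ℤ) - (q - + 2) * (q - + 2)
  triv-V-1 = cancel-q-1 {z = Triv.V 𝟘} (begin
    Triv.V 𝟘 + (q - 1ℤ) * Triv.V 𝟙                             ≡⟨ Triv.V-total ⟩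
    ∑ ν * ∑ ν * (∑ ν * ∑ ν)                              ≡⟨ cong (λ x → x * x * (x * x)) ∑-ν ⟩
    (q - 1ℤ) * (q - 1ℤ) * ((q - 1ℤ) * (q - 1ℤ))          ≡⟨ expand q ⟩
    (q - 1ℤ) * (q - 1ℤ) + (q - 1ℤ) * ((q - + 2) * (q - + 2))
      + (q - 1ℤ) * ((q - 1ℤ) * (q - 1ℤ) * (q - 1ℤ) - (q - 1ℤ) - (q - + 2) * (q - + 2))
      ≡⟨ cong (_+ (q - 1ℤ) * ((q - 1ℤ) * (q - 1ℤ) * (q - 1ℤ) - (q - 1ℤ) - (q - + 2) * (q - + 2))) triv-V-0 ⟨
    Triv.V 𝟘 + (q - 1ℤ) * ((q - 1ℤ) * (q - 1ℤ) * (q - 1ℤ) - (q - 1ℤ) - (q - + 2) * (q - + 2)) ∎)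
    where
    expand : ∀ q → (q - 1ℤ) * (q - 1ℤ) * ((q - 1ℤ) * (q - 1ℤ)) ≡
      (q - 1ℤ) * (q - 1ℤ) + (q - 1ℤ) * ((q - + 2) * (q - + 2))
      + (q - 1ℤ) * ((q - 1ℤ) * (q - 1ℤ) * (q - 1ℤ) - (q - 1ℤ) - (q - + 2) * (q - + 2))
    expand = solve-∀

  -- The classical Jacobi sum: η has total 0, so J(0) = (q - 1) η(-1) must be balanced by (q - 1)
  -- J(1).
  quad-J-1 : Quad.J 𝟙 ≡ - η (⊟ 𝟙)
  quad-J-1 = cancel-q-1 {z = (q - 1ℤ) * e} (begin
    (q - 1ℤ) * e + (q - 1ℤ) * Quad.J 𝟙  ≡⟨ cong (_+ (q - 1ℤ) * Quad.J 𝟙) Quad.J-0 ⟨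
    Quad.J 𝟘 + (q - 1ℤ) * Quad.J 𝟙         ≡⟨ Quad.J-total ⟩
    ∑ η * ∑ η                        ≡⟨ cong₂ _*_ ∑-η ∑-η ⟩
    0ℤ                               ≡⟨ expand q e ⟩
    (q - 1ℤ) * e + (q - 1ℤ) * - e    ∎)
    where
    e = η (⊟ 𝟙)
    expand : ∀ q e → 0ℤ ≡ (q - 1ℤ) * e + (q - 1ℤ) * - e
    expand = solve-∀

  quad-V-0 : Quad.V 𝟘 ≡ (q - 1ℤ) * q
  quad-V-0 = begin
    Quad.V 𝟘                                                ≡⟨ Quad.V-0 ⟩
    Quad.J 𝟘 * Quad.J 𝟘 + (q - 1ℤ) * (Quad.J 𝟙 * Quad.J 𝟙)           ≡⟨ cong₂ (λ x y → x * x + (q - 1ℤ) * (y * y)) Quad.J-0 quad-J-1 ⟩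
    (q - 1ℤ) * e * ((q - 1ℤ) * e) + (q - 1ℤ) * (- e * - e)  ≡⟨ expand q e ⟩
    (q - 1ℤ) * q * (e * e)                               ≡⟨ cong ((q - 1ℤ) * q *_) (η²≡1 ⊟1≢0) ⟩
    (q - 1ℤ) * q * 1ℤ                                    ≡⟨ ℤ.*-identityʳ _ ⟩
    (q - 1ℤ) * q                                         ∎
    where
    e = η (⊟ 𝟙)
    expand : ∀ q e → (q - 1ℤ) * e * ((q - 1ℤ) * e) + (q - 1ℤ) * (- e * - e) ≡ (q - 1ℤ) * q * (e * e)
    expand = solve-∀

  -- The total mass is again 0, so V(0) = (q - 1) q forces this value; it produces the term -σ(E) p
  -- in the number of vertices.
  quad-V-1 : Quad.V 𝟙 ≡ - q
  quad-V-1 = cancel-q-1 {z = (q - 1ℤ) * q} (begin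
    (q - 1ℤ) * q + (q - 1ℤ) * Quad.V 𝟙  ≡⟨ cong (_+ (q - 1ℤ) * Quad.V 𝟙) quad-V-0 ⟨
    Quad.V 𝟘 + (q - 1ℤ) * Quad.V 𝟙         ≡⟨ Quad.V-total ⟩
    ∑ η * ∑ η * (∑ η * ∑ η)          ≡⟨ cong (λ x → x * x * (x * x)) ∑-η ⟩
    0ℤ                               ≡⟨ expand q ⟩
    (q - 1ℤ) * q + (q - 1ℤ) * - q    ∎)
    where
    expand : ∀ q → 0ℤ ≡ (q - 1ℤ) * q + (q - 1ℤ) * - q
    expand = solve-∀

  -- For k ≠ 0, multiplying s² k = 1 by k gives (k s)² = k, so s corresponds to the square root k s
  -- of k. For k = 0 there is no s, and both characters vanish.
  ∑-square-multiples : ∀ k → ∑[ s ] [ 𝟙 ≟ s · s · k ] ≡ ν k + η k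
  ∑-square-multiples k with k ≟ 𝟘
  ... | yes refl = trans
    (∑-zero λ s → []-no (𝟙 ≟ s · s · 𝟘) λ h → 1≢0 (trans h (zeroʳ (s · s))))
    (sym (trans (ℤ.+-identityˡ _) η-0))
  ... | no k≢0 = begin
    ∑[ s ] [ 𝟙 ≟ s · s · k ]
      ≡⟨ ∑-cong (λ s → []-cong (𝟙 ≟ s · s · k) (k · s · (k · s) ≟ k)
           (λ h → trans (rearrange s) (trans (cong (k ·_) (sym h)) (*-identityʳ k)))
           (λ h → ·-cancelˡ k≢0 (trans (*-identityʳ k) (trans (sym h) (rearrange s))))) ⟩
    ∑[ s ] [ k · s · (k · s) ≟ k ]    ≡⟨ ∑-scale k≢0 (λ s → [ s · s ≟ k ]) ⟩
    ∑[ s ] [ s · s ≟ k ]              ≡⟨ add-sub (∑[ s ] [ s · s ≟ k ]) ⟩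
    1ℤ + η k                          ∎
    where
    rearrange : ∀ s → k · s · (k · s) ≡ k · (s · s · k)
    rearrange s = solve 2 (λ s k → k :* s :* (k :* s) := k :* (s :* s :* k)) refl s k
    add-sub : ∀ x → x ≡ 1ℤ + (x - 1ℤ)
    add-sub = solve-∀

  -- The number of solutions, sorted by coordinate sum.

  ∑⁴ : (F → F → F → F → ℤ) → ℤ
  ∑⁴ f = ∑[ a ] ∑[ b ] ∑[ c ] ∑[ d ] f a b c d

  ∑⁴-cong : ∀ {f g} → (∀ a b c d → f a b c d ≡ g a b c d) → ∑⁴ f ≡ ∑⁴ g
  ∑⁴-cong h = ∑-cong λ a → ∑³-cong (h a)

  -- Shifting d by a + b + c makes the total itself a summation variable.
  ∑⁴-by-total : ∀ f → ∑⁴ f ≡ ∑[ s ] ∑³ (λ a b c → f a b c (s ⊟ a ⊟ b ⊟ c))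
  ∑⁴-by-total f = trans
    (∑³-cong λ a b c → trans (sym (∑-shift (a ⊞ b ⊞ c) (f a b c)))
      (∑-cong λ s → cong (f a b c)
        (solve 4 (λ a b c s → s :- (a :+ b :+ c) := s :- a :- b :- c) refl a b c s)))
    (∑-∑³ (λ s a b c → f a b c (s ⊟ a ⊟ b ⊟ c)))

  ∑³-scale : ∀ {t} → t ≢ 𝟘 → ∀ f → ∑³ (λ a b c → f (t · a) (t · b) (t · c)) ≡ ∑³ f
  ∑³-scale {t} t≢0 f = begin
    ∑[ a ] ∑[ b ] ∑[ c ] f (t · a) (t · b) (t · c)
      ≡⟨ ∑-cong (λ a → ∑-cong (λ b → ∑-scale t≢0 (f (t · a) (t · b)))) ⟩
    ∑[ a ] ∑[ b ] ∑[ c ] f (t · a) (t · b) c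
      ≡⟨ ∑-cong (λ a → ∑-scale t≢0 (λ b → ∑[ c ] f (t · a) b c)) ⟩
    ∑[ a ] ∑[ b ] ∑[ c ] f (t · a) b c
      ≡⟨ ∑-scale t≢0 (λ a → ∑[ b ] ∑[ c ] f a b c) ⟩
    ∑³ f ∎

  total : F → F → F → F → F
  total a b c d = a ⊞ b ⊞ c ⊞ d

  product : F → F → F → F → F
  product a b c d = a · b · c · d

  derivative : F → F → F → F
  derivative E s m = s ⊞ s ⊟ E · m

  ∑³-1 : ∑³ (λ _ _ _ → 1ℤ) ≡ q * q * q
  ∑³-1 = begin
    ∑[ a ] ∑[ b ] ∑[ c ] 1ℤ  ≡⟨ ∑-cong (λ a → ∑-cong (λ b → ∑-const 1ℤ)) ⟩
    ∑[ a ] ∑[ b ] (q * 1ℤ)   ≡⟨ ∑-cong (λ a → ∑-const (q * 1ℤ)) ⟩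
    ∑[ a ] (q * (q * 1ℤ))    ≡⟨ ∑-const (q * (q * 1ℤ)) ⟩
    q * (q * (q * 1ℤ))       ≡⟨ assoc q ⟩
    q * q * q                ∎
    where
    assoc : ∀ q → q * (q * (q * 1ℤ)) ≡ q * q * q
    assoc = solve-∀

  module _ {E : F} (E≢0 : E ≢ 𝟘) where

    Solution : F → F → F → F → Set
    Solution a b c d = total a b c d · total a b c d ≡ E · product a b c d

    ν-product : ∀ a b c d → ν (product a b c d) ≡ ν a * ν b * ν c * ν d
    ν-product a b c d = trans (ν-* (a · b · c) d)
      (cong (_* ν d) (trans (ν-* (a · b) c) (cong (_* ν c) (ν-* a b))))

    η-product : ∀ a b c d → η (product a b c d) ≡ η a * η b * η c * η d
    η-product a b c d = trans (η-* (a · b · c) d)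
      (cong (_* η d) (trans (η-* (a · b) c) (cong (_* η c) (η-* a b))))

    slice : F → ℤ
    slice s = ∑³ λ a b c → [ s · s ≟ E · product a b c (s ⊟ a ⊟ b ⊟ c) ]

    last-1 : F → F → F → F
    last-1 a b c = 𝟙 ⊟ a ⊟ b ⊟ c

    -- Solutions of total s ≠ 0 are s times a vector of total 1.
    projective : F → ℤ
    projective s = ∑³ λ a b c → [ 𝟙 ≟ s · s · (E · product a b c (last-1 a b c)) ]

    -- With s = 0 the equation says that the product vanishes: all q³ vectors of total 0 count,
    -- except those with four nonzero coordinates, and `Triv.V 𝟘` is the number of these.
    slice-0 : slice 𝟘 ≡ q * q * q - Triv.V 𝟘
    slice-0 = begin
      ∑³ (λ a b c → [ 𝟘 · 𝟘 ≟ E · product a b c (𝟘 ⊟ a ⊟ b ⊟ c) ])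
        ≡⟨ ∑³-cong pointwise ⟩
      ∑³ (λ a b c → 1ℤ + -1ℤ * (ν a * ν b * ν c * ν (𝟘 ⊟ a ⊟ b ⊟ c)))
        ≡⟨ ∑³-+ (λ _ _ _ → 1ℤ) (λ a b c → -1ℤ * (ν a * ν b * ν c * ν (𝟘 ⊟ a ⊟ b ⊟ c))) ⟩
      ∑³ (λ _ _ _ → 1ℤ) + ∑³ (λ a b c → -1ℤ * (ν a * ν b * ν c * ν (𝟘 ⊟ a ⊟ b ⊟ c)))
        ≡⟨ cong₂ _+_ ∑³-1 (trans
             (∑³-*ˡ -1ℤ (λ a b c → ν a * ν b * ν c * ν (𝟘 ⊟ a ⊟ b ⊟ c)))
             (trans (cong (-1ℤ *_) (Triv.∑³-χ 𝟘)) (ℤ.-1*i≡-i (Triv.V 𝟘)))) ⟩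
      q * q * q - Triv.V 𝟘 ∎
      where
      1-1- : ∀ x → x ≡ 1ℤ + -1ℤ * (1ℤ - x)
      1-1- = solve-∀
      pointwise : ∀ a b c → [ 𝟘 · 𝟘 ≟ E · product a b c (𝟘 ⊟ a ⊟ b ⊟ c) ] ≡
                  1ℤ + -1ℤ * (ν a * ν b * ν c * ν (𝟘 ⊟ a ⊟ b ⊟ c))
      pointwise a b c = let d = 𝟘 ⊟ a ⊟ b ⊟ c ; m = product a b c d in begin
        [ 𝟘 · 𝟘 ≟ E · m ]                  ≡⟨ []-cong (𝟘 · 𝟘 ≟ E · m) (m ≟ 𝟘)
             (λ h → ·-cancelˡ-0 E≢0 (trans (sym h) (zeroˡ 𝟘)))
             (λ h → trans (zeroˡ 𝟘) (sym (trans (cong (E ·_) h) (zeroʳ E)))) ⟩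
        [ m ≟ 𝟘 ]                          ≡⟨ 1-1- _ ⟩
        1ℤ + -1ℤ * (1ℤ - [ m ≟ 𝟘 ])        ≡⟨ cong (λ x → 1ℤ + -1ℤ * x) ([]-¬ (m ≟ 𝟘)) ⟨
        1ℤ + -1ℤ * ν m                     ≡⟨ cong (λ x → 1ℤ + -1ℤ * x) (ν-product a b c d) ⟩
        1ℤ + -1ℤ * (ν a * ν b * ν c * ν d) ∎

    -- Scaling a, b and c by s scales the last coordinate too; the product then releases s⁴, of
    -- which s² cancels.
    slice-≢0 : ∀ {s} → s ≢ 𝟘 → slice s ≡ projective s
    slice-≢0 {s} s≢0 = trans
      (sym (∑³-scale s≢0 (λ a b c → [ s · s ≟ E · product a b c (s ⊟ a ⊟ b ⊟ c) ])))
      (∑³-cong λ a b c → []-cong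
        (s · s ≟ E · product (s · a) (s · b) (s · c) (s ⊟ s · a ⊟ s · b ⊟ s · c))
        (𝟙 ≟ s · s · (E · product a b c (last-1 a b c)))
        (λ h → ·-cancelˡ (·≢0 s≢0 s≢0) (trans (*-identityʳ _) (trans h (homogeneous a b c))))
        (λ h → trans (sym (*-identityʳ _)) (trans (cong (s · s ·_) h) (sym (homogeneous a b c)))))
      where
      homogeneous : ∀ a b c → E · product (s · a) (s · b) (s · c) (s ⊟ s · a ⊟ s · b ⊟ s · c) ≡
                    s · s · (s · s · (E · product a b c (last-1 a b c)))
      homogeneous a b c = solve 5 (λ E s a b c →
        E :* ((s :* a) :* (s :* b) :* (s :* c) :* (s :- s :* a :- s :* b :- s :* c)) :=
        s :* s :* (s :* s :* (E :* (a :* b :* c :* (con 1ℤ :- a :- b :- c))))) refl E s a b c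

    -- Allows `projective` to be summed over all s, as the count of s in `∑-square-multiples`
    -- requires.
    projective-0 : projective 𝟘 ≡ 0ℤ
    projective-0 = ∑-zero λ a → ∑-zero λ b → ∑-zero λ c →
      []-no (𝟙 ≟ 𝟘 · 𝟘 · (E · product a b c (last-1 a b c)))
        λ h → 1≢0 (trans h (solve 1 (λ x → con 0ℤ :* con 0ℤ :* x := con 0ℤ) refl _))

    ∑-slice : ∑ slice ≡ slice 𝟘 + ∑ projective
    ∑-slice = begin
      ∑ slice                                                ≡⟨ ∑-cong split ⟩
      ∑[ s ] ([ s ≟ 𝟘 ] * slice s + projective s)            ≡⟨ ∑-+ (λ s → [ s ≟ 𝟘 ] * slice s) projective ⟩
      ∑[ s ] ([ s ≟ 𝟘 ] * slice s) + ∑ projective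
        ≡⟨ cong (_+ ∑ projective) (∑-pick (_≟ 𝟘) 𝟘 slice refl (λ _ → id)) ⟩
      slice 𝟘 + ∑ projective                                 ∎
      where
      split : ∀ s → slice s ≡ [ s ≟ 𝟘 ] * slice s + projective s
      split s with s ≟ 𝟘
      ... | yes refl = sym (trans (cong₂ _+_ (ℤ.*-identityˡ (slice 𝟘)) projective-0) (ℤ.+-identityʳ _))
      ... | no s≢0   = trans (slice-≢0 s≢0) (sym (ℤ.+-identityˡ _))

    -- With s summed first, a vector of total 1 and product m contributes ν(E m) + η(E m), and
    -- multiplicativity splits both terms over the coordinates.
    ∑-projective : ∑ projective ≡ Triv.V 𝟙 + η E * Quad.V 𝟙
    ∑-projective = begin
      ∑ projective
        ≡⟨ ∑-∑³ (λ s a b c → [ 𝟙 ≟ s · s · (E · product a b c (last-1 a b c)) ]) ⟨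
      ∑³ (λ a b c → ∑[ s ] [ 𝟙 ≟ s · s · (E · product a b c (last-1 a b c)) ])
        ≡⟨ ∑³-cong (λ a b c → trans (∑-square-multiples (E · product a b c (last-1 a b c)))
             (cong₂ _+_
               (trans (ν-* E (product a b c (last-1 a b c))) (trans (cong (_* ν (product a b c (last-1 a b c))) (ν-≢0 E≢0))
                 (trans (ℤ.*-identityˡ _) (ν-product a b c (last-1 a b c)))))
               (trans (η-* E (product a b c (last-1 a b c)))
                 (cong (η E *_) (η-product a b c (last-1 a b c)))))) ⟩
      ∑³ (λ a b c → ν a * ν b * ν c * ν (last-1 a b c) + η E * (η a * η b * η c * η (last-1 a b c)))
        ≡⟨ ∑³-+ (λ a b c → ν a * ν b * ν c * ν (last-1 a b c))
             (λ a b c → η E * (η a * η b * η c * η (last-1 a b c))) ⟩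
      ∑³ (λ a b c → ν a * ν b * ν c * ν (last-1 a b c)) +
      ∑³ (λ a b c → η E * (η a * η b * η c * η (last-1 a b c)))
        ≡⟨ cong₂ _+_ (Triv.∑³-χ 𝟙) (trans
             (∑³-*ˡ (η E) (λ a b c → η a * η b * η c * η (last-1 a b c)))
             (cong (η E *_) (Quad.∑³-χ 𝟙))) ⟩
      Triv.V 𝟙 + η E * Quad.V 𝟙 ∎

    solution? : ∀ a b c d → Dec (Solution a b c d)
    solution? a b c d = total a b c d · total a b c d ≟ E · product a b c d

    #solutions : ∑⁴ (λ a b c d → [ solution? a b c d ]) ≡ q ^ 3 - 1ℤ - η E * q
    #solutions = begin
      ∑⁴ (λ a b c d → [ solution? a b c d ])
        ≡⟨ ∑⁴-by-total (λ a b c d → [ solution? a b c d ]) ⟩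
      ∑[ s ] ∑³ (λ a b c → [ solution? a b c (s ⊟ a ⊟ b ⊟ c) ])
        ≡⟨ ∑-cong (λ s → ∑³-cong λ a b c → cong (λ z → [ z · z ≟ E · product a b c (s ⊟ a ⊟ b ⊟ c) ])
             (solve 4 (λ s a b c → a :+ b :+ c :+ (s :- a :- b :- c) := s) refl s a b c)) ⟩
      ∑ slice                                  ≡⟨ ∑-slice ⟩
      slice 𝟘 + ∑ projective                   ≡⟨ cong₂ _+_ slice-0 ∑-projective ⟩
      q * q * q - Triv.V 𝟘 + (Triv.V 𝟙 + η E * Quad.V 𝟙)
        ≡⟨ cong₂ (λ x y → q * q * q - x + y) triv-V-0 (cong₂ _+_ triv-V-1 (cong (η E *_) quad-V-1)) ⟩
      _                                        ≡⟨ evaluate q (η E) ⟩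
      q ^ 3 - 1ℤ - η E * q ∎
      where
      evaluate : ∀ q e → q * q * q
        - ((q - 1ℤ) * (q - 1ℤ) + (q - 1ℤ) * ((q - + 2) * (q - + 2)))
        + ((q - 1ℤ) * (q - 1ℤ) * (q - 1ℤ) - (q - 1ℤ) - (q - + 2) * (q - + 2) + e * - q) ≡ q * (q * (q * 1ℤ)) - 1ℤ - e * q
      evaluate = solve-∀

[]-*-zero : ∀ {P : Set} (P? : Dec P) {x} → (P → x ≡ 0ℤ) → [ P? ] * x ≡ 0ℤ
[]-*-zero P? {x} h = trans ([]-*-cong P? h) (ℤ.*-zeroʳ [ P? ])

-- Symmetric functions of four indicators

Pattern : Set
Pattern = ℤ → ℤ → ℤ → ℤ → ℤ

-- `orbit₄` puts each argument once in the last place, `orbit₆` each pair of arguments once in the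
-- last two. The patterns to which they are applied do not depend on the order within the two
-- groups, so `orbit₄ one-of`, `orbit₆ two-of` and `orbit₄ three-of` are elementary symmetric
-- polynomials.
orbit₄ orbit₆ : Pattern → Pattern
orbit₄ P x y z w = P x y z w + P x y w z + P x z w y + P y z w x
orbit₆ P x y z w = P x y z w + P x z y w + P x w y z + P y z x w + P y w x z + P z w x y

one-of two-of three-of four-of three-only : Pattern
one-of     x y z w = w
two-of     x y z w = z * w
three-of   x y z w = x * y * z
four-of    x y z w = x * y * z * w
three-only x y z w = x * y * z * (1ℤ - w)

bit : Bool → ℕ
bit b = if b then 1 else 0

count₄ : Bool → Bool → Bool → Bool → ℕ
count₄ x y z w = bit x ℕ.+ (bit y ℕ.+ (bit z ℕ.+ bit w))

-- The indicator of degree k for a solution with nonzero coordinates, whose i-th argument says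
-- 2 xᵢ = s, and for a solution with a zero coordinate, whose i-th argument says xᵢ ≠ 0.
nonzero-pattern : ℕ → Bool → Bool → Bool → Bool → ℤ
nonzero-pattern k x y z w = [ count₄ (not x) (not y) (not z) (not w) ℕ.≟ k ]

zero-pattern : ℕ → Bool → Bool → Bool → Bool → ℤ
zero-pattern k x y z w = ⟨ not (x ∧ y ∧ z ∧ w) ⟩ *
  [ count₄ (y ∧ z ∧ w) (x ∧ z ∧ w) (x ∧ y ∧ w) (x ∧ y ∧ z) ℕ.≟ k ]

-- For concrete functions all sixteen premises hold by `refl`, so inclusion-exclusion formulas are
-- verified by evaluation.
∀-Bool⁴ : ∀ {f g : Bool → Bool → Bool → Bool → ℤ} →
  f true true true true ≡ g true true true true → f true true true false ≡ g true true true false →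
  f true true false true ≡ g true true false true → f true true false false ≡ g true true false false →
  f true false true true ≡ g true false true true → f true false true false ≡ g true false true false →
  f true false false true ≡ g true false false true → f true false false false ≡ g true false false false →
  f false true true true ≡ g false true true true → f false true true false ≡ g false true true false →
  f false true false true ≡ g false true false true → f false true false false ≡ g false true false false →
  f false false true true ≡ g false false true true → f false false true false ≡ g false false true false →
  f false false false true ≡ g false false false true → f false false false false ≡ g false false false false →
  ∀ x y z w → f x y z w ≡ g x y z w
∀-Bool⁴ a b c d e f g h i j k l m n o p true  true  true  true  = a
∀-Bool⁴ a b c d e f g h i j k l m n o p true  true  true  false = b
∀-Bool⁴ a b c d e f g h i j k l m n o p true  true  false true  = c
∀-Bool⁴ a b c d e f g h i j k l m n o p true  true  false false = d
∀-Bool⁴ a b c d e f g h i j k l m n o p true  false true  true  = e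
∀-Bool⁴ a b c d e f g h i j k l m n o p true  false true  false = f
∀-Bool⁴ a b c d e f g h i j k l m n o p true  false false true  = g
∀-Bool⁴ a b c d e f g h i j k l m n o p true  false false false = h
∀-Bool⁴ a b c d e f g h i j k l m n o p false true  true  true  = i
∀-Bool⁴ a b c d e f g h i j k l m n o p false true  true  false = j
∀-Bool⁴ a b c d e f g h i j k l m n o p false true  false true  = k
∀-Bool⁴ a b c d e f g h i j k l m n o p false true  false false = l
∀-Bool⁴ a b c d e f g h i j k l m n o p false false true  true  = m
∀-Bool⁴ a b c d e f g h i j k l m n o p false false true  false = n
∀-Bool⁴ a b c d e f g h i j k l m n o p false false false true  = o
∀-Bool⁴ a b c d e f g h i j k l m n o p false false false false = p

on-Bool : Pattern → Bool → Bool → Bool → Bool → ℤ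
on-Bool P x y z w = P ⟨ x ⟩ ⟨ y ⟩ ⟨ z ⟩ ⟨ w ⟩

-- The patterns by inclusion–exclusion, as polynomials in the four indicators.
nonzero-polynomial zero-polynomial : ℕ → Pattern
nonzero-polynomial 0 x y z w = four-of x y z w
nonzero-polynomial 1 x y z w = orbit₄ three-of x y z w - + 4 * four-of x y z w
nonzero-polynomial 2 x y z w = orbit₆ two-of x y z w - + 3 * orbit₄ three-of x y z w + + 6 * four-of x y z w
nonzero-polynomial 3 x y z w = orbit₄ one-of x y z w - + 2 * orbit₆ two-of x y z w
                             + + 3 * orbit₄ three-of x y z w - + 4 * four-of x y z w
nonzero-polynomial _ x y z w = 0ℤ
zero-polynomial 0 x y z w = 1ℤ - four-of x y z w - orbit₄ three-only x y z w
zero-polynomial 1 x y z w = orbit₄ three-only x y z w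
zero-polynomial _ x y z w = 0ℤ

-- Matching on it makes k a literal, so that the patterns evaluate on Booleans.
data Degree : ℕ → Set where
  deg0 : Degree 0
  deg1 : Degree 1
  deg2 : Degree 2
  deg3 : Degree 3

-- Degree k means that exactly m = 4 - k of the conditions hold. The indicator of this is the sum
-- over j ≥ m of (-1)^(j-m) C(j,m) times the j-th elementary symmetric polynomial of the four
-- indicators.
nonzero-pattern≡ : ∀ {k} → Degree k → ∀ x y z w → nonzero-pattern k x y z w ≡ on-Bool (nonzero-polynomial k) x y z w
nonzero-pattern≡ deg0 = ∀-Bool⁴ refl refl refl refl refl refl refl refl refl refl refl refl refl refl refl refl
nonzero-pattern≡ deg1 = ∀-Bool⁴ refl refl refl refl refl refl refl refl refl refl refl refl refl refl refl refl
nonzero-pattern≡ deg2 = ∀-Bool⁴ refl refl refl refl refl refl refl refl refl refl refl refl refl refl refl refl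
nonzero-pattern≡ deg3 = ∀-Bool⁴ refl refl refl refl refl refl refl refl refl refl refl refl refl refl refl refl

zero-pattern≡ : ∀ {k} → Degree k → ∀ x y z w → zero-pattern k x y z w ≡ on-Bool (zero-polynomial k) x y z w
zero-pattern≡ deg0 = ∀-Bool⁴ refl refl refl refl refl refl refl refl refl refl refl refl refl refl refl refl
zero-pattern≡ deg1 = ∀-Bool⁴ refl refl refl refl refl refl refl refl refl refl refl refl refl refl refl refl
zero-pattern≡ deg2 = ∀-Bool⁴ refl refl refl refl refl refl refl refl refl refl refl refl refl refl refl refl
zero-pattern≡ deg3 = ∀-Bool⁴ refl refl refl refl refl refl refl refl refl refl refl refl refl refl refl refl

-- Weighted counts of the conditions 2 xᵢ = s and xᵢ ≠ 0.

module DegreeSums {p : ℕ} (K : OddField p) where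

  open Convolutions K public
  open FieldSums K public
  open RS using (solve; _:=_; _:+_; _:*_; _:-_; :-_; con)
  open ≡-Reasoning

  ∑⁴-+ : ∀ f g → ∑⁴ (λ a b c d → f a b c d + g a b c d) ≡ ∑⁴ f + ∑⁴ g
  ∑⁴-+ f g = trans (∑-cong λ a → ∑³-+ (f a) (g a)) (∑-+ (λ a → ∑³ (f a)) (λ a → ∑³ (g a)))

  ∑⁴-*ˡ : ∀ k f → ∑⁴ (λ a b c d → k * f a b c d) ≡ k * ∑⁴ f
  ∑⁴-*ˡ k f = trans (∑-cong λ a → ∑³-*ˡ k (f a)) (∑-*ˡ k (λ a → ∑³ (f a)))

  -- The weight sees a vector only through its total and product, so permuting the coordinates lets
  -- the arguments of a pattern be permuted without changing the sum.
  module Symmetric (W : F → F → ℤ) (h : F → F → ℤ) where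

    term : Pattern → F → F → F → F → ℤ
    term P a b c d = let s = total a b c d in
      W s (product a b c d) * P (h a s) (h b s) (h c s) (h d s)

    ∑ʷ : Pattern → ℤ
    ∑ʷ P = ∑⁴ (term P)

    ∑ʷ-+ : ∀ P Q → ∑ʷ (λ x y z w → P x y z w + Q x y z w) ≡ ∑ʷ P + ∑ʷ Q
    ∑ʷ-+ P Q = trans
      (∑⁴-cong λ a b c d → ℤ.*-distribˡ-+ (W (total a b c d) (product a b c d)) _ _)
      (∑⁴-+ (term P) (term Q))

    ∑ʷ-*ˡ : ∀ k P → ∑ʷ (λ x y z w → k * P x y z w) ≡ k * ∑ʷ P
    ∑ʷ-*ˡ k P = trans
      (∑⁴-cong λ a b c d → swap (W (total a b c d) (product a b c d)) k _)
      (∑⁴-*ˡ k (term P))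
      where
      swap : ∀ x k y → x * (k * y) ≡ k * (x * y)
      swap = solve-∀

    ∑ʷ-- : ∀ P Q → ∑ʷ (λ x y z w → P x y z w - Q x y z w) ≡ ∑ʷ P - ∑ʷ Q
    ∑ʷ-- P Q = begin
      ∑ʷ (λ x y z w → P x y z w - Q x y z w)
        ≡⟨ ∑⁴-cong (λ a b c d → cong (λ v → W (total a b c d) (product a b c d) * (P _ _ _ _ + v)) (sym (ℤ.-1*i≡-i (Q _ _ _ _)))) ⟩
      ∑ʷ (λ x y z w → P x y z w + -1ℤ * Q x y z w)   ≡⟨ ∑ʷ-+ P (λ x y z w → -1ℤ * Q x y z w) ⟩
      ∑ʷ P + ∑ʷ (λ x y z w → -1ℤ * Q x y z w)        ≡⟨ cong (_+_ (∑ʷ P)) (trans (∑ʷ-*ˡ -1ℤ Q) (ℤ.-1*i≡-i (∑ʷ Q))) ⟩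
      ∑ʷ P - ∑ʷ Q                                    ∎

    ∑ʷ-12 : ∀ P → ∑ʷ (λ x y z w → P y x z w) ≡ ∑ʷ P
    ∑ʷ-12 P = trans
      (∑⁴-cong λ a b c d → cong₂ (λ s m → W s m * P (h b s) (h a s) (h c s) (h d s))
        (solve 4 (λ a b c d → a :+ b :+ c :+ d := b :+ a :+ c :+ d) refl a b c d)
        (solve 4 (λ a b c d → a :* b :* c :* d := b :* a :* c :* d) refl a b c d))
      (∑-comm (λ a b → ∑[ c ] ∑[ d ] term P b a c d))

    ∑ʷ-23 : ∀ P → ∑ʷ (λ x y z w → P x z y w) ≡ ∑ʷ P
    ∑ʷ-23 P = trans
      (∑⁴-cong λ a b c d → cong₂ (λ s m → W s m * P (h a s) (h c s) (h b s) (h d s))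
        (solve 4 (λ a b c d → a :+ b :+ c :+ d := a :+ c :+ b :+ d) refl a b c d)
        (solve 4 (λ a b c d → a :* b :* c :* d := a :* c :* b :* d) refl a b c d))
      (∑-cong λ a → ∑-comm (λ b c → ∑[ d ] term P a c b d))

    ∑ʷ-34 : ∀ P → ∑ʷ (λ x y z w → P x y w z) ≡ ∑ʷ P
    ∑ʷ-34 P = trans
      (∑⁴-cong λ a b c d → cong₂ (λ s m → W s m * P (h a s) (h b s) (h d s) (h c s))
        (solve 4 (λ a b c d → a :+ b :+ c :+ d := a :+ b :+ d :+ c) refl a b c d)
        (solve 4 (λ a b c d → a :* b :* c :* d := a :* b :* d :* c) refl a b c d))
      (∑-cong λ a → ∑-cong λ b → ∑-comm (λ c d → term P a b d c))

    -- Each summand of the orbit is reached from `P` by adjacent transpositions, which preserve the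
    -- sum.
    ∑ʷ-orbit₄ : ∀ P → ∑ʷ (orbit₄ P) ≡ + 4 * ∑ʷ P
    ∑ʷ-orbit₄ P = begin
      ∑ʷ (orbit₄ P)  ≡⟨ trans (∑ʷ-+ (λ x y z w → P x y z w + P₂ x y z w + P₃ x y z w) P₄)
                          (cong (_+ ∑ʷ P₄) (trans (∑ʷ-+ (λ x y z w → P x y z w + P₂ x y z w) P₃)
                            (cong (_+ ∑ʷ P₃) (∑ʷ-+ P P₂)))) ⟩
      ∑ʷ P + ∑ʷ P₂ + ∑ʷ P₃ + ∑ʷ P₄
                     ≡⟨ cong₂ _+_ (cong₂ _+_ (cong (_+_ (∑ʷ P)) eq₂) eq₃) eq₄ ⟩
      ∑ʷ P + ∑ʷ P + ∑ʷ P + ∑ʷ P  ≡⟨ four (∑ʷ P) ⟩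
      + 4 * ∑ʷ P ∎
      where
      P₂ P₃ P₄ : Pattern
      P₂ x y z w = P x y w z
      P₃ x y z w = P x z w y
      P₄ x y z w = P y z w x
      eq₂ = ∑ʷ-34 P
      eq₃ = trans (∑ʷ-23 P₂) eq₂
      eq₄ = trans (∑ʷ-12 P₃) eq₃
      four : ∀ x → x + x + x + x ≡ + 4 * x
      four = solve-∀

    ∑ʷ-orbit₆ : ∀ P → ∑ʷ (orbit₆ P) ≡ + 6 * ∑ʷ P
    ∑ʷ-orbit₆ P = begin
      ∑ʷ (orbit₆ P)
        ≡⟨ trans (∑ʷ-+ (λ x y z w → P x y z w + P₂ x y z w + P₃ x y z w + P₄ x y z w + P₅ x y z w) P₆)
             (cong (_+ ∑ʷ P₆) (trans (∑ʷ-+ (λ x y z w → P x y z w + P₂ x y z w + P₃ x y z w + P₄ x y z w) P₅)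
             (cong (_+ ∑ʷ P₅) (trans (∑ʷ-+ (λ x y z w → P x y z w + P₂ x y z w + P₃ x y z w) P₄)
             (cong (_+ ∑ʷ P₄) (trans (∑ʷ-+ (λ x y z w → P x y z w + P₂ x y z w) P₃)
             (cong (_+ ∑ʷ P₃) (∑ʷ-+ P P₂)))))))) ⟩
      ∑ʷ P + ∑ʷ P₂ + ∑ʷ P₃ + ∑ʷ P₄ + ∑ʷ P₅ + ∑ʷ P₆
        ≡⟨ cong₂ _+_ (cong₂ _+_ (cong₂ _+_ (cong₂ _+_ (cong (_+_ (∑ʷ P)) eq₂) eq₃) eq₄) eq₅) eq₆ ⟩
      ∑ʷ P + ∑ʷ P + ∑ʷ P + ∑ʷ P + ∑ʷ P + ∑ʷ P  ≡⟨ six (∑ʷ P) ⟩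
      + 6 * ∑ʷ P ∎
      where
      P₂ P₃ P₄ P₅ P₆ : Pattern
      P₂ x y z w = P x z y w
      P₃ x y z w = P x w y z
      P₄ x y z w = P y z x w
      P₅ x y z w = P y w x z
      P₆ x y z w = P z w x y
      eq₂ = ∑ʷ-23 P
      eq₃ = trans (∑ʷ-34 P₂) eq₂
      eq₄ = trans (∑ʷ-12 P₂) eq₂
      eq₅ = trans (∑ʷ-12 P₃) eq₃
      eq₆ = trans (∑ʷ-23 P₅) eq₅
      six : ∀ x → x + x + x + x + x + x ≡ + 6 * x
      six = solve-∀

  -- There is one nonzero root if α and β are both nonzero, none if exactly one of them vanishes,
  -- and q - 1 if both do; the right side interpolates these values.
  ∑-linear-root : ∀ α β → ∑[ c ] (ν c * [ α · c ≟ β ]) ≡ 1ℤ - [ α ≟ 𝟘 ] - [ β ≟ 𝟘 ] + q * ([ α ≟ 𝟘 ] * [ β ≟ 𝟘 ])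
  ∑-linear-root α β with α ≟ 𝟘 | β ≟ 𝟘
  ... | yes refl | yes refl = begin
    ∑[ c ] (ν c * [ 𝟘 · c ≟ 𝟘 ])  ≡⟨ ∑-cong (λ c → cong (ν c *_) ([]-yes (𝟘 · c ≟ 𝟘) (zeroˡ c))) ⟩
    ∑[ c ] (ν c * 1ℤ)             ≡⟨ ∑-cong (λ c → ℤ.*-identityʳ (ν c)) ⟩
    ∑ ν                           ≡⟨ ∑-ν ⟩
    q - 1ℤ                        ≡⟨ eval q ⟩
    1ℤ - 1ℤ - 1ℤ + q * (1ℤ * 1ℤ)  ∎
    where
    eval : ∀ q → q - 1ℤ ≡ 1ℤ - 1ℤ - 1ℤ + q * (1ℤ * 1ℤ)
    eval = solve-∀
  ... | yes refl | no β≢0 = trans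
    (∑-zero λ c → trans (cong (ν c *_) ([]-no (𝟘 · c ≟ β) λ h → β≢0 (trans (sym h) (zeroˡ c)))) (ℤ.*-zeroʳ (ν c)))
    (sym (cong (_+_ 0ℤ) (ℤ.*-zeroʳ q)))
  ... | no α≢0 | yes refl = trans
    (∑-zero λ c → []-*-zero (¬? (c ≟ 𝟘)) λ c≢0 → []-no (α · c ≟ 𝟘) (·≢0 α≢0 c≢0))
    (sym (cong (_+_ 0ℤ) (ℤ.*-zeroʳ q)))
  ... | no α≢0 | no β≢0 with u , αu≡1 ← inverse α α≢0 = begin
    ∑[ c ] (ν c * [ α · c ≟ β ])  ≡⟨ ∑-cong (λ c → ℤ.*-comm (ν c) [ α · c ≟ β ]) ⟩
    ∑[ c ] ([ α · c ≟ β ] * ν c)  ≡⟨ ∑-pick (λ c → α · c ≟ β) (u · β) ν αuβ≡β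
                                       (λ c h → ·-cancelˡ α≢0 (trans h (sym αuβ≡β))) ⟩
    ν (u · β)                     ≡⟨ ν-≢0 (λ h → β≢0 (trans (sym αuβ≡β) (trans (cong (α ·_) h) (zeroʳ α)))) ⟩
    1ℤ                            ≡⟨ cong (_+_ 1ℤ) (ℤ.*-zeroʳ q) ⟨
    1ℤ - 0ℤ - 0ℤ + q * (0ℤ * 0ℤ)  ∎
    where
    αuβ≡β : α · (u · β) ≡ β
    αuβ≡β = trans (sym (*-assoc α u β)) (trans (cong (_· β) αu≡1) (*-identityˡ β))

  𝟜 : F
  𝟜 = 𝟙 ⊞ 𝟙 ⊞ 𝟙 ⊞ 𝟙

  4≢0 : 𝟜 ≢ 𝟘
  4≢0 h = ·≢0 2≢0 2≢0 (trans (solve 0 ((con 1ℤ :+ con 1ℤ) :* (con 1ℤ :+ con 1ℤ) := con 1ℤ :+ con 1ℤ :+ con 1ℤ :+ con 1ℤ) refl) h)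

  double-injective : ∀ {x y} → x ⊞ x ≡ y ⊞ y → x ≡ y
  double-injective {x} {y} h = ⊟≡0⇒≡ (⊞-self≡0
    (trans (solve 2 (λ x y → x :- y :+ (x :- y) := x :+ x :- (y :+ y)) refl x y) (≡⇒⊟≡0 h)))

  module _ {E : F} (E≢0 : E ≢ 𝟘) where

    -- If 2 xᵢ = 2 xⱼ = s then the other two coordinates are ± a with - E a² = 4.
    special? : ∀ a → Dec (𝟜 ≡ ⊟ E · (a · a))
    special? a = 𝟜 ≟ ⊟ E · (a · a)

    #special : ℤ
    #special = 1ℤ + η (⊟ E)

    ⊟E≢0 : ⊟ E ≢ 𝟘
    ⊟E≢0 h = E≢0 (consequence (⊟ 𝟙) h (solve 1 (λ E → E :- con 0ℤ := :- con 1ℤ :* (:- E :- con 0ℤ)) refl E))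

    special⇒≢0 : ∀ {a} → 𝟜 ≡ ⊟ E · (a · a) → a ≢ 𝟘
    special⇒≢0 h refl = 4≢0 (trans h (solve 1 (λ E → :- E :* (con 0ℤ :* con 0ℤ) := con 0ℤ) refl E))

    -- Substituting 2 a for a divides out the 4 and leaves 1 = a² (-E).
    ∑-special : ∑[ a ] [ special? a ] ≡ #special
    ∑-special = begin
      ∑[ a ] [ special? a ]            ≡⟨ ∑-scale 2≢0 (λ a → [ special? a ]) ⟨
      ∑[ a ] [ special? ((𝟙 ⊞ 𝟙) · a) ]
        ≡⟨ ∑-cong (λ a → []-cong (special? ((𝟙 ⊞ 𝟙) · a)) (𝟙 ≟ a · a · ⊟ E)
             (λ h → ·-cancelˡ 4≢0 (trans (*-identityʳ 𝟜) (trans h (rearrange a))))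
             (λ h → trans (sym (*-identityʳ 𝟜)) (trans (cong (𝟜 ·_) h) (sym (rearrange a))))) ⟩
      ∑[ a ] [ 𝟙 ≟ a · a · ⊟ E ]       ≡⟨ ∑-square-multiples (⊟ E) ⟩
      ν (⊟ E) + η (⊟ E)                ≡⟨ cong (_+ η (⊟ E)) (ν-≢0 ⊟E≢0) ⟩
      #special                         ∎
      where
      rearrange : ∀ a → ⊟ E · ((𝟙 ⊞ 𝟙) · a · ((𝟙 ⊞ 𝟙) · a)) ≡ 𝟜 · (a · a · ⊟ E)
      rearrange a = solve 2 (λ E a → :- E :* ((con 1ℤ :+ con 1ℤ) :* a :* ((con 1ℤ :+ con 1ℤ) :* a)) :=
        (con 1ℤ :+ con 1ℤ :+ con 1ℤ :+ con 1ℤ) :* (a :* a :* :- E)) refl E a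

    nonzero-solution? : ∀ s m → Dec (s · s ≡ E · m × m ≢ 𝟘)
    nonzero-solution? s m = (s · s ≟ E · m) ×-dec ¬? (m ≟ 𝟘)

    half? : ∀ a s → Dec (a ⊞ a ≡ s)
    half? a s = a ⊞ a ≟ s

    -- S sums over the solutions with nonzero coordinates, U over all vectors of total 0.
    module S = Symmetric (λ s m → [ nonzero-solution? s m ]) (λ a s → [ half? a s ])
    module U = Symmetric (λ s _ → [ s ≟ 𝟘 ]) (λ a _ → ν a)

    -- Adding the four conditions gives 2 s = 4 s, so s = 0, against s² = E m with E and m nonzero.
    S-four : S.∑ʷ four-of ≡ 0ℤ
    S-four = ∑-zero λ a → ∑-zero λ b → ∑-zero λ c → ∑-zero λ d →
      let s = total a b c d ; m = product a b c d in
      trans (rearrange [ nonzero-solution? s m ] [ half? a s ] [ half? b s ] [ half? c s ] [ half? d s ])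
        ([]-*-zero (half? a s) λ ha → []-*-zero (half? b s) λ hb →
         []-*-zero (half? c s) λ hc → []-*-zero (half? d s) λ hd →
         []-no (nonzero-solution? s m) λ (sol , m≢0) →
           ·≢0 E≢0 m≢0 (trans (sym sol) (trans (cong (λ z → z · z) (s≡0 a b c d ha hb hc hd)) (zeroˡ 𝟘))))
      where
      rearrange : ∀ v x y z w → v * (x * y * z * w) ≡ x * (y * (z * (w * v)))
      rearrange = solve-∀
      s≡0 : ∀ a b c d (let s = total a b c d) → a ⊞ a ≡ s → b ⊞ b ≡ s → c ⊞ c ≡ s → d ⊞ d ≡ s → s ≡ 𝟘
      s≡0 a b c d ha hb hc hd = ⊞-self≡0 (begin
        s ⊞ s                                ≡⟨ solve 1 (λ s → s :+ s := s :+ s :+ s :+ s :- (s :+ s)) refl s ⟩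
        s ⊞ s ⊞ s ⊞ s ⊟ (s ⊞ s)
          ≡⟨ cong (_⊟ (s ⊞ s)) (cong₂ _⊞_ (cong₂ _⊞_ (cong₂ _⊞_ ha hb) hc) hd) ⟨
        (a ⊞ a) ⊞ (b ⊞ b) ⊞ (c ⊞ c) ⊞ (d ⊞ d) ⊟ (s ⊞ s)
          ≡⟨ solve 4 (λ a b c d → let s = a :+ b :+ c :+ d in
               (a :+ a) :+ (b :+ b) :+ (c :+ c) :+ (d :+ d) :- (s :+ s) := con 0ℤ) refl a b c d ⟩
        𝟘 ∎)
        where s = total a b c d

    -- 2 a = 2 b = 2 c = s forces the vector (a, a, a, -a), on which the equation reads a² (4 + E
    -- a²) = 0.
    S-three : S.∑ʷ three-of ≡ #special
    S-three = begin
      ∑[ a ] ∑[ b ] ∑[ c ] ∑[ d ] S.term three-of a b c d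
        ≡⟨ ∑³-cong pick-d ⟩
      ∑[ a ] ∑[ b ] ∑[ c ] ([ b ⊞ b ≟ c ⊞ c ] * ([ a ⊞ a ≟ c ⊞ c ] * w a b c))
        ≡⟨ ∑-cong (λ a → ∑-cong (λ b → ∑-pick (λ c → b ⊞ b ≟ c ⊞ c) b
             (λ c → [ a ⊞ a ≟ c ⊞ c ] * w a b c) refl (λ c h → sym (double-injective h)))) ⟩
      ∑[ a ] ∑[ b ] ([ a ⊞ a ≟ b ⊞ b ] * w a b b)
        ≡⟨ ∑-cong (λ a → ∑-pick (λ b → a ⊞ a ≟ b ⊞ b) a
             (λ b → w a b b) refl (λ b h → sym (double-injective h))) ⟩
      ∑[ a ] w a a a
        ≡⟨ ∑-cong (λ a → []-cong (nonzero-solution? (a ⊞ a) (product a a a (a ⊟ a ⊟ a))) (special? a)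
             (to a) (from a)) ⟩
      ∑[ a ] [ special? a ]  ≡⟨ ∑-special ⟩
      #special ∎
      where
      w : F → F → F → ℤ
      w a b c = [ nonzero-solution? (c ⊞ c) (product a b c (c ⊟ a ⊟ b)) ]

      rearrange : ∀ v x y z → v * (x * y * z) ≡ z * (y * (x * v))
      rearrange = solve-∀

      pick-d : ∀ a b c → ∑[ d ] S.term three-of a b c d ≡ [ b ⊞ b ≟ c ⊞ c ] * ([ a ⊞ a ≟ c ⊞ c ] * w a b c)
      pick-d a b c = begin
        ∑[ d ] S.term three-of a b c d
          ≡⟨ ∑-cong (λ d → let s = total a b c d in rearrange [ nonzero-solution? s (product a b c d) ]
               [ half? a s ] [ half? b s ] [ half? c s ]) ⟩
        ∑[ d ] ([ half? c (total a b c d) ] * f (total a b c d) d)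
          ≡⟨ ∑-pick (λ d → half? c (total a b c d)) (c ⊟ a ⊟ b) (λ d → f (total a b c d) d)
               (sym total≡)
               (λ d h → consequence (⊟ 𝟙) h (solve 4 (λ a b c d → d :- (c :- a :- b) :=
                  :- con 1ℤ :* (c :+ c :- (a :+ b :+ c :+ d))) refl a b c d)) ⟩
        f (total a b c (c ⊟ a ⊟ b)) (c ⊟ a ⊟ b)
          ≡⟨ cong (λ s → f s (c ⊟ a ⊟ b)) total≡ ⟩
        f (c ⊞ c) (c ⊟ a ⊟ b) ∎
        where
        f : F → F → ℤ
        f s d = [ half? b s ] * ([ half? a s ] * [ nonzero-solution? s (product a b c d) ])
        total≡ : total a b c (c ⊟ a ⊟ b) ≡ c ⊞ c
        total≡ = solve 3 (λ a b c → a :+ b :+ c :+ (c :- a :- b) := c :+ c) refl a b c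

      key : ∀ a → a · a · (𝟜 ⊟ ⊟ E · (a · a)) ≡ (a ⊞ a) · (a ⊞ a) ⊟ E · product a a a (a ⊟ a ⊟ a)
      key a = solve 2 (λ E a → a :* a :* (con 1ℤ :+ con 1ℤ :+ con 1ℤ :+ con 1ℤ :- :- E :* (a :* a)) :=
        (a :+ a) :* (a :+ a) :- E :* (a :* a :* a :* (a :- a :- a))) refl E a

      to : ∀ a → (a ⊞ a) · (a ⊞ a) ≡ E · product a a a (a ⊟ a ⊟ a) × product a a a (a ⊟ a ⊟ a) ≢ 𝟘 →
           𝟜 ≡ ⊟ E · (a · a)
      to a (sol , m≢0) = ⊟≡0⇒≡ (·-cancelˡ-0 (·≢0⁻ˡ (·≢0⁻ˡ m≢0)) (trans (key a) (≡⇒⊟≡0 sol)))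

      from : ∀ a → 𝟜 ≡ ⊟ E · (a · a) →
             (a ⊞ a) · (a ⊞ a) ≡ E · product a a a (a ⊟ a ⊟ a) × product a a a (a ⊟ a ⊟ a) ≢ 𝟘
      from a h = consequence (a · a) h (sym (key a)) ,
        ·≢0 (·≢0 (·≢0 a≢0 a≢0) a≢0) λ k → a≢0 (consequence (⊟ 𝟙) k
          (solve 1 (λ a → a :- con 0ℤ := :- con 1ℤ :* (a :- a :- a :- con 0ℤ)) refl a))
        where a≢0 = special⇒≢0 h

    -- 2 b = 2 d = s forces the vector (a, b, -a, b), on which the equation reads b² (4 + E a²) = 0:
    -- a is special and b is any nonzero element.
    S-two : S.∑ʷ two-of ≡ (q - 1ℤ) * #special
    S-two = begin
      -- With the conditions moved to b and d, the two innermost variables d and c are determined in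
      -- turn.
      S.∑ʷ two-of                        ≡⟨ S.∑ʷ-23 two-of ⟨
      S.∑ʷ (λ x y z w → y * w)           ≡⟨ ∑³-cong pick-d ⟩
      ∑[ a ] ∑[ b ] ∑[ c ] ([ b ⊞ b ≟ t a b c ⊞ t a b c ] * v (t a b c) a b c)
        ≡⟨ ∑-cong (λ a → ∑-cong (λ b → trans
             (∑-pick (λ c → b ⊞ b ≟ t a b c ⊞ t a b c) (⊟ a) (λ c → v (t a b c) a b c)
               (cong (λ z → z ⊞ z) (sym (t≡b a b))) (λ c h → unique a b c (double-injective h)))
             (cong (λ z → v z a b (⊟ a)) (t≡b a b)))) ⟩
      ∑[ a ] ∑[ b ] v b a b (⊟ a)
        ≡⟨ ∑-cong (λ a → ∑-cong (λ b → trans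
             ([]-cong (nonzero-solution? (b ⊞ b) (product a b (⊟ a) b)) (special? a ×-dec ¬? (b ≟ 𝟘)) (to a b) (from a b))
             ([]-× (special? a) (¬? (b ≟ 𝟘))))) ⟩
      ∑[ a ] ∑[ b ] ([ special? a ] * ν b)
        ≡⟨ ∑-cong (λ a → trans (∑-*ˡ [ special? a ] ν) (cong ([ special? a ] *_) ∑-ν)) ⟩
      ∑[ a ] ([ special? a ] * (q - 1ℤ)) ≡⟨ ∑-*ʳ (q - 1ℤ) (λ a → [ special? a ]) ⟩
      ∑[ a ] [ special? a ] * (q - 1ℤ)   ≡⟨ cong (_* (q - 1ℤ)) ∑-special ⟩
      #special * (q - 1ℤ)                ≡⟨ ℤ.*-comm #special (q - 1ℤ) ⟩
      (q - 1ℤ) * #special                ∎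
      where
      t : F → F → F → F
      t a b c = a ⊞ b ⊞ c

      v : F → F → F → F → ℤ
      v d a b c = [ nonzero-solution? (d ⊞ d) (product a b c d) ]

      t≡b : ∀ a b → t a b (⊟ a) ≡ b
      t≡b a b = solve 2 (λ a b → a :+ b :+ :- a := b) refl a b

      unique : ∀ a b c → b ≡ t a b c → c ≡ ⊟ a
      unique a b c h = consequence (⊟ 𝟙) h
        (solve 3 (λ a b c → c :- :- a := :- con 1ℤ :* (b :- (a :+ b :+ c))) refl a b c)

      rearrange : ∀ v x y → v * (x * y) ≡ y * (x * v)
      rearrange = solve-∀

      pick-d : ∀ a b c → ∑[ d ] S.term (λ x y z w → y * w) a b c d ≡
               [ b ⊞ b ≟ t a b c ⊞ t a b c ] * v (t a b c) a b c
      pick-d a b c = begin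
        ∑[ d ] S.term (λ x y z w → y * w) a b c d
          ≡⟨ ∑-cong (λ d → let s = total a b c d in
               rearrange [ nonzero-solution? s (product a b c d) ] [ half? b s ] [ half? d s ]) ⟩
        ∑[ d ] ([ half? d (total a b c d) ] * f (total a b c d) d)
          ≡⟨ ∑-pick (λ d → half? d (total a b c d)) (t a b c) (λ d → f (total a b c d) d) refl
               (λ d h → consequence 𝟙 h (solve 4 (λ a b c d → d :- (a :+ b :+ c) :=
                  con 1ℤ :* (d :+ d :- (a :+ b :+ c :+ d))) refl a b c d)) ⟩
        f (t a b c ⊞ t a b c) (t a b c) ∎
        where
        f : F → F → ℤ
        f s d = [ half? b s ] * [ nonzero-solution? s (product a b c d) ]

      key : ∀ a b → b · b · (𝟜 ⊟ ⊟ E · (a · a)) ≡ (b ⊞ b) · (b ⊞ b) ⊟ E · product a b (⊟ a) b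
      key a b = solve 3 (λ E a b → b :* b :* (con 1ℤ :+ con 1ℤ :+ con 1ℤ :+ con 1ℤ :- :- E :* (a :* a)) :=
        (b :+ b) :* (b :+ b) :- E :* (a :* b :* :- a :* b)) refl E a b

      to : ∀ a b → (b ⊞ b) · (b ⊞ b) ≡ E · product a b (⊟ a) b × product a b (⊟ a) b ≢ 𝟘 →
           𝟜 ≡ ⊟ E · (a · a) × b ≢ 𝟘
      to a b (sol , m≢0) = ⊟≡0⇒≡ (·-cancelˡ-0 (·≢0 b≢0 b≢0) (trans (key a b) (≡⇒⊟≡0 sol))) , b≢0
        where b≢0 = ·≢0⁻ʳ m≢0

      from : ∀ a b → 𝟜 ≡ ⊟ E · (a · a) × b ≢ 𝟘 →
             (b ⊞ b) · (b ⊞ b) ≡ E · product a b (⊟ a) b × product a b (⊟ a) b ≢ 𝟘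
      from a b (h , b≢0) = consequence (b · b) h (sym (key a b)) ,
        ·≢0 (·≢0 (·≢0 a≢0 b≢0) λ k → a≢0 (consequence (⊟ 𝟙) k
          (solve 1 (λ a → a :- con 0ℤ := :- con 1ℤ :* (:- a :- con 0ℤ)) refl a))) b≢0
        where a≢0 = special⇒≢0 h

    -- 2 d = s means d = t for t = a + b + c, and s = 2 t. Dividing 4 t² = E a b c t by t leaves an
    -- equation linear in c, namely (E a b - 4) c = 4 (a + b).
    S-one : S.∑ʷ one-of ≡ (q - 1ℤ) * (q - + 3) + q * #special
    S-one = begin
      ∑³ (λ a b c → ∑[ d ] S.term one-of a b c d)  ≡⟨ ∑³-cong pick-d ⟩
      ∑³ (λ a b c → w a b c)                       ≡⟨ ∑³-cong linearise ⟩
      ∑[ a ] ∑[ b ] ∑[ c ] (ν a * (ν b * (ν c * [ α a b · c ≟ β a b ])))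
        ≡⟨ ∑-cong (λ a → ∑-cong (λ b → trans
             (∑-*ˡ (ν a) (λ c → ν b * (ν c * [ α a b · c ≟ β a b ])))
             (cong (ν a *_) (trans (∑-*ˡ (ν b) (λ c → ν c * [ α a b · c ≟ β a b ]))
               (cong (ν b *_) (∑-linear-root (α a b) (β a b))))))) ⟩
      ∑[ a ] ∑[ b ] (ν a * (ν b * (1ℤ - X a b - Y a b + q * (X a b * Y a b))))
        ≡⟨ ∑-cong (λ a → trans (∑-*ˡ (ν a) (λ b → ν b * (1ℤ - X a b - Y a b + q * (X a b * Y a b))))
             ([]-*-cong (¬? (a ≟ 𝟘)) (sum-b a))) ⟩
      ∑[ a ] (ν a * (q - + 3 + q * [ special? a ]))
        ≡⟨ ∑-cong (λ a → trans (ℤ.*-distribˡ-+ (ν a) (q - + 3) _) (cong (_+_ (ν a * (q - + 3))) (drop-ν a))) ⟩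
      ∑[ a ] (ν a * (q - + 3) + q * [ special? a ])
        ≡⟨ ∑-+ (λ a → ν a * (q - + 3)) (λ a → q * [ special? a ]) ⟩
      ∑[ a ] (ν a * (q - + 3)) + ∑[ a ] (q * [ special? a ])
        ≡⟨ cong₂ _+_ (trans (∑-*ʳ (q - + 3) ν) (cong (_* (q - + 3)) ∑-ν))
                     (trans (∑-*ˡ q (λ a → [ special? a ])) (cong (q *_) ∑-special)) ⟩
      (q - 1ℤ) * (q - + 3) + q * #special ∎
      where
      w : F → F → F → ℤ
      w a b c = let t = a ⊞ b ⊞ c in [ nonzero-solution? (t ⊞ t) (product a b c t) ]

      pick-d : ∀ a b c → ∑[ d ] S.term one-of a b c d ≡ w a b c
      pick-d a b c = trans
        (∑-cong λ d → ℤ.*-comm _ [ half? d (total a b c d) ])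
        (∑-pick (λ d → half? d (total a b c d)) (a ⊞ b ⊞ c)
          (λ d → [ nonzero-solution? (total a b c d) (product a b c d) ]) refl
          (λ d h → consequence 𝟙 h (solve 4 (λ a b c d → d :- (a :+ b :+ c) :=
             con 1ℤ :* (d :+ d :- (a :+ b :+ c :+ d))) refl a b c d)))

      α β : F → F → F
      α a b = E · a · b ⊟ 𝟜
      β a b = 𝟜 · (a ⊞ b)

      X Y : F → F → ℤ
      X a b = [ α a b ≟ 𝟘 ]
      Y a b = [ β a b ≟ 𝟘 ]

      key : ∀ a b c → let t = a ⊞ b ⊞ c in
            t · (β a b ⊟ α a b · c) ≡ (t ⊞ t) · (t ⊞ t) ⊟ E · product a b c t
      key a b c = solve 4 (λ E a b c → let t = a :+ b :+ c ; four = con 1ℤ :+ con 1ℤ :+ con 1ℤ :+ con 1ℤ in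
        t :* (four :* (a :+ b) :- (E :* a :* b :- four) :* c) := (t :+ t) :* (t :+ t) :- E :* (a :* b :* c :* t)) refl E a b c

      linearise : ∀ a b c → w a b c ≡ ν a * (ν b * (ν c * [ α a b · c ≟ β a b ]))
      linearise a b c = trans
        ([]-cong (nonzero-solution? (t ⊞ t) (product a b c t))
          (¬? (a ≟ 𝟘) ×-dec (¬? (b ≟ 𝟘) ×-dec (¬? (c ≟ 𝟘) ×-dec (α a b · c ≟ β a b)))) to from)
        (trans ([]-× (¬? (a ≟ 𝟘)) (¬? (b ≟ 𝟘) ×-dec (¬? (c ≟ 𝟘) ×-dec (α a b · c ≟ β a b)))) (cong (ν a *_)
          (trans ([]-× (¬? (b ≟ 𝟘)) (¬? (c ≟ 𝟘) ×-dec (α a b · c ≟ β a b))) (cong (ν b *_) ([]-× (¬? (c ≟ 𝟘)) (α a b · c ≟ β a b))))))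
        where
        t = a ⊞ b ⊞ c
        to : (t ⊞ t) · (t ⊞ t) ≡ E · product a b c t × product a b c t ≢ 𝟘 →
             a ≢ 𝟘 × b ≢ 𝟘 × c ≢ 𝟘 × α a b · c ≡ β a b
        to (sol , m≢0) = ·≢0⁻ˡ (·≢0⁻ˡ (·≢0⁻ˡ m≢0)) , ·≢0⁻ʳ (·≢0⁻ˡ (·≢0⁻ˡ m≢0)) , ·≢0⁻ʳ (·≢0⁻ˡ m≢0) ,
          sym (⊟≡0⇒≡ (·-cancelˡ-0 (·≢0⁻ʳ m≢0) (trans (key a b c) (≡⇒⊟≡0 sol))))
        from : a ≢ 𝟘 × b ≢ 𝟘 × c ≢ 𝟘 × α a b · c ≡ β a b →
               (t ⊞ t) · (t ⊞ t) ≡ E · product a b c t × product a b c t ≢ 𝟘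
        from (a≢0 , b≢0 , c≢0 , h) = consequence t (sym h) (sym (key a b c)) ,
          -- The division by t is reversible: the linear equation says E a b c = 4 t, so t ≠ 0
          -- follows from it.
          ·≢0 (·≢0 (·≢0 a≢0 b≢0) c≢0) λ t≡0 → ·≢0 (·≢0 (·≢0 E≢0 a≢0) b≢0) c≢0 (begin
            E · a · b · c               ≡⟨ solve 4 (λ E a b c → let four = con 1ℤ :+ con 1ℤ :+ con 1ℤ :+ con 1ℤ in
                                             E :* a :* b :* c := (E :* a :* b :- four) :* c :+ four :* c) refl E a b c ⟩
            α a b · c ⊞ 𝟜 · c           ≡⟨ cong (_⊞ 𝟜 · c) h ⟩
            β a b ⊞ 𝟜 · c               ≡⟨ solve 4 (λ f a b c → f :* (a :+ b) :+ f :* c := f :* (a :+ b :+ c)) refl 𝟜 a b c ⟩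
            𝟜 · t                       ≡⟨ cong (𝟜 ·_) t≡0 ⟩
            𝟜 · 𝟘                       ≡⟨ zeroʳ 𝟜 ⟩
            𝟘                           ∎)

      -- Among nonzero b, `X` holds only at 4 / (E a) and `Y` only at -a; the two points coincide
      -- exactly when a is special.
      sum-b : ∀ a → a ≢ 𝟘 → ∑[ b ] (ν b * (1ℤ - X a b - Y a b + q * (X a b * Y a b))) ≡ q - + 3 + q * [ special? a ]
      sum-b a a≢0 with u , Eau≡1 ← inverse (E · a) (·≢0 E≢0 a≢0) = begin
        ∑[ b ] (ν b * (1ℤ - X a b - Y a b + q * (X a b * Y a b)))
          ≡⟨ ∑-cong (λ b → expand q (ν b) (X a b) (Y a b)) ⟩
        ∑[ b ] (ν b + -1ℤ * (X a b * ν b) + -1ℤ * (Y a b * ν b) + q * (Y a b * (ν b * X a b)))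
          ≡⟨ trans (∑-+ (λ b → ν b + -1ℤ * (X a b * ν b) + -1ℤ * (Y a b * ν b)) (λ b → q * (Y a b * (ν b * X a b))))
               (cong₂ _+_ (trans (∑-+ (λ b → ν b + -1ℤ * (X a b * ν b)) (λ b → -1ℤ * (Y a b * ν b)))
                 (cong₂ _+_ (trans (∑-+ ν (λ b → -1ℤ * (X a b * ν b)))
                   (cong₂ _+_ ∑-ν (trans (∑-*ˡ -1ℤ (λ b → X a b * ν b)) (cong (-1ℤ *_) ∑-X))))
                   (trans (∑-*ˡ -1ℤ (λ b → Y a b * ν b)) (cong (-1ℤ *_) ∑-Y))))
                 (trans (∑-*ˡ q (λ b → Y a b * (ν b * X a b))) (cong (q *_) ∑-XY))) ⟩
        q - 1ℤ + -1ℤ * 1ℤ + -1ℤ * 1ℤ + q * [ special? a ]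
          ≡⟨ cong (_+ q * [ special? a ]) (collect q) ⟩
        q - + 3 + q * [ special? a ] ∎
        where
        expand : ∀ q n x y → n * (1ℤ - x - y + q * (x * y)) ≡ n + -1ℤ * (x * n) + -1ℤ * (y * n) + q * (y * (n * x))
        expand = solve-∀
        collect : ∀ q → q - 1ℤ + -1ℤ * 1ℤ + -1ℤ * 1ℤ ≡ q - + 3
        collect = solve-∀
        Ea≢0 = ·≢0 E≢0 a≢0
        Eab≡4 : E · a · (u · 𝟜) ≡ 𝟜
        Eab≡4 = trans (sym (*-assoc (E · a) u 𝟜)) (trans (cong (_· 𝟜) Eau≡1) (*-identityˡ 𝟜))
        ⊟a≢0 : ⊟ a ≢ 𝟘
        ⊟a≢0 h = a≢0 (consequence (⊟ 𝟙) h (solve 1 (λ a → a :- con 0ℤ := :- con 1ℤ :* (:- a :- con 0ℤ)) refl a))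
        β-root : β a (⊟ a) ≡ 𝟘
        β-root = trans (cong (𝟜 ·_) (-‿inverseʳ a)) (zeroʳ 𝟜)
        β-unique : ∀ b → β a b ≡ 𝟘 → b ≡ ⊟ a
        β-unique b h = consequence 𝟙 (·-cancelˡ-0 4≢0 h)
          (solve 2 (λ a b → b :- :- a := con 1ℤ :* (a :+ b :- con 0ℤ)) refl a b)
        ∑-X : ∑[ b ] (X a b * ν b) ≡ 1ℤ
        ∑-X = trans
          (∑-pick (λ b → α a b ≟ 𝟘) (u · 𝟜) ν (≡⇒⊟≡0 Eab≡4)
            (λ b h → ·-cancelˡ Ea≢0 (trans (⊟≡0⇒≡ h) (sym Eab≡4))))
          (ν-≢0 λ h → 4≢0 (trans (sym Eab≡4) (trans (cong (E · a ·_) h) (zeroʳ (E · a)))))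
        ∑-Y : ∑[ b ] (Y a b * ν b) ≡ 1ℤ
        ∑-Y = trans (∑-pick (λ b → β a b ≟ 𝟘) (⊟ a) ν β-root β-unique) (ν-≢0 ⊟a≢0)
        ∑-XY : ∑[ b ] (Y a b * (ν b * X a b)) ≡ [ special? a ]
        ∑-XY = begin
          ∑[ b ] (Y a b * (ν b * X a b))
            ≡⟨ ∑-pick (λ b → β a b ≟ 𝟘) (⊟ a) (λ b → ν b * X a b) β-root β-unique ⟩
          ν (⊟ a) * X a (⊟ a)   ≡⟨ cong (_* X a (⊟ a)) (ν-≢0 ⊟a≢0) ⟩
          1ℤ * X a (⊟ a)        ≡⟨ ℤ.*-identityˡ (X a (⊟ a)) ⟩
          X a (⊟ a)
            ≡⟨ []-cong (α a (⊟ a) ≟ 𝟘) (special? a)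
                 (λ h → trans (sym (⊟≡0⇒≡ h)) (assoc a)) (λ h → ≡⇒⊟≡0 (trans (assoc a) (sym h))) ⟩
          [ special? a ] ∎
          where
          assoc : ∀ a → E · a · ⊟ a ≡ ⊟ E · (a · a)
          assoc a = solve 2 (λ E a → E :* a :* :- a := :- E :* (a :* a)) refl E a

      drop-ν : ∀ a → ν a * (q * [ special? a ]) ≡ q * [ special? a ]
      drop-ν a with special? a
      ... | yes h = trans (cong (_* (q * 1ℤ)) (ν-≢0 (special⇒≢0 h))) (ℤ.*-identityˡ _)
      ... | no _  = trans (cong (ν a *_) (ℤ.*-zeroʳ q)) (trans (ℤ.*-zeroʳ (ν a)) (sym (ℤ.*-zeroʳ q)))

    U-sum : ∀ P → U.∑ʷ P ≡ ∑³ (λ a b c → P (ν a) (ν b) (ν c) (ν (𝟘 ⊟ a ⊟ b ⊟ c)))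
    U-sum P = ∑³-cong λ a b c → ∑-pick (λ d → total a b c d ≟ 𝟘) (𝟘 ⊟ a ⊟ b ⊟ c) (λ d → P (ν a) (ν b) (ν c) (ν d))
      (solve 3 (λ a b c → a :+ b :+ c :+ (con 0ℤ :- a :- b :- c) := con 0ℤ) refl a b c)
      (λ d h → consequence 𝟙 h (solve 4 (λ a b c d → d :- (con 0ℤ :- a :- b :- c) :=
         con 1ℤ :* (a :+ b :+ c :+ d :- con 0ℤ)) refl a b c d))

    U-four : U.∑ʷ four-of ≡ Triv.V 𝟘
    U-four = trans (U-sum four-of) (Triv.∑³-χ 𝟘)

    U-one : U.∑ʷ (λ _ _ _ _ → 1ℤ) ≡ q * q * q
    U-one = trans (U-sum (λ _ _ _ _ → 1ℤ)) ∑³-1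

    ∑³-ν : ∑³ (λ a b c → ν a * ν b * ν c) ≡ (q - 1ℤ) * (q - 1ℤ) * (q - 1ℤ)
    ∑³-ν = begin
      ∑[ a ] ∑[ b ] ∑[ c ] (ν a * ν b * ν c)
        ≡⟨ ∑-cong (λ a → ∑-cong (λ b → trans (∑-*ˡ (ν a * ν b) ν) (cong (ν a * ν b *_) ∑-ν))) ⟩
      ∑[ a ] ∑[ b ] (ν a * ν b * (q - 1ℤ))
        ≡⟨ ∑-cong (λ a → trans (∑-*ʳ (q - 1ℤ) (λ b → ν a * ν b))
             (cong (_* (q - 1ℤ)) (trans (∑-*ˡ (ν a) ν) (cong (ν a *_) ∑-ν)))) ⟩
      ∑[ a ] (ν a * (q - 1ℤ) * (q - 1ℤ))
        ≡⟨ trans (∑-*ʳ (q - 1ℤ) (λ a → ν a * (q - 1ℤ)))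
             (cong (_* (q - 1ℤ)) (trans (∑-*ʳ (q - 1ℤ) ν) (cong (_* (q - 1ℤ)) ∑-ν))) ⟩
      (q - 1ℤ) * (q - 1ℤ) * (q - 1ℤ) ∎

    -- The factor 1 - w subtracts the vectors of total 0 with four nonzero coordinates from those
    -- whose first three are nonzero; the latter are (q - 1)³, the fourth coordinate being
    -- determined.
    U-three-only : U.∑ʷ three-only ≡ (q - 1ℤ) * (q - + 2)
    U-three-only = begin
      U.∑ʷ three-only
        ≡⟨ ∑⁴-cong (λ a b c d → cong ([ total a b c d ≟ 𝟘 ] *_) (expand (ν a * ν b * ν c) (ν d))) ⟩
      U.∑ʷ (λ x y z w → x * y * z - four-of x y z w)  ≡⟨ U.∑ʷ-- three-of four-of ⟩
      U.∑ʷ three-of - U.∑ʷ four-of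
        ≡⟨ cong₂ _-_ (trans (U-sum three-of) ∑³-ν) (trans U-four triv-V-0) ⟩
      _ ≡⟨ evaluate q ⟩
      (q - 1ℤ) * (q - + 2) ∎
      where
      expand : ∀ x w → x * (1ℤ - w) ≡ x - x * w
      expand = solve-∀
      evaluate : ∀ q → (q - 1ℤ) * (q - 1ℤ) * (q - 1ℤ) - ((q - 1ℤ) * (q - 1ℤ) + (q - 1ℤ) * ((q - + 2) * (q - + 2)))
                 ≡ (q - 1ℤ) * (q - + 2)
      evaluate = solve-∀

    -- Nonvanishing partial derivatives at a solution.

    moves? : ∀ s m → Dec (derivative E s m ≢ 𝟘)
    moves? s m = ¬? (derivative E s m ≟ 𝟘)

    #moves : F → F → F → F → ℕ
    #moves a b c d = let s = total a b c d in count₄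
      (does (moves? s (b · c · d))) (does (moves? s (a · c · d)))
      (does (moves? s (a · b · d))) (does (moves? s (a · b · c)))

    count₄-cong : ∀ {x x′ y y′ z z′ w w′} → x ≡ x′ → y ≡ y′ → z ≡ z′ → w ≡ w′ →
                  count₄ x y z w ≡ count₄ x′ y′ z′ w′
    count₄-cong refl refl refl refl = refl

    moves-at-0 : ∀ {s} → s ≡ 𝟘 → ∀ x y z → does (moves? s (x · y · z)) ≡
                 does (¬? (x ≟ 𝟘)) ∧ does (¬? (y ≟ 𝟘)) ∧ does (¬? (z ≟ 𝟘))
    moves-at-0 refl x y z = does-⇔ (mk⇔ to from) (moves? 𝟘 (x · y · z)) (¬? (x ≟ 𝟘) ×-dec (¬? (y ≟ 𝟘) ×-dec ¬? (z ≟ 𝟘)))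
      where
      to : derivative E 𝟘 (x · y · z) ≢ 𝟘 → x ≢ 𝟘 × y ≢ 𝟘 × z ≢ 𝟘
      to h = ·≢0⁻ˡ (·≢0⁻ˡ xyz≢0) , ·≢0⁻ʳ (·≢0⁻ˡ xyz≢0) , ·≢0⁻ʳ xyz≢0
        where
        xyz≢0 : x · y · z ≢ 𝟘
        xyz≢0 k = h (consequence (⊟ E) k (solve 2 (λ E m → con 0ℤ :+ con 0ℤ :- E :* m :- con 0ℤ :=
          :- E :* (m :- con 0ℤ)) refl E (x · y · z)))
      from : x ≢ 𝟘 × y ≢ 𝟘 × z ≢ 𝟘 → derivative E 𝟘 (x · y · z) ≢ 𝟘
      from (x≢0 , y≢0 , z≢0) h = ·≢0 E≢0 (·≢0 (·≢0 x≢0 y≢0) z≢0) (consequence (⊟ 𝟙) h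
        (solve 2 (λ E m → E :* m :- con 0ℤ := :- con 1ℤ :* (con 0ℤ :+ con 0ℤ :- E :* m :- con 0ℤ)) refl E (x · y · z)))

    -- On a solution, a · ∂f/∂a = s (2a - s).
    moves-off-0 : ∀ {s a m} → s ≢ 𝟘 → a ≢ 𝟘 → s · s ≡ E · (a · m) →
                  does (moves? s m) ≡ not (does (half? a s))
    moves-off-0 {s} {a} {m} s≢0 a≢0 sol = does-⇔ (mk⇔ to from) (moves? s m) (¬? (half? a s))
      where
      key : a · derivative E s m ≡ s · (a ⊞ a ⊟ s)
      key = ⊟≡0⇒≡ (trans (solve 4 (λ E s a m → a :* (s :+ s :- E :* m) :- s :* (a :+ a :- s) :=
        s :* s :- E :* (a :* m)) refl E s a m) (≡⇒⊟≡0 sol))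
      to : derivative E s m ≢ 𝟘 → a ⊞ a ≢ s
      to h k = ·≢0 a≢0 h (trans key (trans (cong (s ·_) (≡⇒⊟≡0 k)) (zeroʳ s)))
      from : a ⊞ a ≢ s → derivative E s m ≢ 𝟘
      from h k = h (⊟≡0⇒≡ (·-cancelˡ-0 s≢0 (trans (sym key) (trans (cong (a ·_) k) (zeroʳ a)))))

    nonzero-term zero-term : ℕ → F → F → F → F → ℤ
    nonzero-term k a b c d = let s = total a b c d in
      [ nonzero-solution? s (product a b c d) ] *
        nonzero-pattern k (does (half? a s)) (does (half? b s)) (does (half? c s)) (does (half? d s))
    zero-term k a b c d =
      [ total a b c d ≟ 𝟘 ] *
        zero-pattern k (does (¬? (a ≟ 𝟘))) (does (¬? (b ≟ 𝟘))) (does (¬? (c ≟ 𝟘))) (does (¬? (d ≟ 𝟘)))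

    -- The product m selects the summand. If m = 0, the equation reduces to s = 0 and the first term
    -- vanishes. If m ≠ 0, a solution has s ≠ 0, and the factor of the second term that demands a
    -- zero coordinate vanishes.
    #moves-split : ∀ k a b c d → [ solution? E≢0 a b c d ] * [ #moves a b c d ℕ.≟ k ] ≡
                   nonzero-term k a b c d + zero-term k a b c d
    #moves-split k a b c d = go (m ≟ 𝟘)
      where
      s m : F
      s = total a b c d
      m = product a b c d

      all-≢0? : Dec (a ≢ 𝟘 × b ≢ 𝟘 × c ≢ 𝟘 × d ≢ 𝟘)
      all-≢0? = ¬? (a ≟ 𝟘) ×-dec (¬? (b ≟ 𝟘) ×-dec (¬? (c ≟ 𝟘) ×-dec ¬? (d ≟ 𝟘)))

      moved : ℤ
      moved = [ #moves a b c d ℕ.≟ k ]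

      one-zero : ℤ
      one-zero = let x = does (¬? (a ≟ 𝟘)) ; y = does (¬? (b ≟ 𝟘)) ; z = does (¬? (c ≟ 𝟘)) ; w = does (¬? (d ≟ 𝟘)) in
        [ count₄ (y ∧ z ∧ w) (x ∧ z ∧ w) (x ∧ y ∧ w) (x ∧ y ∧ z) ℕ.≟ k ]

      go : Dec (m ≡ 𝟘) → [ solution? E≢0 a b c d ] * moved ≡ nonzero-term k a b c d + zero-term k a b c d
      go (yes m≡0) = begin
        [ solution? E≢0 a b c d ] * moved
          ≡⟨ cong (_* moved) ([]-cong (solution? E≢0 a b c d) (s ≟ 𝟘) to from) ⟩
        [ s ≟ 𝟘 ] * moved
          ≡⟨ []-*-cong (s ≟ 𝟘) (λ s≡0 → trans
               (cong (λ n → [ n ℕ.≟ k ]) (count₄-cong (moves-at-0 s≡0 b c d) (moves-at-0 s≡0 a c d)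
                                          (moves-at-0 s≡0 a b d) (moves-at-0 s≡0 a b c)))
               (sym (trans (cong (λ x → ⟨ not x ⟩ * one-zero) (dec-false all-≢0? some-0)) (ℤ.*-identityˡ one-zero)))) ⟩
        zero-term k a b c d
          ≡⟨ ℤ.+-identityˡ (zero-term k a b c d) ⟨
        0ℤ + zero-term k a b c d
          ≡⟨ cong (_+ zero-term k a b c d)
               ([]-*-zero (nonzero-solution? s m) (λ (_ , m≢0) → contradiction m≡0 m≢0)) ⟨
        nonzero-term k a b c d + zero-term k a b c d ∎
        where
        Em≡0 : E · m ≡ 𝟘
        Em≡0 = trans (cong (E ·_) m≡0) (zeroʳ E)
        to : s · s ≡ E · m → s ≡ 𝟘
        to h with ·≡0 (trans h Em≡0)
        ... | inj₁ s≡0 = s≡0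
        ... | inj₂ s≡0 = s≡0
        from : s ≡ 𝟘 → s · s ≡ E · m
        from h = trans (cong (_· s) h) (trans (zeroˡ s) (sym Em≡0))
        some-0 : ¬ (a ≢ 𝟘 × b ≢ 𝟘 × c ≢ 𝟘 × d ≢ 𝟘)
        some-0 (a≢0 , b≢0 , c≢0 , d≢0) = ·≢0 (·≢0 (·≢0 a≢0 b≢0) c≢0) d≢0 m≡0
      go (no m≢0) = begin
        [ solution? E≢0 a b c d ] * moved
          ≡⟨ []-*-cong (solution? E≢0 a b c d) (λ sol → cong (λ n → [ n ℕ.≟ k ]) (count₄-cong
               (moves-off-0 (s≢0 sol) a≢0 (trans sol (cong (E ·_) (solve 4 (λ a b c d → a :* b :* c :* d := a :* (b :* c :* d)) refl a b c d))))
               (moves-off-0 (s≢0 sol) b≢0 (trans sol (cong (E ·_) (solve 4 (λ a b c d → a :* b :* c :* d := b :* (a :* c :* d)) refl a b c d))))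
               (moves-off-0 (s≢0 sol) c≢0 (trans sol (cong (E ·_) (solve 4 (λ a b c d → a :* b :* c :* d := c :* (a :* b :* d)) refl a b c d))))
               (moves-off-0 (s≢0 sol) d≢0 (trans sol (cong (E ·_) (solve 4 (λ a b c d → a :* b :* c :* d := d :* (a :* b :* c)) refl a b c d)))))) ⟩
        [ solution? E≢0 a b c d ] * _
          ≡⟨ cong (_* nonzero-pattern k (does (half? a s)) (does (half? b s)) (does (half? c s)) (does (half? d s)))
               ([]-cong (solution? E≢0 a b c d) (nonzero-solution? s m) (λ sol → sol , m≢0) proj₁) ⟩
        nonzero-term k a b c d
          ≡⟨ ℤ.+-identityʳ (nonzero-term k a b c d) ⟨
        nonzero-term k a b c d + 0ℤ
          ≡⟨ cong (_+_ (nonzero-term k a b c d))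
               (trans (cong (λ x → [ s ≟ 𝟘 ] * (⟨ not x ⟩ * one-zero)) (dec-true all-≢0? (a≢0 , b≢0 , c≢0 , d≢0)))
                 (ℤ.*-zeroʳ [ s ≟ 𝟘 ])) ⟨
        nonzero-term k a b c d + zero-term k a b c d ∎
        where
        a≢0 = ·≢0⁻ˡ (·≢0⁻ˡ (·≢0⁻ˡ m≢0))
        b≢0 = ·≢0⁻ʳ (·≢0⁻ˡ (·≢0⁻ˡ m≢0))
        c≢0 = ·≢0⁻ʳ (·≢0⁻ˡ m≢0)
        d≢0 = ·≢0⁻ʳ m≢0
        s≢0 : s · s ≡ E · m → s ≢ 𝟘
        s≢0 sol s≡0 = ·≢0 E≢0 m≢0 (trans (sym sol) (trans (cong (_· s) s≡0) (zeroˡ s)))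

    ∑-moves : ℕ → ℤ
    ∑-moves k = ∑⁴ λ a b c d → [ solution? E≢0 a b c d ] * [ #moves a b c d ℕ.≟ k ]

    ∑-moves≡ : ∀ {k} → Degree k → ∑-moves k ≡ S.∑ʷ (nonzero-polynomial k) + U.∑ʷ (zero-polynomial k)
    ∑-moves≡ {k} deg = trans
      (∑⁴-cong λ a b c d → let s = total a b c d in trans (#moves-split k a b c d) (cong₂ _+_
        (cong ([ nonzero-solution? s (product a b c d) ] *_)
          (nonzero-pattern≡ deg (does (half? a s)) (does (half? b s)) (does (half? c s)) (does (half? d s))))
        (cong ([ s ≟ 𝟘 ] *_)
          (zero-pattern≡ deg (does (¬? (a ≟ 𝟘))) (does (¬? (b ≟ 𝟘))) (does (¬? (c ≟ 𝟘))) (does (¬? (d ≟ 𝟘)))))))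
      (∑⁴-+ (S.term (nonzero-polynomial k)) (U.term (zero-polynomial k)))

    S-orbit-one : S.∑ʷ (orbit₄ one-of) ≡ + 4 * ((q - 1ℤ) * (q - + 3) + q * #special)
    S-orbit-one = trans (S.∑ʷ-orbit₄ one-of) (cong (+ 4 *_) S-one)

    S-orbit-two : S.∑ʷ (orbit₆ two-of) ≡ + 6 * ((q - 1ℤ) * #special)
    S-orbit-two = trans (S.∑ʷ-orbit₆ two-of) (cong (+ 6 *_) S-two)

    S-orbit-three : S.∑ʷ (orbit₄ three-of) ≡ + 4 * #special
    S-orbit-three = trans (S.∑ʷ-orbit₄ three-of) (cong (+ 4 *_) S-three)

    scaled : ∀ k P {x} → S.∑ʷ P ≡ x → S.∑ʷ (λ x y z w → k * P x y z w) ≡ k * x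
    scaled k P eq = trans (S.∑ʷ-*ˡ k P) (cong (k *_) eq)

    U-zero : U.∑ʷ (λ _ _ _ _ → 0ℤ) ≡ 0ℤ
    U-zero = ∑-zero λ a → ∑-zero λ b → ∑-zero λ c → ∑-zero λ d → ℤ.*-zeroʳ [ total a b c d ≟ 𝟘 ]

    U-orbit : U.∑ʷ (orbit₄ three-only) ≡ + 4 * ((q - 1ℤ) * (q - + 2))
    U-orbit = trans (U.∑ʷ-orbit₄ three-only) (cong (+ 4 *_) U-three-only)

    -- `#special` enters with total coefficient 4 q - 12 (q - 1) + 12 = -8 (q - 3), and its constant
    -- part 1 turns 4 (q - 1)(q - 3) into 4 (q - 3)².
    #degree-3 : ∑-moves 3 ≡ + 4 * ((q - + 3) ^ 2 - + 2 * η (⊟ E) * (q - + 3))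
    #degree-3 = begin
      ∑-moves 3 ≡⟨ ∑-moves≡ deg3 ⟩
      S.∑ʷ (nonzero-polynomial 3) + U.∑ʷ (λ _ _ _ _ → 0ℤ)
        ≡⟨ cong₂ _+_ (trans (S.∑ʷ-- P₃ (λ x y z w → + 4 * four-of x y z w)) (cong₂ _-_
             (trans (S.∑ʷ-+ P₂ (λ x y z w → + 3 * orbit₄ three-of x y z w)) (cong₂ _+_
               (trans (S.∑ʷ-- (orbit₄ one-of) (λ x y z w → + 2 * orbit₆ two-of x y z w)) (cong₂ _-_
                 S-orbit-one (scaled (+ 2) (orbit₆ two-of) S-orbit-two)))
               (scaled (+ 3) (orbit₄ three-of) S-orbit-three)))
             (scaled (+ 4) four-of S-four))) U-zero ⟩
      _ ≡⟨ evaluate q (η (⊟ E)) ⟩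
      + 4 * ((q - + 3) ^ 2 - + 2 * η (⊟ E) * (q - + 3)) ∎
      where
      P₂ P₃ : Pattern
      P₂ x y z w = orbit₄ one-of x y z w - + 2 * orbit₆ two-of x y z w
      P₃ x y z w = P₂ x y z w + + 3 * orbit₄ three-of x y z w
      evaluate : ∀ q e → + 4 * ((q - 1ℤ) * (q - + 3) + q * (1ℤ + e)) - + 2 * (+ 6 * ((q - 1ℤ) * (1ℤ + e)))
                         + + 3 * (+ 4 * (1ℤ + e)) - + 4 * 0ℤ + 0ℤ
                       ≡ + 4 * ((q - + 3) * ((q - + 3) * 1ℤ) - + 2 * e * (q - + 3))
      evaluate = solve-∀

    -- The factor q - 3 reflects the choices of b in (a, b, -a, b) other than 0, a and -a: at b = a
    -- or b = -a a third condition holds.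
    #degree-2 : ∑-moves 2 ≡ + 6 * (1ℤ + η (⊟ E)) * (q - + 3)
    #degree-2 = begin
      ∑-moves 2 ≡⟨ ∑-moves≡ deg2 ⟩
      S.∑ʷ (nonzero-polynomial 2) + U.∑ʷ (λ _ _ _ _ → 0ℤ)
        ≡⟨ cong₂ _+_ (trans (S.∑ʷ-+ P₂ (λ x y z w → + 6 * four-of x y z w)) (cong₂ _+_
             (trans (S.∑ʷ-- (orbit₆ two-of) (λ x y z w → + 3 * orbit₄ three-of x y z w)) (cong₂ _-_
               S-orbit-two (scaled (+ 3) (orbit₄ three-of) S-orbit-three)))
             (scaled (+ 6) four-of S-four))) U-zero ⟩
      _ ≡⟨ evaluate q (η (⊟ E)) ⟩
      + 6 * (1ℤ + η (⊟ E)) * (q - + 3) ∎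
      where
      P₂ : Pattern
      P₂ x y z w = orbit₆ two-of x y z w - + 3 * orbit₄ three-of x y z w
      evaluate : ∀ q e → + 6 * ((q - 1ℤ) * (1ℤ + e)) - + 3 * (+ 4 * (1ℤ + e)) + + 6 * 0ℤ + 0ℤ
                       ≡ + 6 * (1ℤ + e) * (q - + 3)
      evaluate = solve-∀

    -- Vectors with exactly one zero coordinate contribute 4 (q - 1)(q - 2), and the arrangements of
    -- (a, a, a, -a) with a special contribute 4 (1 + η(-E)).
    #degree-1 : ∑-moves 1 ≡ + 4 * (q ^ 2 - + 3 * q + + 3 + η (⊟ E))
    #degree-1 = begin
      ∑-moves 1 ≡⟨ ∑-moves≡ deg1 ⟩
      S.∑ʷ (nonzero-polynomial 1) + U.∑ʷ (orbit₄ three-only)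
        ≡⟨ cong₂ _+_ (trans (S.∑ʷ-- (orbit₄ three-of) (λ x y z w → + 4 * four-of x y z w)) (cong₂ _-_
             S-orbit-three (scaled (+ 4) four-of S-four))) U-orbit ⟩
      _ ≡⟨ evaluate q (η (⊟ E)) ⟩
      + 4 * (q ^ 2 - + 3 * q + + 3 + η (⊟ E)) ∎
      where
      evaluate : ∀ q e → + 4 * (1ℤ + e) - + 4 * 0ℤ + + 4 * ((q - 1ℤ) * (q - + 2))
                       ≡ + 4 * (q * (q * 1ℤ) - + 3 * q + + 3 + e)
      evaluate = solve-∀

    -- By `S-four` only vectors of total 0 remain. The value is 6 (q - 1) + 1: the arrangements of
    -- (x, -x, 0, 0) with x ≠ 0, and the zero vector.
    #degree-0 : ∑-moves 0 ≡ + 6 * q - + 5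
    #degree-0 = begin
      ∑-moves 0 ≡⟨ ∑-moves≡ deg0 ⟩
      S.∑ʷ four-of + U.∑ʷ (λ x y z w → 1ℤ - four-of x y z w - orbit₄ three-only x y z w)
        ≡⟨ cong₂ _+_ S-four (trans (U.∑ʷ-- (λ x y z w → 1ℤ - four-of x y z w) (orbit₄ three-only)) (cong₂ _-_
             (trans (U.∑ʷ-- (λ _ _ _ _ → 1ℤ) four-of) (cong₂ _-_ U-one (trans U-four triv-V-0))) U-orbit)) ⟩
      _ ≡⟨ evaluate q ⟩
      + 6 * q - + 5 ∎
      where
      evaluate : ∀ q → 0ℤ + (q * q * q - ((q - 1ℤ) * (q - 1ℤ) + (q - 1ℤ) * ((q - + 2) * (q - + 2)))
                         - + 4 * ((q - 1ℤ) * (q - + 2))) ≡ + 6 * q - + 5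
      evaluate = solve-∀

-- Algebra of the Vieta flips.

module VietaFlips {p : ℕ} (K : OddField p) (E : Fin p) where

  open FieldSums K
  open Convolutions K
  open RS using (solve; _:=_; _:+_; _:*_; _:-_; :-_; con)

  Point : Set
  Point = Vec F 4

  value : Point → F
  value (a ∷ b ∷ c ∷ d ∷ []) = total a b c d · total a b c d ⊟ E · product a b c d

  partial : Fin 4 → Point → F
  partial zero                   (a ∷ b ∷ c ∷ d ∷ []) = derivative E (total a b c d) (b · c · d)
  partial (suc zero)             (a ∷ b ∷ c ∷ d ∷ []) = derivative E (total a b c d) (a · c · d)
  partial (suc (suc zero))       (a ∷ b ∷ c ∷ d ∷ []) = derivative E (total a b c d) (a · b · d)
  partial (suc (suc (suc zero))) (a ∷ b ∷ c ∷ d ∷ []) = derivative E (total a b c d) (a · b · c)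

  vieta : Fin 4 → Point → Point
  vieta i x = x [ i ]≔ (lookup x i ⊟ partial i x)

  -- The values at a ∷ b ∷ c ∷ d ∷ [] of the two halves of the formal derivative of the quartic,
  -- where δ₁, …, δ₄ are the derivatives of the four variables.
  ∂square : F → F → F → F → Point → F
  ∂square δ₁ δ₂ δ₃ δ₄ (a ∷ b ∷ c ∷ d ∷ []) =
    (δ₁ ⊞ δ₂ ⊞ δ₃ ⊞ δ₄) · total a b c d ⊞ total a b c d · (δ₁ ⊞ δ₂ ⊞ δ₃ ⊞ δ₄)

  ∂product : F → F → F → F → Point → F
  ∂product δ₁ δ₂ δ₃ δ₄ (a ∷ b ∷ c ∷ d ∷ []) =
    (((𝟘 · a ⊞ E · δ₁) · b ⊞ E · a · δ₂) · c ⊞ E · a · b · δ₃) · d ⊞ E · a · b · c · δ₄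

  -- The left side has the shape in which the formal derivative evaluates; its term `𝟘 · a` is the
  -- derivative of the constant E times the first variable.
  product-rule-1 : ∀ x → ∂square 𝟙 𝟘 𝟘 𝟘 x ⊟ ∂product 𝟙 𝟘 𝟘 𝟘 x ≡ partial zero x
  product-rule-1 (a ∷ b ∷ c ∷ d ∷ []) = solve 5 (λ E a b c d →
    let 0# = con 0ℤ ; 1# = con 1ℤ ; s = a :+ b :+ c :+ d ; δ = 1# :+ 0# :+ 0# :+ 0# in
    δ :* s :+ s :* δ :- ((((0# :* a :+ E :* 1#) :* b :+ E :* a :* 0#) :* c :+ E :* a :* b :* 0#) :* d :+ E :* a :* b :* c :* 0#)
      := s :+ s :- E :* (b :* c :* d)) refl E a b c d

  product-rule-2 : ∀ x → ∂square 𝟘 𝟙 𝟘 𝟘 x ⊟ ∂product 𝟘 𝟙 𝟘 𝟘 x ≡ partial (suc zero) x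
  product-rule-2 (a ∷ b ∷ c ∷ d ∷ []) = solve 5 (λ E a b c d →
    let 0# = con 0ℤ ; 1# = con 1ℤ ; s = a :+ b :+ c :+ d ; δ = 0# :+ 1# :+ 0# :+ 0# in
    δ :* s :+ s :* δ :- ((((0# :* a :+ E :* 0#) :* b :+ E :* a :* 1#) :* c :+ E :* a :* b :* 0#) :* d :+ E :* a :* b :* c :* 0#)
      := s :+ s :- E :* (a :* c :* d)) refl E a b c d

  product-rule-3 : ∀ x → ∂square 𝟘 𝟘 𝟙 𝟘 x ⊟ ∂product 𝟘 𝟘 𝟙 𝟘 x ≡ partial (suc (suc zero)) x
  product-rule-3 (a ∷ b ∷ c ∷ d ∷ []) = solve 5 (λ E a b c d →
    let 0# = con 0ℤ ; 1# = con 1ℤ ; s = a :+ b :+ c :+ d ; δ = 0# :+ 0# :+ 1# :+ 0# in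
    δ :* s :+ s :* δ :- ((((0# :* a :+ E :* 0#) :* b :+ E :* a :* 0#) :* c :+ E :* a :* b :* 1#) :* d :+ E :* a :* b :* c :* 0#)
      := s :+ s :- E :* (a :* b :* d)) refl E a b c d

  product-rule-4 : ∀ x → ∂square 𝟘 𝟘 𝟘 𝟙 x ⊟ ∂product 𝟘 𝟘 𝟘 𝟙 x ≡ partial (suc (suc (suc zero))) x
  product-rule-4 (a ∷ b ∷ c ∷ d ∷ []) = solve 5 (λ E a b c d →
    let 0# = con 0ℤ ; 1# = con 1ℤ ; s = a :+ b :+ c :+ d ; δ = 0# :+ 0# :+ 0# :+ 1# in
    δ :* s :+ s :* δ :- ((((0# :* a :+ E :* 0#) :* b :+ E :* a :* 0#) :* c :+ E :* a :* b :* 0#) :* d :+ E :* a :* b :* c :* 1#)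
      := s :+ s :- E :* (a :* b :* c)) refl E a b c d

  -- As a polynomial in the flipped coordinate z, f is z² + B z + C with derivative 2 z + B, so the
  -- flip is the reflection of z to -B - z. It preserves the value of f at every point, solution or
  -- not.
  value-vieta : ∀ i x → value (vieta i x) ≡ value x
  value-vieta zero (a ∷ b ∷ c ∷ d ∷ []) = solve 5 (λ E a b c d →
    let s = a :+ b :+ c :+ d ; x′ = a :- (s :+ s :- E :* (b :* c :* d)) ; s′ = x′ :+ b :+ c :+ d in
    s′ :* s′ :- E :* (x′ :* b :* c :* d) := s :* s :- E :* (a :* b :* c :* d)) refl E a b c d
  value-vieta (suc zero) (a ∷ b ∷ c ∷ d ∷ []) = solve 5 (λ E a b c d →
    let s = a :+ b :+ c :+ d ; x′ = b :- (s :+ s :- E :* (a :* c :* d)) ; s′ = a :+ x′ :+ c :+ d in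
    s′ :* s′ :- E :* (a :* x′ :* c :* d) := s :* s :- E :* (a :* b :* c :* d)) refl E a b c d
  value-vieta (suc (suc zero)) (a ∷ b ∷ c ∷ d ∷ []) = solve 5 (λ E a b c d →
    let s = a :+ b :+ c :+ d ; x′ = c :- (s :+ s :- E :* (a :* b :* d)) ; s′ = a :+ b :+ x′ :+ d in
    s′ :* s′ :- E :* (a :* b :* x′ :* d) := s :* s :- E :* (a :* b :* c :* d)) refl E a b c d
  value-vieta (suc (suc (suc zero))) (a ∷ b ∷ c ∷ d ∷ []) = solve 5 (λ E a b c d →
    let s = a :+ b :+ c :+ d ; x′ = d :- (s :+ s :- E :* (a :* b :* c)) ; s′ = a :+ b :+ c :+ x′ in
    s′ :* s′ :- E :* (a :* b :* c :* x′) := s :* s :- E :* (a :* b :* c :* d)) refl E a b c d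

  -- The coefficient B of the flipped quadratic does not involve the flipped coordinate, so the
  -- second flip is the same reflection as the first.
  vieta-involutive : ∀ i x → vieta i (vieta i x) ≡ x
  vieta-involutive zero (a ∷ b ∷ c ∷ d ∷ []) = cong (λ z → z ∷ b ∷ c ∷ d ∷ []) (solve 5 (λ E a b c d →
    let s = a :+ b :+ c :+ d ; m = b :* c :* d ; x′ = a :- (s :+ s :- E :* m) ; s′ = x′ :+ b :+ c :+ d in
    x′ :- (s′ :+ s′ :- E :* m) := a) refl E a b c d)
  vieta-involutive (suc zero) (a ∷ b ∷ c ∷ d ∷ []) = cong (λ z → a ∷ z ∷ c ∷ d ∷ []) (solve 5 (λ E a b c d →
    let s = a :+ b :+ c :+ d ; m = a :* c :* d ; x′ = b :- (s :+ s :- E :* m) ; s′ = a :+ x′ :+ c :+ d in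
    x′ :- (s′ :+ s′ :- E :* m) := b) refl E a b c d)
  vieta-involutive (suc (suc zero)) (a ∷ b ∷ c ∷ d ∷ []) = cong (λ z → a ∷ b ∷ z ∷ d ∷ []) (solve 5 (λ E a b c d →
    let s = a :+ b :+ c :+ d ; m = a :* b :* d ; x′ = c :- (s :+ s :- E :* m) ; s′ = a :+ b :+ x′ :+ d in
    x′ :- (s′ :+ s′ :- E :* m) := c) refl E a b c d)
  vieta-involutive (suc (suc (suc zero))) (a ∷ b ∷ c ∷ d ∷ []) = cong (λ z → a ∷ b ∷ c ∷ z ∷ []) (solve 5 (λ E a b c d →
    let s = a :+ b :+ c :+ d ; m = a :* b :* c ; x′ = d :- (s :+ s :- E :* m) ; s′ = a :+ b :+ c :+ x′ in
    x′ :- (s′ :+ s′ :- E :* m) := d) refl E a b c d)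

  value-assoc : ∀ a b c d → total a b c d · total a b c d ⊟ E · a · b · c · d ≡ value (a ∷ b ∷ c ∷ d ∷ [])
  value-assoc a b c d = cong (_⊟_ (total a b c d · total a b c d))
    (solve 5 (λ E a b c d → E :* a :* b :* c :* d := E :* (a :* b :* c :* d)) refl E a b c d)

  vieta-fixed : ∀ i x → partial i x ≡ 𝟘 → vieta i x ≡ x
  vieta-fixed i x h = trans
    (cong (x [ i ]≔_) (trans (cong (_⊟_ (lookup x i)) h) (solve 1 (λ a → a :- con 0ℤ := a) refl (lookup x i))))
    ([]≔-lookup x i)

  vieta-moves : ∀ {i x} → partial i x ≢ 𝟘 → lookup (vieta i x) i ≢ lookup x i
  vieta-moves {i} {x} moves eq = moves (consequence (⊟ 𝟙)
    (trans (sym (lookup∘update i x (lookup x i ⊟ partial i x))) eq)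
    (solve 2 (λ a v → v :- con 0ℤ := :- con 1ℤ :* (a :- v :- a)) refl (lookup x i) (partial i x)))

  -- A flip that moves x changes coordinate i, which a flip at any other index leaves alone.
  vieta-injective : ∀ {x i j} → partial i x ≢ 𝟘 → partial j x ≢ 𝟘 → vieta i x ≡ vieta j x → i ≡ j
  vieta-injective {x} {i} {j} moves _ eq with i ≟ j
  ... | yes i≡j = i≡j
  ... | no  i≢j = contradiction
    (trans (cong (λ y → lookup y i) eq) (lookup∘update′ i≢j x (lookup x j ⊟ partial j x))) (vieta-moves {i} {x} moves)

open import Defs

-- Residues modulo p as a commutative ring, with inverses for prime p.

module Residues (p : ℕ) .{{_ : NonZero p}} where

  open ≡-Reasoning

  toℕ-mod : ∀ n → toℕ (n mod p) ≡ n % p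
  toℕ-mod n = Fin.toℕ-fromℕ< (ℕ.m%n<n n p)

  mod-cong : ∀ m n → m % p ≡ n % p → m mod p ≡ n mod p
  mod-cong m n eq = Fin.fromℕ<-cong (m % p) (n % p) eq (ℕ.m%n<n m p) (ℕ.m%n<n n p)

  mod-toℕ : ∀ (a : 𝔽 p) → toℕ a mod p ≡ a
  mod-toℕ a = Fin.toℕ-injective (trans (toℕ-mod (toℕ a)) (ℕ.m<n⇒m%n≡m (Fin.toℕ<n a)))

  mod-+ : ∀ m n → (m mod p) +ₚ (n mod p) ≡ (m ℕ.+ n) mod p
  mod-+ m n = mod-cong _ (m ℕ.+ n)
    (trans (cong₂ (λ i j → (i ℕ.+ j) % p) (toℕ-mod m) (toℕ-mod n)) (sym (ℕ.%-distribˡ-+ m n p)))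

  mod-* : ∀ m n → (m mod p) *ₚ (n mod p) ≡ (m ℕ.* n) mod p
  mod-* m n = mod-cong _ (m ℕ.* n)
    (trans (cong₂ (λ i j → (i ℕ.* j) % p) (toℕ-mod m) (toℕ-mod n)) (sym (ℕ.%-distribˡ-* m n p)))

  kp-mod : ∀ k → (k ℕ.* p) mod p ≡ 0ₚ
  kp-mod k = mod-cong (k ℕ.* p) 0 (ℕ.[m+kn]%n≡m%n 0 k p)

  p-mod : p mod p ≡ 0ₚ
  p-mod = trans (cong (_mod p) (sym (ℕ.*-identityˡ p))) (kp-mod 1)

  +ₚ-comm : ∀ a b → a +ₚ b ≡ b +ₚ a
  +ₚ-comm a b = cong (_mod p) (ℕ.+-comm (toℕ a) (toℕ b))

  *ₚ-comm : ∀ a b → a *ₚ b ≡ b *ₚ a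
  *ₚ-comm a b = cong (_mod p) (ℕ.*-comm (toℕ a) (toℕ b))

  -- Removes an inner reduction, so that the laws of addition come down to those of the natural
  -- numbers.
  +ₚ-modʳ : ∀ a n → a +ₚ (n mod p) ≡ (toℕ a ℕ.+ n) mod p
  +ₚ-modʳ a n = trans (cong (_+ₚ (n mod p)) (sym (mod-toℕ a))) (mod-+ (toℕ a) n)

  *ₚ-modʳ : ∀ a n → a *ₚ (n mod p) ≡ (toℕ a ℕ.* n) mod p
  *ₚ-modʳ a n = trans (cong (_*ₚ (n mod p)) (sym (mod-toℕ a))) (mod-* (toℕ a) n)

  +ₚ-assoc : ∀ a b c → (a +ₚ b) +ₚ c ≡ a +ₚ (b +ₚ c)
  +ₚ-assoc a b c = begin
    (a +ₚ b) +ₚ c                         ≡⟨ +ₚ-comm (a +ₚ b) c ⟩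
    c +ₚ (a +ₚ b)                         ≡⟨ +ₚ-modʳ c _ ⟩
    (toℕ c ℕ.+ (toℕ a ℕ.+ toℕ b)) mod p   ≡⟨ cong (_mod p) (ℕ.+-comm (toℕ c) _) ⟩
    (toℕ a ℕ.+ toℕ b ℕ.+ toℕ c) mod p     ≡⟨ cong (_mod p) (ℕ.+-assoc (toℕ a) _ _) ⟩
    (toℕ a ℕ.+ (toℕ b ℕ.+ toℕ c)) mod p   ≡⟨ +ₚ-modʳ a _ ⟨
    a +ₚ (b +ₚ c)                         ∎

  *ₚ-assoc : ∀ a b c → (a *ₚ b) *ₚ c ≡ a *ₚ (b *ₚ c)
  *ₚ-assoc a b c = begin
    (a *ₚ b) *ₚ c                         ≡⟨ *ₚ-comm (a *ₚ b) c ⟩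
    c *ₚ (a *ₚ b)                         ≡⟨ *ₚ-modʳ c _ ⟩
    (toℕ c ℕ.* (toℕ a ℕ.* toℕ b)) mod p   ≡⟨ cong (_mod p) (ℕ.*-comm (toℕ c) _) ⟩
    (toℕ a ℕ.* toℕ b ℕ.* toℕ c) mod p     ≡⟨ cong (_mod p) (ℕ.*-assoc (toℕ a) _ _) ⟩
    (toℕ a ℕ.* (toℕ b ℕ.* toℕ c)) mod p   ≡⟨ *ₚ-modʳ a _ ⟨
    a *ₚ (b *ₚ c)                         ∎

  +ₚ-identityʳ : ∀ a → a +ₚ 0ₚ ≡ a
  +ₚ-identityʳ a = trans (+ₚ-modʳ a 0) (trans (cong (_mod p) (ℕ.+-identityʳ _)) (mod-toℕ a))

  *ₚ-identityʳ : ∀ a → a *ₚ 1ₚ ≡ a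
  *ₚ-identityʳ a = trans (*ₚ-modʳ a 1) (trans (cong (_mod p) (ℕ.*-identityʳ _)) (mod-toℕ a))

  *ₚ-distribˡ : ∀ a b c → a *ₚ (b +ₚ c) ≡ a *ₚ b +ₚ a *ₚ c
  *ₚ-distribˡ a b c = begin
    a *ₚ (b +ₚ c)                                ≡⟨ *ₚ-modʳ a _ ⟩
    (toℕ a ℕ.* (toℕ b ℕ.+ toℕ c)) mod p          ≡⟨ cong (_mod p) (ℕ.*-distribˡ-+ (toℕ a) _ _) ⟩
    (toℕ a ℕ.* toℕ b ℕ.+ toℕ a ℕ.* toℕ c) mod p  ≡⟨ mod-+ (toℕ a ℕ.* toℕ b) _ ⟨
    a *ₚ b +ₚ a *ₚ c                             ∎

  *ₚ-distribʳ : ∀ a b c → (b +ₚ c) *ₚ a ≡ b *ₚ a +ₚ c *ₚ a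
  *ₚ-distribʳ a b c = trans (*ₚ-comm (b +ₚ c) a)
    (trans (*ₚ-distribˡ a b c) (cong₂ _+ₚ_ (*ₚ-comm a b) (*ₚ-comm a c)))

  -- Subtraction is defined by adding the natural number p ∸ b; this brings it to the form a + (-b)
  -- in which ring identities are solved.
  -ₚ≡+ₚ-ₚ : ∀ a b → a -ₚ b ≡ a +ₚ (-ₚ b)
  -ₚ≡+ₚ-ₚ a b = begin
    (toℕ a ℕ.+ (p ∸ toℕ b)) mod p               ≡⟨ +ₚ-modʳ a _ ⟨
    a +ₚ ((p ∸ toℕ b) mod p)                    ≡⟨ cong (a +ₚ_) (+ₚ-identityʳ _) ⟨
    a +ₚ (((p ∸ toℕ b) mod p) +ₚ 0ₚ)            ≡⟨ cong (a +ₚ_) (+ₚ-comm ((p ∸ toℕ b) mod p) 0ₚ) ⟩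
    a +ₚ (0ₚ +ₚ ((p ∸ toℕ b) mod p))            ≡⟨ cong (a +ₚ_) (+ₚ-modʳ 0ₚ _) ⟩
    a +ₚ (-ₚ b)                                 ∎

  -ₚ-inverseʳ : ∀ a → a +ₚ (-ₚ a) ≡ 0ₚ
  -ₚ-inverseʳ a = begin
    a +ₚ (-ₚ a)                      ≡⟨ -ₚ≡+ₚ-ₚ a a ⟨
    (toℕ a ℕ.+ (p ∸ toℕ a)) mod p    ≡⟨ cong (_mod p) (ℕ.m+[n∸m]≡n (ℕ.<⇒≤ (Fin.toℕ<n a))) ⟩
    p mod p                          ≡⟨ p-mod ⟩
    0ₚ                               ∎

  isCommutativeRing : IsCommutativeRing _≡_ _+ₚ_ _*ₚ_ (-ₚ_) 0ₚ 1ₚ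
  isCommutativeRing = record
    { isRing = record
      { +-isAbelianGroup = record
        { isGroup = record
          { isMonoid = record
            { isSemigroup = record
              { isMagma = record { isEquivalence = isEquivalence ; ∙-cong = cong₂ _+ₚ_ }
              ; assoc   = +ₚ-assoc
              }
            ; identity = (λ a → trans (+ₚ-comm 0ₚ a) (+ₚ-identityʳ a)) , +ₚ-identityʳ
            }
          ; inverse = (λ a → trans (+ₚ-comm (-ₚ a) a) (-ₚ-inverseʳ a)) , -ₚ-inverseʳ
          ; ⁻¹-cong = cong (-ₚ_)
          }
        ; comm = +ₚ-comm
        }
      ; *-cong     = cong₂ _*ₚ_
      ; *-assoc    = *ₚ-assoc
      ; *-identity = (λ a → trans (*ₚ-comm 1ₚ a) (*ₚ-identityʳ a)) , *ₚ-identityʳ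
      ; distrib    = *ₚ-distribˡ , *ₚ-distribʳ
      }
    ; *-comm = *ₚ-comm
    }

  commutativeRing : CommutativeRing _ _
  commutativeRing = record { isCommutativeRing = isCommutativeRing }

  toℕ≢0 : ∀ {a : 𝔽 p} → a ≢ 0ₚ → toℕ a ≢ 0
  toℕ≢0 {a} a≢0 eq = a≢0 (trans (sym (mod-toℕ a)) (cong (_mod p) eq))

  small-mod≢0 : ∀ {n} → n ≢ 0 → n ℕ.< p → n mod p ≢ 0ₚ
  small-mod≢0 {n} n≢0 n<p eq = n≢0 (begin
    n             ≡⟨ ℕ.m<n⇒m%n≡m n<p ⟨
    n % p         ≡⟨ toℕ-mod n ⟨
    toℕ (n mod p) ≡⟨ cong toℕ eq ⟩
    toℕ (0ₚ {p})  ≡⟨ toℕ-mod 0 ⟩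
    0 % p         ≡⟨ ℕ.m<n⇒m%n≡m (ℕ.≤-<-trans ℕ.z≤n n<p) ⟩
    0             ∎)

  inverse : Prime p → ∀ a → a ≢ 0ₚ → ∃ λ b → a *ₚ b ≡ 1ₚ
  inverse p-prime a a≢0
    with coprime-Bézout (prime⇒coprime p-prime {{ℕ.≢-nonZero (toℕ≢0 a≢0)}} (Fin.toℕ<n a))
  -- Over the natural numbers Bézout's identity has two sign forms. Here 1 + x p = y a, so y is the
  -- inverse.
  ... | Bézout.-+ x y eq = y mod p , (begin
    a *ₚ (y mod p)                 ≡⟨ *ₚ-modʳ a y ⟩
    (toℕ a ℕ.* y) mod p            ≡⟨ cong (_mod p) (trans (ℕ.*-comm (toℕ a) y) (sym eq)) ⟩
    (1 ℕ.+ x ℕ.* p) mod p          ≡⟨ mod-+ 1 (x ℕ.* p) ⟨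
    1ₚ +ₚ ((x ℕ.* p) mod p)        ≡⟨ cong (1ₚ +ₚ_) (kp-mod x) ⟩
    1ₚ +ₚ 0ₚ                       ≡⟨ +ₚ-identityʳ 1ₚ ⟩
    1ₚ                             ∎)
  -- Here 1 + y a = x p, so y a = -1 and the inverse is -y.
  ... | Bézout.+- x y eq = -ₚ (y mod p) , (begin
    a *ₚ -ₚ (y mod p)              ≡⟨ -‿distribʳ-* a (y mod p) ⟨
    -ₚ (a *ₚ (y mod p))            ≡⟨ cong (-ₚ_) (trans (*ₚ-modʳ a y) (cong (_mod p) (ℕ.*-comm (toℕ a) y))) ⟩
    -ₚ ((y ℕ.* toℕ a) mod p)       ≡⟨ ⁻¹-unique _ _ (begin
      1ₚ +ₚ ((y ℕ.* toℕ a) mod p)    ≡⟨ mod-+ 1 _ ⟩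
      (1 ℕ.+ y ℕ.* toℕ a) mod p      ≡⟨ cong (_mod p) eq ⟩
      (x ℕ.* p) mod p                ≡⟨ kp-mod x ⟩
      0ₚ                             ∎) ⟨
    1ₚ                             ∎)
    where
    open Algebra.Properties.Ring (CommutativeRing.ring commutativeRing) using (-‿distribʳ-*)
    open Algebra.Properties.AbelianGroup (CommutativeRing.+-abelianGroup commutativeRing)
      using () renaming (inverseˡ-unique to ⁻¹-unique)

-- Lengths of filtered lists as sums of indicators.

module _ {A : Set} {P : A → Set} (P? : Decidable P) where

  length-filter-∷ : ∀ x xs → length (filter P? (x ∷ xs)) ≡ bit (does (P? x)) ℕ.+ length (filter P? xs)
  length-filter-∷ x xs with does (P? x)
  ... | true  = refl
  ... | false = refl

  length-filter-map : ∀ {B : Set} (f : B → A) xs → length (filter P? (map f xs)) ≡ length (filter (P? ∘ f) xs)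
  length-filter-map f []       = refl
  length-filter-map f (x ∷ xs) with does (P? (f x))
  ... | true  = cong suc (length-filter-map f xs)
  ... | false = length-filter-map f xs

  filter-filter : ∀ {Q : A → Set} (Q? : Decidable Q) xs →
                  filter P? (filter Q? xs) ≡ filter (λ x → Q? x ×-dec P? x) xs
  filter-filter Q? [] = refl
  filter-filter Q? (x ∷ xs) with does (Q? x)
  ... | false = filter-filter Q? xs
  ... | true with does (P? x)
  ...   | true  = cong (x ∷_) (filter-filter Q? xs)
  ...   | false = filter-filter Q? xs

  -- Stated for an arbitrary enumeration `g`, because the induction replaces `g` by `g ∘ suc`.
  length-filter-product : ∀ {n} {B C : Set} (f : B → C → A) (g : Fin n → B) ys →
    + length (filter P? (cartesianProductWith f (tabulate g) ys)) ≡
    Sum.sum (λ i → + length (filter (P? ∘ f (g i)) ys))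
  length-filter-product {zero}  f g ys = refl
  length-filter-product {suc n} f g ys = begin
    + length (filter P? (map (f (g zero)) ys ++ rest))
      ≡⟨ cong (+_ ∘ length) (filter-++ P? (map (f (g zero)) ys) rest) ⟩
    + length (filter P? (map (f (g zero)) ys) ++ filter P? rest)
      ≡⟨ cong +_ (length-++ (filter P? (map (f (g zero)) ys))) ⟩
    + length (filter P? (map (f (g zero)) ys)) + + length (filter P? rest)
      ≡⟨ cong₂ (λ m k → + m + k) (length-filter-map (f (g zero)) ys) (length-filter-product f (g ∘ suc) ys) ⟩
    Sum.sum (λ i → + length (filter (P? ∘ f (g i)) ys)) ∎
    where
    open ≡-Reasoning
    rest = cartesianProductWith f (tabulate (g ∘ suc)) ys

length-filter-vectors : ∀ {p n} {P : Vec (𝔽 p) (suc n) → Set} (P? : Decidable P) →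
  + length (filter P? (vectors p (suc n))) ≡ Sum.sum (λ a → + length (filter (P? ∘ (a ∷_)) (vectors p n)))
length-filter-vectors {p} {n} P? = length-filter-product P? _∷_ (λ a → a) (vectors p n)

length-filter-vectors₀ : ∀ {p} {P : Vec (𝔽 p) 0 → Set} (P? : Decidable P) →
  + length (filter P? (vectors p 0)) ≡ [ P? [] ]
length-filter-vectors₀ P? with does (P? [])
... | true  = refl
... | false = refl

-- Injectivity is asked only where `P` holds: all flips that fix x have the same value x, so only
-- the indices that move x are separated.
unique-map-on : ∀ {A B : Set} {P : A → Set} {f : A → B} → (∀ {x y} → P x → P y → f x ≡ f y → x ≡ y) →
                ∀ {xs} → All P xs → Unique xs → Unique (map f xs)
unique-map-on inj []         []         = []
unique-map-on inj (px ∷ pxs) (x∉xs ∷ u) =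
  All.map⁺ (All.zipWith (λ (py , x≢y) eq → x≢y (inj px py eq)) (pxs , x∉xs)) ∷ unique-map-on inj pxs u

unique-length : ∀ {A : Set} {xs ys : List A} → Unique xs → Unique ys →
                (∀ {x} → x ∈ xs → x ∈ ys) → (∀ {x} → x ∈ ys → x ∈ xs) → length xs ≡ length ys
unique-length u v f g = ↭-length (∼bag⇒↭ (unique∧set⇒bag u v (mk⇔ f g)))

-- Orders and degrees of the Vieta graph as sums over the field.

module VietaGraph (p : ℕ) .{{_ : NonZero p}} (p-prime : Prime p) (p≥5 : p ≥ 5) (E : 𝔽 p) where

  open Residues p hiding (commutativeRing) renaming (inverse to inverse-mod)

  field′ : OddField p
  field′ = record
    { _⊞_ = _+ₚ_ ; _·_ = _*ₚ_ ; ⊟_ = -ₚ_ ; 𝟘 = 0ₚ ; 𝟙 = 1ₚ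
    ; isCommutativeRing = isCommutativeRing
    ; inverse = inverse-mod p-prime
    ; 2≢0 = λ h → small-mod≢0 {2} (λ ()) (ℕ.≤-trans (ℕ.s≤s (ℕ.s≤s (ℕ.s≤s ℕ.z≤n))) p≥5) (trans (sym (mod-+ 1 1)) h)
    ; 1<p = ℕ.≤-trans (ℕ.s≤s (ℕ.s≤s ℕ.z≤n)) p≥5
    }

  open DegreeSums field′
  open VietaFlips field′ E
  open ≡-Reasoning

  length-filter-⁴ : ∀ {P : Vec (𝔽 p) 4 → Set} (P? : Decidable P) →
    + length (filter P? (vectors p 4)) ≡ ∑⁴ (λ a b c d → [ P? (a ∷ b ∷ c ∷ d ∷ []) ])
  length-filter-⁴ P? =
    trans (length-filter-vectors P?) (∑-cong λ a →
    trans (length-filter-vectors (P? ∘ (a ∷_))) (∑-cong λ b →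
    trans (length-filter-vectors (λ x → P? (a ∷ b ∷ x))) (∑-cong λ c →
    trans (length-filter-vectors (λ x → P? (a ∷ b ∷ c ∷ x))) (∑-cong λ d →
    length-filter-vectors₀ (λ x → P? (a ∷ b ∷ c ∷ d ∷ x))))))

  σ≡η : ∀ a → σ a ≡ η a
  σ≡η a with a Fin.≟ 0ₚ | isSquare? a
  ... | yes refl | _            = sym η-0
  ... | no a≢0   | yes (b , eq) = sym (trans (cong η (sym eq)) (η-square {b} λ { refl → a≢0 (trans (sym eq) (zeroˡ 𝟘)) }))
  ... | no _     | no nonsq     = sym (η-nonsquare λ t eq → nonsq (t , eq))

  eval≡value : ∀ x → eval (quartic E) x ≡ value x
  eval≡value (a ∷ b ∷ c ∷ d ∷ []) = trans
    (-ₚ≡+ₚ-ₚ (total a b c d · total a b c d) (E · a · b · c · d)) (value-assoc a b c d)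

  eval-∂ : ∀ i x → eval (∂ i (quartic E)) x ≡ partial i x
  eval-∂ zero x@(_ ∷ _ ∷ _ ∷ _ ∷ []) =
    trans (-ₚ≡+ₚ-ₚ (∂square 𝟙 𝟘 𝟘 𝟘 x) (∂product 𝟙 𝟘 𝟘 𝟘 x)) (product-rule-1 x)
  eval-∂ (suc zero) x@(_ ∷ _ ∷ _ ∷ _ ∷ []) =
    trans (-ₚ≡+ₚ-ₚ (∂square 𝟘 𝟙 𝟘 𝟘 x) (∂product 𝟘 𝟙 𝟘 𝟘 x)) (product-rule-2 x)
  eval-∂ (suc (suc zero)) x@(_ ∷ _ ∷ _ ∷ _ ∷ []) =
    trans (-ₚ≡+ₚ-ₚ (∂square 𝟘 𝟘 𝟙 𝟘 x) (∂product 𝟘 𝟘 𝟙 𝟘 x)) (product-rule-3 x)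
  eval-∂ (suc (suc (suc zero))) x@(_ ∷ _ ∷ _ ∷ _ ∷ []) =
    trans (-ₚ≡+ₚ-ₚ (∂square 𝟘 𝟘 𝟘 𝟙 x) (∂product 𝟘 𝟘 𝟘 𝟙 x)) (product-rule-4 x)

  flip≡vieta : ∀ i x → flip E i x ≡ vieta i x
  flip≡vieta i x = cong (x [ i ]≔_) (trans
    (-ₚ≡+ₚ-ₚ (lookup x i) (eval (∂ i (quartic E)) x)) (cong (_⊟_ (lookup x i)) (eval-∂ i x)))

  movesAt? : ∀ x → Decidable (λ i → partial i x ≢ 𝟘)
  movesAt? x i = ¬? (partial i x Fin.≟ 𝟘)

  vieta-solution : ∀ i x → IsSolution E x → IsSolution E (vieta i x)
  vieta-solution i x sol = begin
    eval (quartic E) (vieta i x)  ≡⟨ eval≡value (vieta i x) ⟩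
    value (vieta i x)             ≡⟨ value-vieta i x ⟩
    value x                       ≡⟨ eval≡value x ⟨
    eval (quartic E) x            ≡⟨ sol ⟩
    0ₚ                            ∎

  open SimpleGraph (vietaGraph E)

  neighbours : Vec (𝔽 p) 4 → List (Vec (𝔽 p) 4)
  neighbours x = map (λ i → vieta i x) (filter (movesAt? x) (allFin 4))

  -- Adjacency allows the flip in either direction; since flips are involutions both give y =
  -- `vieta i x`, and x ≠ y excludes indices with vanishing derivative.
  adjacent⇒neighbour : ∀ {x y} → Adjacent E x y → y ∈ neighbours x
  adjacent⇒neighbour {x} {y} (x≢y , i , e) = subst (_∈ neighbours x) (sym y≡) (∈-map⁺ (λ i → vieta i x)
    (∈-filter⁺ (movesAt? x) (∈-allFin i) λ h → x≢y (sym (trans y≡ (vieta-fixed i x h)))))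
    where
    y≡ : y ≡ vieta i x
    y≡ = [ (λ eq → trans eq (flip≡vieta i x))
         , (λ eq → sym (trans (cong (vieta i) (trans eq (flip≡vieta i y))) (vieta-involutive i y)))
         ]′ e

  vieta-adjacent : ∀ i x → partial i x ≢ 𝟘 → Adjacent E x (vieta i x)
  vieta-adjacent i x moves = (λ eq → vieta-moves {i} {x} moves (cong (λ y → lookup y i) (sym eq)))
    , i , inj₁ (sym (flip≡vieta i x))

  neighbour⇒adjacent : ∀ {x y} → IsSolution E x → y ∈ neighbours x → IsSolution E y × Adjacent E x y
  neighbour⇒adjacent {x} {y} sol y∈ =
    let i , i∈ , y≡ = ∈-map⁻ (λ i → vieta i x) y∈
    in subst (λ y → IsSolution E y × Adjacent E x y) (sym y≡)
         (vieta-solution i x sol , vieta-adjacent i x (proj₂ (∈-filter⁻ (movesAt? x) {xs = allFin 4} i∈)))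

  degree≡length-neighbours : ∀ x → IsSolution E x → degree x ≡ length (neighbours x)
  degree≡length-neighbours x sol = unique-length
    (Unique.filter⁺ (adjacent? E x) unique)
    (unique-map-on (λ {i} {j} → vieta-injective {x} {i} {j}) (All.all-filter (movesAt? x) (allFin 4))
      (Unique.filter⁺ (movesAt? x) (Unique.allFin⁺ 4)))
    (λ y∈ → adjacent⇒neighbour (proj₂ (∈-filter⁻ (adjacent? E x) {xs = solutions E} y∈)))
    (λ y∈ → let y-sol , adj = neighbour⇒adjacent sol y∈
            in ∈-filter⁺ (adjacent? E x) (Equivalence.from (∈-solutions E) y-sol) adj)

  length-filter-allFin₄ : ∀ {P : Fin 4 → Set} (P? : Decidable P) → length (filter P? (allFin 4)) ≡
    count₄ (does (P? zero)) (does (P? (suc zero))) (does (P? (suc (suc zero)))) (does (P? (suc (suc (suc zero)))))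
  length-filter-allFin₄ P? =
    trans (length-filter-∷ P? i₀ (i₁ ∷ i₂ ∷ i₃ ∷ [])) (cong (bit (does (P? i₀)) ℕ.+_)
    (trans (length-filter-∷ P? i₁ (i₂ ∷ i₃ ∷ [])) (cong (bit (does (P? i₁)) ℕ.+_)
    (trans (length-filter-∷ P? i₂ (i₃ ∷ [])) (cong (bit (does (P? i₂)) ℕ.+_)
    (trans (length-filter-∷ P? i₃ []) (ℕ.+-identityʳ (bit (does (P? i₃))))))))))
    where
    i₀ i₁ i₂ i₃ : Fin 4
    i₀ = zero
    i₁ = suc zero
    i₂ = suc (suc zero)
    i₃ = suc (suc (suc zero))

  module _ (E≢0 : E ≢ 0ₚ) where

    degree≡#moves : ∀ a b c d → let x = a ∷ b ∷ c ∷ d ∷ [] in IsSolution E x → degree x ≡ #moves E≢0 a b c d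
    degree≡#moves a b c d sol = begin
      degree x                                    ≡⟨ degree≡length-neighbours x sol ⟩
      length (neighbours x)                       ≡⟨ length-map (λ i → vieta i x) (filter (movesAt? x) (allFin 4)) ⟩
      length (filter (movesAt? x) (allFin 4))     ≡⟨ length-filter-allFin₄ (movesAt? x) ⟩
      #moves E≢0 a b c d                          ∎
      where
      x : Vec (𝔽 p) 4
      x = a ∷ b ∷ c ∷ d ∷ []

    [isSolution]≡[solution] : ∀ a b c d → [ isSolution? E (a ∷ b ∷ c ∷ d ∷ []) ] ≡ [ solution? E≢0 a b c d ]
    [isSolution]≡[solution] a b c d = []-cong (isSolution? E x) (solution? E≢0 a b c d)
      (λ h → ⊟≡0⇒≡ {s · s} {E · m} (trans (sym (eval≡value x)) h))
      (λ h → trans (eval≡value x) (≡⇒⊟≡0 {s · s} {E · m} h))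
      where
      x : Vec (𝔽 p) 4
      x = a ∷ b ∷ c ∷ d ∷ []
      s m : F
      s = total a b c d
      m = product a b c d

    order≡ : + order ≡ q ^ 3 - + 1 - σ E * q
    order≡ = begin
      + order                                              ≡⟨ length-filter-⁴ (isSolution? E) ⟩
      ∑⁴ (λ a b c d → [ isSolution? E (a ∷ b ∷ c ∷ d ∷ []) ])  ≡⟨ ∑⁴-cong [isSolution]≡[solution] ⟩
      ∑⁴ (λ a b c d → [ solution? E≢0 a b c d ])           ≡⟨ #solutions E≢0 ⟩
      q ^ 3 - + 1 - η E * q                                ≡⟨ cong (λ x → q ^ 3 - + 1 - x * q) (σ≡η E) ⟨
      q ^ 3 - + 1 - σ E * q                                ∎

    #ofDegree≡∑-moves : ∀ k → + #ofDegree k ≡ ∑-moves E≢0 k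
    #ofDegree≡∑-moves k = begin
      + #ofDegree k
        ≡⟨ cong (+_ ∘ length) (filter-filter (λ x → degree x ℕ.≟ k) (isSolution? E) (vectors p 4)) ⟩
      + length (filter (λ x → isSolution? E x ×-dec (degree x ℕ.≟ k)) (vectors p 4))
        ≡⟨ length-filter-⁴ (λ x → isSolution? E x ×-dec (degree x ℕ.≟ k)) ⟩
      ∑⁴ (λ a b c d → [ isSolution? E (a ∷ b ∷ c ∷ d ∷ []) ×-dec (degree (a ∷ b ∷ c ∷ d ∷ []) ℕ.≟ k) ])
        ≡⟨ ∑⁴-cong pointwise ⟩
      ∑-moves E≢0 k ∎
      where
      pointwise : ∀ a b c d → [ isSolution? E (a ∷ b ∷ c ∷ d ∷ []) ×-dec (degree (a ∷ b ∷ c ∷ d ∷ []) ℕ.≟ k) ] ≡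
                  [ solution? E≢0 a b c d ] * [ #moves E≢0 a b c d ℕ.≟ k ]
      pointwise a b c d = begin
        [ isSolution? E x ×-dec (degree x ℕ.≟ k) ]
          ≡⟨ []-× (isSolution? E x) (degree x ℕ.≟ k) ⟩
        [ isSolution? E x ] * [ degree x ℕ.≟ k ]
          -- The degree is known only at solutions, so it is replaced under their indicator.
          ≡⟨ []-*-cong (isSolution? E x) (λ sol → cong (λ n → [ n ℕ.≟ k ]) (degree≡#moves a b c d sol)) ⟩
        [ isSolution? E x ] * [ #moves E≢0 a b c d ℕ.≟ k ]
          ≡⟨ cong (_* [ #moves E≢0 a b c d ℕ.≟ k ]) ([isSolution]≡[solution] a b c d) ⟩
        [ solution? E≢0 a b c d ] * [ #moves E≢0 a b c d ℕ.≟ k ] ∎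
        where
        x : Vec (𝔽 p) 4
        x = a ∷ b ∷ c ∷ d ∷ []

    #ofDegree-3 : + #ofDegree 3 ≡ + 4 * ((q - + 3) ^ 2 - + 2 * σ (-ₚ E) * (q - + 3))
    #ofDegree-3 = trans (#ofDegree≡∑-moves 3) (trans (#degree-3 E≢0)
      (cong (λ e → + 4 * ((q - + 3) ^ 2 - + 2 * e * (q - + 3))) (sym (σ≡η (-ₚ E)))))

    #ofDegree-2 : + #ofDegree 2 ≡ + 6 * (+ 1 + σ (-ₚ E)) * (q - + 3)
    #ofDegree-2 = trans (#ofDegree≡∑-moves 2) (trans (#degree-2 E≢0)
      (cong (λ e → + 6 * (+ 1 + e) * (q - + 3)) (sym (σ≡η (-ₚ E)))))

    #ofDegree-1 : + #ofDegree 1 ≡ + 4 * (q ^ 2 - + 3 * q + + 3 + σ (-ₚ E))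
    #ofDegree-1 = trans (#ofDegree≡∑-moves 1) (trans (#degree-1 E≢0)
      (cong (λ e → + 4 * (q ^ 2 - + 3 * q + + 3 + e)) (sym (σ≡η (-ₚ E)))))

    #ofDegree-0 : + #ofDegree 0 ≡ + 6 * q - + 5
    #ofDegree-0 = trans (#ofDegree≡∑-moves 0) (#degree-0 E≢0)

theorem15p2 : (p : ℕ) .{{_ : NonZero p}} → Prime p → p ≥ 5 →
    (E : 𝔽 p) → E ≢ 0ₚ →
    let open SimpleGraph (vietaGraph E) in
    (+ order ≡ (+ p) ^ 3 - + 1 - σ E * + p)
    × (+ #ofDegree 3 ≡
    + 4 * ((+ p - + 3) ^ 2 - + 2 * σ (-ₚ E) * (+ p - + 3)))
    × (+ #ofDegree 2 ≡ + 6 * (+ 1 + σ (-ₚ E)) * (+ p - + 3))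
    × (+ #ofDegree 1 ≡
    + 4 * ((+ p) ^ 2 - + 3 * + p + + 3 + σ (-ₚ E)))
    × (+ #ofDegree 0 ≡ + 6 * + p - + 5)
theorem15p2 p p-prime p≥5 E E≢0 =
  order≡ E≢0 , #ofDegree-3 E≢0 , #ofDegree-2 E≢0 , #ofDegree-1 E≢0 , #ofDegree-0 E≢0
  where open VietaGraph p p-prime p≥5 E
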